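{- The (partial) map $\psi:\omega(\mathbb{R}^n)\times\mathbb{R}^n\to\mathcal{A}(\mathbb{R}^n)$, $(f,x_0)\mapsto\overline{W^u_f(x_0)}$ (the closure of $W^u_f(x_0)$), is not computable, where $(f,x_0)\in\mathrm{dom}(\psi)$ if $x_0$ is a hyperbolic equilibrium point of $\dot{x}=f(x)$, and $W^u_f(x_0)$ is the global unstable manifold of $f$ at $x_0$.
   Context: $\omega(\mathbb{R}^n)$ is the set of real analytic functions $f:\mathbb{R}^n\to\mathbb{R}^n$; $\mathcal{A}(\mathbb{R}^n)$ is the set of all closed subsets of $\mathbb{R}^n$. A point $x_0$ is a hyperbolic equilibrium of $\dot{x}=f(x)$ if $f(x_0)=0$ and no eigenvalue of $Df(x_0)$ has zero real part. Global unstable manifold: $W^u_f(x_0)=\bigcup_{j=0}^\infty\phi_{j}(U)$, where $U$ is a local unstable manifold of $f$ at $x_0$ as given by the Stable Manifold Theorem and $\phi_t(A)=\{x(t): x \text{ is a solution of } \dot{x}=f(x) \text{ with } x(0)\in A\}$; equivalently, it is the set of all points whose solution is defined for all $t\le 0$ and converges to $x_0$ as $t\to-\infty$. Solutions are not required to exist for all times. Names: a $\rho$-name of a real $x$ is a sequence of rationals $r_k$ (coded by natural numbers) with $|r_k-x|\le 2^{ -k}$ for all $k$; names of points of $\mathbb{R}^n$ are componentwise; a name of a sequence of points consists of names of all its terms. Write $B(a,r)=\{x\in\mathbb{R}^n:|x-a|<r\}$ and fix a computable sequence of rational balls $B(a_k,r_k)$ with $\bigcup_k B(a_k,r_k)=\mathbb{R}^n$.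 A $\rho$-name of a function $f$ (here $f\in\omega(\mathbb{R}^n)$, regarded as a $C^1$ function) is a sequence $\{P_l\}$ of polynomial maps $\mathbb{R}^n\to\mathbb{R}^n$ with rational coefficients with $d(f,P_l)\le 2^{ -l}$ for all $l$, where $d(f,P)=\sum_{k=0}^\infty 2^{ -k}\left(\frac{\|f-P\|_k}{1+\|f-P\|_k}+\frac{\|Df-DP\|_k}{1+\|Df-DP\|_k}\right)$ and $\|g\|_k=\max_{x\in\overline{B(a_k,r_k)}}|g(x)|$. A name of a pair is a pair of names. A name of a closed set $X$ consists of (i) a name of a sequence of points of $\mathbb{R}^n$ dense in $X$, together with (ii) a sequence of pairs $(c_k,s_k)\in\mathbb{Q}^n\times\mathbb{Q}$ with $\mathbb{R}^n\setminus X=\bigcup_k B(c_k,s_k)$; the topology on $\mathcal{A}(\mathbb{R}^n)$ induced by these names is the Wijsman topology. Computability: a (partial) map $g$ is computable if there is a Type-2 machine (a Turing machine with infinite input sequence and one-way infinite output) that on any name of any $x\in\mathrm{dom}(g)$ outputs a name of $g(x)$. -}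

module Defs where

open import Data.Bool using (Bool; true; false; if_then_else_)
open import Data.Fin using (Fin; zero; suc)
open import Data.Integer as ℤ using ()
open import Data.List using (List; []; _∷_; _++_; applyUpTo; foldr)
open import Data.Maybe using (Maybe; just; nothing)
open import Data.Nat as ℕ using (ℕ; zero; suc)
import Data.Nat.Properties as ℕₚ
open import Data.Product using (Σ; ∃; ∃-syntax; _×_; _,_; proj₁; proj₂)
open import Data.Rational as ℚ using (ℚ; 0ℚ; 1ℚ; ½)
import Data.Rational.Properties as ℚₚ
open import Data.Rational.Solver using (module +-*-Solver)
open import Data.Vec using (Vec; []; _∷_; lookup; replicate; toList)
import Data.Vec as Vec
open import Data.Sum using (inj₁; inj₂)
open import Function using (_∘_; _⇔_)
open import Relation.Binary.PropositionalEquality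
  using (_≡_; refl; sym; trans; cong; cong₂; subst; subst₂)
open import Level using (0ℓ; _⊔_) renaming (suc to lsuc)
open import Relation.Nullary using (¬_)
open +-*-Solver using (solve; _:+_; _:*_; _:-_; :-_; con; _:=_)

infix  4 _≃_ _≤_ _<_ _≈_ _∈_
infix  4 _≃ᶜ_ _∈ᵇ_ _∈ᶜ_ _⟶_
infix  2 _⇀_
infixr 2 _⊗_
infixr 8 _^_
infixl 6 _+_ _-_ _⊞_ _⊟_ _+ᶜ_
infixl 7 _*_ _·_ _*ᶜ_ _⊡_
infix  8 -_

IsCauchy : (ℕ → ℚ) → Set
IsCauchy s = ∀ ε → 0ℚ ℚ.< ε →
  ∃[ N ] ∀ m n → N ℕ.≤ m → N ℕ.≤ n → ℚ.∣ s m ℚ.- s n ∣ ℚ.≤ ε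

record ℝ : Set where
  constructor mkℝ
  field
    seq    : ℕ → ℚ
    cauchy : IsCauchy seq

open ℝ public

_≃_ _≤_ _<_ : ℝ → ℝ → Set
x ≃ y = ∀ ε → 0ℚ ℚ.< ε → ∃[ N ] ∀ n → N ℕ.≤ n → ℚ.∣ seq x n ℚ.- seq y n ∣ ℚ.≤ ε
x ≤ y = ∀ ε → 0ℚ ℚ.< ε → ∃[ N ] ∀ n → N ℕ.≤ n → seq x n ℚ.≤ seq y n ℚ.+ ε
x < y = ∃[ ε ] 0ℚ ℚ.< ε × (∃[ N ] ∀ n → N ℕ.≤ n → seq x n ℚ.+ ε ℚ.≤ seq y n)

private
  ½-pos : ∀ {ε} → 0ℚ ℚ.< ε → 0ℚ ℚ.< ½ ℚ.* ε
  ½-pos {ε} 0<ε = subst (ℚ._< ½ ℚ.* ε) (ℚₚ.*-zeroʳ ½) (ℚₚ.*-monoʳ-<-pos ½ 0<ε)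

  halves : ∀ ε → ½ ℚ.* ε ℚ.+ ½ ℚ.* ε ≡ ε
  halves = solve 1 (λ e → con ½ :* e :+ con ½ :* e := e) refl

  ∣-∣-sub : ∀ p q → ℚ.∣ q ∣ ℚ.≤ ℚ.∣ p ∣ ℚ.+ ℚ.∣ q ℚ.- p ∣
  ∣-∣-sub p q = subst (ℚ._≤ ℚ.∣ p ∣ ℚ.+ ℚ.∣ q ℚ.- p ∣)
    (cong ℚ.∣_∣ (solve 2 (λ p q → p :+ (q :- p) := q) refl p q))
    (ℚₚ.∣p+q∣≤∣p∣+∣q∣ p (q ℚ.- p))

  ∣-∣-swap : ∀ p q → ℚ.∣ p ℚ.- q ∣ ≡ ℚ.∣ q ℚ.- p ∣
  ∣-∣-swap p q = trans (sym (ℚₚ.∣-p∣≡∣p∣ (p ℚ.- q)))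
    (cong ℚ.∣_∣ (solve 2 (λ p q → :- (p :- q) := q :- p) refl p q))

  ≤-move : ∀ {a b c} → a ℚ.≤ b ℚ.+ c → a ℚ.- b ℚ.≤ c
  ≤-move {a} {b} {c} h = subst (a ℚ.- b ℚ.≤_)
    (solve 2 (λ b c → b :+ c :- b := c) refl b c) (ℚₚ.+-monoˡ-≤ (ℚ.- b) h)

  ∣-∣-lip : ∀ p q → ℚ.∣ ℚ.∣ p ∣ ℚ.- ℚ.∣ q ∣ ∣ ℚ.≤ ℚ.∣ p ℚ.- q ∣
  ∣-∣-lip p q with ℚₚ.∣p∣≡p∨∣p∣≡-p (ℚ.∣ p ∣ ℚ.- ℚ.∣ q ∣)
  ... | inj₁ e = subst (ℚ._≤ ℚ.∣ p ℚ.- q ∣) (sym e) (≤-move (∣-∣-sub q p))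
  ... | inj₂ e = subst₂ ℚ._≤_
          (sym (trans e (solve 2 (λ a b → :- (a :- b) := b :- a) refl ℚ.∣ p ∣ ℚ.∣ q ∣)))
          (∣-∣-swap q p)
          (≤-move (∣-∣-sub p q))

  bounded : ∀ x → Σ ℚ λ B → ℚ.Positive B × (∃[ N ] ∀ n → N ℕ.≤ n → ℚ.∣ seq x n ∣ ℚ.≤ B)
  bounded x with cauchy x 1ℚ (ℚₚ.positive⁻¹ 1ℚ)
  ... | N , h = ℚ.∣ seq x N ∣ ℚ.+ 1ℚ
              , ℚₚ.nonNeg+pos⇒pos ℚ.∣ seq x N ∣ {{ℚₚ.∣-∣-nonNeg (seq x N)}} 1ℚ
              , N , λ n p → ℚₚ.≤-trans (∣-∣-sub (seq x N) (seq x n))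
                      (ℚₚ.+-monoʳ-≤ ℚ.∣ seq x N ∣ (h n N p ℕₚ.≤-refl))

  scale : ∀ B → ℚ.Positive B → ∀ ε → 0ℚ ℚ.< ε → Σ ℚ λ δ → 0ℚ ℚ.< δ × B ℚ.* δ ≡ ε
  scale B pB ε 0<ε = ℚ.1/ B ℚ.* ε , pos , eq
    where
    instance
      _ = pB
      nz : ℚ.NonZero B
      nz = ℚₚ.pos⇒nonZero B
      p1 : ℚ.Positive (ℚ.1/ B)
      p1 = ℚₚ.1/pos⇒pos B
    pos : 0ℚ ℚ.< ℚ.1/ B ℚ.* ε
    pos = subst (ℚ._< ℚ.1/ B ℚ.* ε) (ℚₚ.*-zeroʳ (ℚ.1/ B)) (ℚₚ.*-monoʳ-<-pos (ℚ.1/ B) 0<ε)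
    eq : B ℚ.* (ℚ.1/ B ℚ.* ε) ≡ ε
    eq = trans (sym (ℚₚ.*-assoc B (ℚ.1/ B) ε))
          (trans (cong (ℚ._* ε) (ℚₚ.*-inverseʳ B)) (ℚₚ.*-identityˡ ε))

  *-mono : ∀ {a b c d} → ℚ.∣ a ∣ ℚ.≤ b → ℚ.∣ c ∣ ℚ.≤ d → ℚ.Positive b → ℚ.∣ a ℚ.* c ∣ ℚ.≤ b ℚ.* d
  *-mono {a} {b} {c} {d} p q pb = begin
    ℚ.∣ a ℚ.* c ∣          ≡⟨ ℚₚ.∣p*q∣≡∣p∣*∣q∣ a c ⟩
    ℚ.∣ a ∣ ℚ.* ℚ.∣ c ∣     ≤⟨ ℚₚ.*-monoʳ-≤-nonNeg ℚ.∣ c ∣ {{ℚₚ.∣-∣-nonNeg c}} p ⟩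
    b ℚ.* ℚ.∣ c ∣           ≤⟨ ℚₚ.*-monoˡ-≤-nonNeg b {{ℚₚ.pos⇒nonNeg b {{pb}}}} q ⟩
    b ℚ.* d                 ∎
    where open ℚₚ.≤-Reasoning

abstract
  cauchy-const : ∀ q → IsCauchy (λ _ → q)
  cauchy-const q ε 0<ε = 0 , λ _ _ _ _ →
    subst (ℚ._≤ ε) (sym (cong ℚ.∣_∣ (ℚₚ.+-inverseʳ q))) (ℚₚ.<⇒≤ 0<ε)

  cauchy-+ : ∀ x y → IsCauchy (λ n → seq x n ℚ.+ seq y n)
  cauchy-+ x y ε 0<ε =
    let (M , hx) = cauchy x (½ ℚ.* ε) (½-pos 0<ε)
        (N , hy) = cauchy y (½ ℚ.* ε) (½-pos 0<ε)
    in M ℕ.⊔ N , λ m n p q → begin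
      ℚ.∣ seq x m ℚ.+ seq y m ℚ.- (seq x n ℚ.+ seq y n) ∣
        ≡⟨ cong ℚ.∣_∣ (solve 4 (λ a b c d → a :+ b :- (c :+ d) := (a :- c) :+ (b :- d))
                        refl (seq x m) (seq y m) (seq x n) (seq y n)) ⟩
      ℚ.∣ (seq x m ℚ.- seq x n) ℚ.+ (seq y m ℚ.- seq y n) ∣
        ≤⟨ ℚₚ.∣p+q∣≤∣p∣+∣q∣ (seq x m ℚ.- seq x n) (seq y m ℚ.- seq y n) ⟩
      ℚ.∣ seq x m ℚ.- seq x n ∣ ℚ.+ ℚ.∣ seq y m ℚ.- seq y n ∣
        ≤⟨ ℚₚ.+-mono-≤ (hx m n (ℕₚ.m⊔n≤o⇒m≤o M N p) (ℕₚ.m⊔n≤o⇒m≤o M N q))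
                        (hy m n (ℕₚ.m⊔n≤o⇒n≤o M N p) (ℕₚ.m⊔n≤o⇒n≤o M N q)) ⟩
      ½ ℚ.* ε ℚ.+ ½ ℚ.* ε ≡⟨ halves ε ⟩
      ε ∎
    where open ℚₚ.≤-Reasoning

  cauchy-neg : ∀ x → IsCauchy (λ n → ℚ.- seq x n)
  cauchy-neg x ε 0<ε =
    let (N , h) = cauchy x ε 0<ε in N , λ m n p q →
    subst (ℚ._≤ ε)
      (trans (∣-∣-swap (seq x m) (seq x n))
        (cong ℚ.∣_∣ (solve 2 (λ a b → b :- a := :- a :- (:- b)) refl (seq x m) (seq x n))))
      (h m n p q)

  cauchy-∣∣ : ∀ x → IsCauchy (λ n → ℚ.∣ seq x n ∣)
  cauchy-∣∣ x ε 0<ε =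
    let (N , h) = cauchy x ε 0<ε in N , λ m n p q →
    ℚₚ.≤-trans (∣-∣-lip (seq x m) (seq x n)) (h m n p q)

  cauchy-* : ∀ x y → IsCauchy (λ n → seq x n ℚ.* seq y n)
  cauchy-* x y ε 0<ε =
    let (A , pA , K , hA) = bounded x
        (B , pB , L , hB) = bounded y
        (δ , 0<δ , eδ) = scale A pA (½ ℚ.* ε) (½-pos 0<ε)
        (η , 0<η , eη) = scale B pB (½ ℚ.* ε) (½-pos 0<ε)
        (M , hy) = cauchy y δ 0<δ
        (N , hx) = cauchy x η 0<η
        lo = λ i (p : _ ℕ.≤ i) → ℕₚ.m⊔n≤o⇒m≤o (K ℕ.⊔ L) (M ℕ.⊔ N) p
        hi = λ i (p : _ ℕ.≤ i) → ℕₚ.m⊔n≤o⇒n≤o (K ℕ.⊔ L) (M ℕ.⊔ N) p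
    in (K ℕ.⊔ L) ℕ.⊔ (M ℕ.⊔ N) , λ m n p q → begin
      ℚ.∣ seq x m ℚ.* seq y m ℚ.- seq x n ℚ.* seq y n ∣
        ≡⟨ cong ℚ.∣_∣ (solve 4 (λ a b c d → a :* b :- c :* d := a :* (b :- d) :+ d :* (a :- c))
                        refl (seq x m) (seq y m) (seq x n) (seq y n)) ⟩
      ℚ.∣ seq x m ℚ.* (seq y m ℚ.- seq y n) ℚ.+ seq y n ℚ.* (seq x m ℚ.- seq x n) ∣
        ≤⟨ ℚₚ.∣p+q∣≤∣p∣+∣q∣ (seq x m ℚ.* (seq y m ℚ.- seq y n)) (seq y n ℚ.* (seq x m ℚ.- seq x n)) ⟩
      ℚ.∣ seq x m ℚ.* (seq y m ℚ.- seq y n) ∣ ℚ.+ ℚ.∣ seq y n ℚ.* (seq x m ℚ.- seq x n) ∣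
        ≤⟨ ℚₚ.+-mono-≤
             (*-mono (hA m (ℕₚ.m⊔n≤o⇒m≤o K L (lo m p)))
                     (hy m n (ℕₚ.m⊔n≤o⇒m≤o M N (hi m p)) (ℕₚ.m⊔n≤o⇒m≤o M N (hi n q))) pA)
             (*-mono (hB n (ℕₚ.m⊔n≤o⇒n≤o K L (lo n q)))
                     (hx m n (ℕₚ.m⊔n≤o⇒n≤o M N (hi m p)) (ℕₚ.m⊔n≤o⇒n≤o M N (hi n q))) pB) ⟩
      A ℚ.* δ ℚ.+ B ℚ.* η         ≡⟨ cong₂ ℚ._+_ eδ eη ⟩
      ½ ℚ.* ε ℚ.+ ½ ℚ.* ε         ≡⟨ halves ε ⟩
      ε ∎
    where open ℚₚ.≤-Reasoning

const : ℚ → ℝ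
const q = mkℝ (λ _ → q) (cauchy-const q)

0ℝ 1ℝ : ℝ
0ℝ = const 0ℚ
1ℝ = const 1ℚ

-_ ∣_∣ : ℝ → ℝ
- x   = mkℝ (λ n → ℚ.- seq x n) (cauchy-neg x)
∣ x ∣ = mkℝ (λ n → ℚ.∣ seq x n ∣) (cauchy-∣∣ x)

_+_ _*_ _-_ : ℝ → ℝ → ℝ
x + y = mkℝ (λ n → seq x n ℚ.+ seq y n) (cauchy-+ x y)
x * y = mkℝ (λ n → seq x n ℚ.* seq y n) (cauchy-* x y)
x - y = x + (- y)

_^_ : ℝ → ℕ → ℝ
x ^ zero  = 1ℝ
x ^ suc k = x * x ^ k

2⁻ : ℕ → ℚ
2⁻ zero    = 1ℚ
2⁻ (suc k) = ½ ℚ.* 2⁻ k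

sumℕ : (ℕ → ℝ) → ℕ → ℝ
sumℕ a zero    = 0ℝ
sumℕ a (suc N) = sumℕ a N + a N

_⟶_ : (ℕ → ℝ) → ℝ → Set
a ⟶ l = ∀ ε → 0ℚ ℚ.< ε → ∃[ N ] ∀ m → N ℕ.≤ m → ∣ a m - l ∣ ≤ const ε

Point : ℕ → Set
Point n = Fin n → ℝ

Matrix : ℕ → Set
Matrix n = Fin n → Fin n → ℝ

_≈_ : ∀ {n} → Point n → Point n → Set
x ≈ y = ∀ i → x i ≃ y i

_⊞_ _⊟_ : ∀ {n} → Point n → Point n → Point n
(x ⊞ y) i = x i + y i
(x ⊟ y) i = x i - y i

_⊡_ : ∀ {n} → ℝ → Point n → Point n
(c ⊡ x) i = c * x i

0ⁿ : ∀ {n} → Point n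
0ⁿ _ = 0ℝ

sum : ∀ {n} → (Fin n → ℝ) → ℝ
sum {zero}  u = 0ℝ
sum {suc n} u = u zero + sum (u ∘ suc)

prod : ∀ {n} → (Fin n → ℝ) → ℝ
prod {zero}  u = 1ℝ
prod {suc n} u = u zero * prod (u ∘ suc)

_·_ : ∀ {n} → Matrix n → Point n → Point n
(A · v) i = sum λ j → A i j * v j

∥_∥² : ∀ {n} → Point n → ℝ
∥ x ∥² = sum λ i → x i * x i

-- r is the Euclidean norm of v.
Norm : ∀ {n} → Point n → ℝ → Set
Norm v r = 0ℝ ≤ r × r * r ≃ ∥ v ∥²

-- Euclidean balls |x - a| < r and |x - a| ≤ r.  Radii are rational, not
-- assumed positive: an open ball of radius r ≤ 0 is empty.
OpenBall ClosedBall : ∀ {n} → Point n → ℚ → Point n → Set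
OpenBall   a r x = 0ℚ ℚ.< r × ∥ x ⊟ a ∥² < const (r ℚ.* r)
ClosedBall a r x = 0ℚ ℚ.≤ r × ∥ x ⊟ a ∥² ≤ const (r ℚ.* r)

-- m is the maximum over x ∈ K of a quantity given by its graph V.
MaxOn : ∀ {n} → (Point n → Set) → (Point n → ℝ → Set) → ℝ → Set
MaxOn K V m = (∃[ x ] K x × V x m) × (∀ x r → K x → V x r → r ≤ m)

-- Operator norm: max of |A v| over |v| ≤ 1.
OpNorm : ∀ {n} → Matrix n → ℝ → Set
OpNorm A = MaxOn (ClosedBall 0ⁿ 1ℚ) (λ v → Norm (A · v))

ι : ∀ {n} → Vec ℚ n → Point n
ι a i = const (lookup a i)

Closure : ∀ {n} → (Point n → Set) → Point n → Set
Closure W x = ∀ ε → 0ℚ ℚ.< ε → ∃[ w ] W w × OpenBall w ε x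

-- 𝒜(ℝⁿ)
record ClosedSet (n : ℕ) : Set₁ where
  field
    _∋_    : Point n → Set
    closed : ∀ x → Closure _∋_ x → _∋_ x

_∈_ : ∀ {n} → Point n → ClosedSet n → Set
x ∈ X = ClosedSet._∋_ X x

private
  sq≥0 : ∀ p → 0ℚ ℚ.≤ p ℚ.* p
  sq≥0 p with ℚₚ.∣p∣≡p∨∣p∣≡-p p
  ... | inj₁ e = ℚₚ.nonNegative⁻¹ (p ℚ.* p) {{ℚₚ.nonNeg*nonNeg⇒nonNeg p {{q}} p {{q}}}}
    where q = subst ℚ.NonNegative e (ℚₚ.∣-∣-nonNeg p)
  ... | inj₂ e = subst (0ℚ ℚ.≤_) (solve 1 (λ p → (:- p) :* (:- p) := p :* p) refl p)
          (ℚₚ.nonNegative⁻¹ (ℚ.- p ℚ.* ℚ.- p)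
            {{ℚₚ.nonNeg*nonNeg⇒nonNeg (ℚ.- p) {{q}} (ℚ.- p) {{q}}}})
    where q = subst ℚ.NonNegative e (ℚₚ.∣-∣-nonNeg p)

  sq-+ : ∀ b c → (b ℚ.+ c) ℚ.* (b ℚ.+ c) ℚ.≤ (b ℚ.* b ℚ.+ b ℚ.* b) ℚ.+ (c ℚ.* c ℚ.+ c ℚ.* c)
  sq-+ b c = subst₂ ℚ._≤_ (ℚₚ.+-identityʳ ((b ℚ.+ c) ℚ.* (b ℚ.+ c)))
      (solve 2 (λ b c → (b :+ c) :* (b :+ c) :+ (b :- c) :* (b :- c)
                          := (b :* b :+ b :* b) :+ (c :* c :+ c :* c)) refl b c)
      (ℚₚ.+-monoʳ-≤ ((b ℚ.+ c) ℚ.* (b ℚ.+ c)) (sq≥0 (b ℚ.- c)))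

  sq-ineq : ∀ x w v → let a = x ℚ.- v ; b = x ℚ.- w ; c = w ℚ.- v in
            a ℚ.* a ℚ.≤ (b ℚ.* b ℚ.+ b ℚ.* b) ℚ.+ (c ℚ.* c ℚ.+ c ℚ.* c)
  sq-ineq x w v = subst (λ a → a ℚ.* a ℚ.≤ (b ℚ.* b ℚ.+ b ℚ.* b) ℚ.+ (c ℚ.* c ℚ.+ c ℚ.* c))
    (solve 3 (λ x w v → (x :- w) :+ (w :- v) := x :- v) refl x w v) (sq-+ b c)
    where
    b = x ℚ.- w
    c = w ℚ.- v

  regroup : ∀ p q r s → ((p ℚ.+ p) ℚ.+ (q ℚ.+ q)) ℚ.+ ((r ℚ.+ r) ℚ.+ (s ℚ.+ s))
                      ≡ ((p ℚ.+ r) ℚ.+ (p ℚ.+ r)) ℚ.+ ((q ℚ.+ s) ℚ.+ (q ℚ.+ s))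
  regroup = solve 4 (λ p q r s → ((p :+ p) :+ (q :+ q)) :+ ((r :+ r) :+ (s :+ s))
                              := ((p :+ r) :+ (p :+ r)) :+ ((q :+ s) :+ (q :+ s))) refl

  four-quarters : ∀ ε → let H = (½ ℚ.* ε) ℚ.* (½ ℚ.* ε) in (H ℚ.+ H) ℚ.+ (H ℚ.+ H) ≡ ε ℚ.* ε
  four-quarters = solve 1 (λ ε → let H = (con ½ :* ε) :* (con ½ :* ε) in
                               (H :+ H) :+ (H :+ H) := ε :* ε) refl

  ≤-drop : ∀ {a e b} → 0ℚ ℚ.< e → a ℚ.+ e ℚ.≤ b → a ℚ.≤ b
  ≤-drop {a} {e} 0<e h =
    ℚₚ.≤-trans (subst (ℚ._≤ a ℚ.+ e) (ℚₚ.+-identityʳ a) (ℚₚ.+-monoʳ-≤ a (ℚₚ.<⇒≤ 0<e))) h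

  sum-≤ : ∀ a B C H e → a ℚ.≤ (B ℚ.+ B) ℚ.+ (C ℚ.+ C) → 0ℚ ℚ.< e →
          B ℚ.+ e ℚ.≤ H → C ℚ.≤ H → a ℚ.+ e ℚ.≤ (H ℚ.+ H) ℚ.+ (H ℚ.+ H)
  sum-≤ a B C H e ha 0<e hB hC = begin
    a ℚ.+ e                            ≤⟨ ℚₚ.+-monoˡ-≤ e ha ⟩
    (B ℚ.+ B) ℚ.+ (C ℚ.+ C) ℚ.+ e
      ≡⟨ solve 3 (λ B C e → (B :+ B) :+ (C :+ C) :+ e := ((B :+ e) :+ B) :+ (C :+ C)) refl B C e ⟩
    ((B ℚ.+ e) ℚ.+ B) ℚ.+ (C ℚ.+ C)    ≤⟨ ℚₚ.+-mono-≤ (ℚₚ.+-mono-≤ hB (≤-drop {B} {e} {H} 0<e hB)) (ℚₚ.+-mono-≤ hC hC) ⟩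
    (H ℚ.+ H) ℚ.+ (H ℚ.+ H)            ∎
    where open ℚₚ.≤-Reasoning

  norm-ineq : ∀ {n} (x w v : Point n) k →
    let b = seq ∥ x ⊟ w ∥² k ; c = seq ∥ w ⊟ v ∥² k in
    seq ∥ x ⊟ v ∥² k ℚ.≤ (b ℚ.+ b) ℚ.+ (c ℚ.+ c)
  norm-ineq {zero}  x w v k = ℚₚ.≤-refl
  norm-ineq {suc n} x w v k = subst (seq ∥ x ⊟ v ∥² k ℚ.≤_)
    (regroup (b ℚ.* b) (c ℚ.* c)
             (seq ∥ (x ∘ suc) ⊟ (w ∘ suc) ∥² k) (seq ∥ (w ∘ suc) ⊟ (v ∘ suc) ∥² k))
    (ℚₚ.+-mono-≤ (sq-ineq (seq (x zero) k) (seq (w zero) k) (seq (v zero) k))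
                 (norm-ineq (x ∘ suc) (w ∘ suc) (v ∘ suc) k))
    where
    b = seq (x zero) k ℚ.- seq (w zero) k
    c = seq (w zero) k ℚ.- seq (v zero) k

  closure-idem : ∀ {n} (W : Point n → Set) x → Closure (Closure W) x → Closure W x
  closure-idem W x cl ε 0<ε with cl (½ ℚ.* ε) (½-pos 0<ε)
  ... | w , cw , _ , (e , 0<e , M , h) with cw (½ ℚ.* ε) (½-pos 0<ε)
  ... | v , v∈W , _ , (d , 0<d , N , g) = v , v∈W , 0<ε , e , 0<e , M ℕ.⊔ N , λ k p →
    subst (seq ∥ x ⊟ v ∥² k ℚ.+ e ℚ.≤_) (four-quarters ε)
      (sum-≤ (seq ∥ x ⊟ v ∥² k) (seq ∥ x ⊟ w ∥² k) (seq ∥ w ⊟ v ∥² k) H e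
        (norm-ineq x w v k) 0<e
        (h k (ℕₚ.m⊔n≤o⇒m≤o M N p))
        (≤-drop {seq ∥ w ⊟ v ∥² k} {d} {H} 0<d (g k (ℕₚ.m⊔n≤o⇒n≤o M N p))))
    where H = (½ ℚ.* ε) ℚ.* (½ ℚ.* ε)

closure : ∀ {n} → (Point n → Set) → ClosedSet n
closure W = record { _∋_ = Closure W ; closed = closure-idem W }

-- Fréchet derivative: |f(a+h) - f(a) - A h| ≤ ε |h| for |h| ≤ δ, squared.
IsDerivativeAt : ∀ {n} → (Point n → Point n) → Point n → Matrix n → Set
IsDerivativeAt f a A = ∀ ε → 0ℚ ℚ.< ε → ∃[ δ ] 0ℚ ℚ.< δ ×
  (∀ h → ClosedBall 0ⁿ δ h →
    ∥ (f (a ⊞ h) ⊟ f a) ⊟ A · h ∥² ≤ const (ε ℚ.* ε) * ∥ h ∥²)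

IsJacobian : ∀ {n} → (Point n → Point n) → (Point n → Matrix n) → Set
IsJacobian f J = ∀ a → IsDerivativeAt f a (J a)

MultiIndex : ℕ → Set
MultiIndex n = Vec ℕ n

monomial : ∀ {n} → MultiIndex n → Point n → ℝ
monomial α x = prod λ i → x i ^ lookup α i

-- The sum of u α over all α ∈ {0,…,N-1}ⁿ.
boxSum : ∀ {n} → (MultiIndex n → ℝ) → ℕ → ℝ
boxSum {zero}  u N = u []
boxSum {suc n} u N = sumℕ (λ k → boxSum (λ α → u (k ∷ α)) N) N

-- The family u is absolutely summable with sum s.  For absolutely summable
-- families the order of summation is immaterial, so boxes suffice.
HasSum : ∀ {n} → (MultiIndex n → ℝ) → ℝ → Set
HasSum u s = (∃[ b ] boxSum (λ α → ∣ u α ∣) ⟶ b) × (boxSum u ⟶ s)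

IsAnalytic : ∀ {n} → (Point n → Point n) → Set
IsAnalytic {n} f = ∀ a → ∃[ r ] 0ℚ ℚ.< r ×
  (Σ (Fin n → MultiIndex n → ℝ) λ c → ∀ x → OpenBall a r x →
    ∀ i → HasSum (λ α → c i α * monomial α (x ⊟ a)) (f x i))

-- ω(ℝⁿ)
record ω (n : ℕ) : Set where
  field
    fun      : Point n → Point n
    cong-fun : ∀ x y → x ≈ y → fun x ≈ fun y
    analytic : IsAnalytic fun

open ω public

ℂ : Set
ℂ = ℝ × ℝ

re : ℂ → ℝ
re = proj₁

0ᶜ : ℂ
0ᶜ = 0ℝ , 0ℝ

_≃ᶜ_ : ℂ → ℂ → Set
(a , b) ≃ᶜ (c , d) = a ≃ c × b ≃ d

_+ᶜ_ _*ᶜ_ : ℂ → ℂ → ℂ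
(a , b) +ᶜ (c , d) = a + c , b + d
(a , b) *ᶜ (c , d) = a * c - b * d , a * d + b * c

sumᶜ : ∀ {n} → (Fin n → ℂ) → ℂ
sumᶜ {zero}  u = 0ᶜ
sumᶜ {suc n} u = u zero +ᶜ sumᶜ (u ∘ suc)

IsEigenvalue : ∀ {n} → Matrix n → ℂ → Set
IsEigenvalue {n} A μ = Σ (Fin n → ℂ) λ v →
  ¬ (∀ i → v i ≃ᶜ 0ᶜ) × (∀ i → sumᶜ (λ j → (A i j , 0ℝ) *ᶜ v j) ≃ᶜ μ *ᶜ v i)

HyperbolicEquilibrium : ∀ {n} → (Point n → Point n) → Point n → Set
HyperbolicEquilibrium f x₀ = f x₀ ≈ 0ⁿ ×
  (∃[ A ] IsDerivativeAt f x₀ A × (∀ μ → IsEigenvalue A μ → ¬ (re μ ≃ 0ℝ)))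

-- y solves ẏ = f(y) on (-∞,0] (one-sided derivative at 0); the values of y
-- at positive times play no role.
record BackwardSolution {n} (f : Point n → Point n) (y : ℝ → Point n) : Set where
  field
    cong-y     : ∀ s t → s ≤ 0ℝ → t ≤ 0ℝ → s ≃ t → y s ≈ y t
    derivative : ∀ t → t ≤ 0ℝ → ∀ ε → 0ℚ ℚ.< ε → ∃[ δ ] 0ℚ ℚ.< δ ×
      (∀ s → s ≤ 0ℝ → ∣ s - t ∣ ≤ const δ →
        ∥ (y s ⊟ y t) ⊟ (s - t) ⊡ f (y t) ∥² ≤ const (ε ℚ.* ε) * ((s - t) * (s - t)))

TendsToAt-∞ : ∀ {n} → (ℝ → Point n) → Point n → Set
TendsToAt-∞ y x₀ = ∀ ε → 0ℚ ℚ.< ε →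
  ∃[ T ] ∀ t → t ≤ 0ℝ → t ≤ const T → ClosedBall x₀ ε (y t)

-- Points whose solution exists for all t ≤ 0 and tends to x₀ as t → -∞; this
-- is ⋃ⱼ φⱼ(U) for any local unstable manifold U at x₀.
UnstableManifold : ∀ {n} → (Point n → Point n) → Point n → Point n → Set
UnstableManifold f x₀ x =
  ∃[ y ] BackwardSolution f y × y 0ℝ ≈ x × TendsToAt-∞ y x₀

-- Cantor's enumeration of ℕ × ℕ along antidiagonals.
next : ℕ × ℕ → ℕ × ℕ
next (zero  , b) = suc b , 0
next (suc a , b) = a , suc b

unpair : ℕ → ℕ × ℕ
unpair zero    = 0 , 0
unpair (suc k) = next (unpair k)

triangle : ℕ → ℕ
triangle zero    = 0
triangle (suc k) = suc k ℕ.+ triangle k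

-- The inverse of unpair.
pair : ℕ → ℕ → ℕ
pair a b = triangle (a ℕ.+ b) ℕ.+ b

decodeℚ : ℕ → ℚ
decodeℚ k =
  let (num , den) = unpair k
      (p , m)     = unpair num
  in (p ℤ.⊖ m) ℚ./ suc den

decodeVec : ∀ n → ℕ → Vec ℕ n
decodeVec zero    k = []
decodeVec (suc n) k = let (a , b) = unpair k in a ∷ decodeVec n b

decodeℚⁿ : ∀ n → ℕ → Vec ℚ n
decodeℚⁿ n k = Vec.map decodeℚ (decodeVec n k)

-- Polynomials with rational coefficients, as lists of terms; a multi-index
-- may occur more than once.
Poly : ℕ → Set
Poly n = List (ℚ × MultiIndex n)

PolyMap : ℕ → Set
PolyMap n = Vec (Poly n) n

⟦_⟧ : ∀ {n} → Poly n → Point n → ℝ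
⟦ P ⟧ x = foldr (λ (c , α) s → const c * monomial α x + s) 0ℝ P

⟦_⟧ᵐ : ∀ {n} → PolyMap n → Point n → Point n
⟦ P ⟧ᵐ x i = ⟦ lookup P i ⟧ x

decodeTerm : ∀ n → ℕ → ℚ × MultiIndex n
decodeTerm n k = let (c , α) = unpair k in decodeℚ c , decodeVec n α

decodePoly : ∀ n → ℕ → Poly n
decodePoly n k =
  let (len , body) = unpair k
  in toList (Vec.map (decodeTerm n) (decodeVec len body))

decodePolyMap : ∀ n → ℕ → PolyMap n
decodePolyMap n k = Vec.map (decodePoly n) (decodeVec n k)

RationalBall : ℕ → Set
RationalBall n = Vec ℚ n × ℚ

decodeBall : ∀ n → ℕ → RationalBall n
decodeBall n k = let (c , s) = unpair k in decodeℚⁿ n c , decodeℚ s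

_∈ᵇ_ _∈ᶜ_ : ∀ {n} → Point n → RationalBall n → Set
x ∈ᵇ (c , s) = OpenBall (ι c) s x
x ∈ᶜ (c , s) = ClosedBall (ι c) s x

data Move : Set where
  left stay right : Move

record Action (State Symbol : Set) (tapes : ℕ) : Set where
  field
    goto    : State
    advance : Bool
    work    : Vec (Symbol × Move) tapes
    emit    : Maybe Bool

-- One one-way read-only input tape and one one-way write-only output tape
-- over {0,1}, and finitely many two-way work tapes over a finite alphabet
-- whose symbol zero is the blank.  Since outputs are infinite there is no
-- halting state.
record Machine : Set where
  field
    states tapes symbols : ℕ

  State  = Fin (suc states)
  Symbol = Fin (suc symbols)

  field
    δ : State → Bool → Vec Symbol tapes → Action State Symbol tapes

module Run (M : Machine) where
  open Machine M

  -- The list on the left of the head is reversed; beyond both lists the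
  -- tape is blank.
  record Tape : Set where
    constructor tape
    field
      before : List Symbol
      head   : Symbol
      after  : List Symbol

  blank : Tape
  blank = tape [] zero []

  shift : Move → Tape → Tape
  shift left  (tape []       s rs) = tape [] zero (s ∷ rs)
  shift left  (tape (l ∷ ls) s rs) = tape ls l (s ∷ rs)
  shift stay  t                    = t
  shift right (tape ls s [])       = tape (s ∷ ls) zero []
  shift right (tape ls s (r ∷ rs)) = tape (s ∷ ls) r rs

  update : Tape → Symbol × Move → Tape
  update t (s , m) = shift m (record t { head = s })

  record Config : Set where
    field
      state    : State
      position : ℕ
      work     : Vec Tape tapes
      output   : List Bool

  initial : Config
  initial = record
    { state = zero ; position = 0 ; work = replicate tapes blank ; output = [] }

  write : Maybe Bool → List Bool → List Bool
  write nothing  o = o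
  write (just b) o = o ++ b ∷ []

  step : (ℕ → Bool) → Config → Config
  step input c =
    let open Config c
        a = δ state (input position) (Vec.map Tape.head work)
    in record
      { state    = Action.goto a
      ; position = if Action.advance a then suc position else position
      ; work     = Vec.zipWith update work (Action.work a)
      ; output   = write (Action.emit a) output
      }

  run : (ℕ → Bool) → ℕ → Config
  run input zero    = initial
  run input (suc t) = step input (run input t)

-- The sequence 1^c 0 1^{p 0} 0 1^{p 1} 0 …
unaryFrom : ℕ → (ℕ → ℕ) → ℕ → Bool
unaryFrom zero    p zero    = false
unaryFrom zero    p (suc i) = unaryFrom (p 0) (p ∘ suc) i
unaryFrom (suc c) p zero    = true
unaryFrom (suc c) p (suc i) = unaryFrom c p i

unary : (ℕ → ℕ) → ℕ → Bool
unary p = unaryFrom (p 0) (p ∘ suc)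

-- On input p the machine outputs the infinite sequence q.  At most one
-- symbol is written per step, so every prefix appears at some time.
Outputs : Machine → (ℕ → ℕ) → (ℕ → ℕ) → Set
Outputs M p q = ∀ m → ∃[ t ]
  Run.Config.output (Run.run M (unary p) t) ≡ applyUpTo (unary q) m

-- A computable sequence of codes: the output of a machine on a trivial input.
ComputableSeq : (ℕ → ℕ) → Set
ComputableSeq q = ∃[ M ] Outputs M (λ _ → 0) q

-- δ p x means that p is a name of x.
Representation : ∀ {ℓ} → Set ℓ → Set (ℓ ⊔ lsuc 0ℓ)
Representation X = (ℕ → ℕ) → X → Set

fst snd : (ℕ → ℕ) → ℕ → ℕ
fst p k = proj₁ (unpair (p k))
snd p k = proj₂ (unpair (p k))

_⊗_ : {X Y : Set} → Representation X → Representation Y → Representation (X × Y)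
(δ ⊗ δ′) p (x , y) = δ (fst p) x × δ′ (snd p) y

sequenceRep : {X : Set} → Representation X → Representation (ℕ → X)
sequenceRep δ p x = ∀ j → δ (λ k → p (pair j k)) (x j)

ρ : Representation ℝ
ρ p x = ∀ k → ∣ const (decodeℚ (p k)) - x ∣ ≤ const (2⁻ k)

-- The k-th entry codes the n-tuple of k-th entries of names of the components.
ρⁿ : ∀ n → Representation (Point n)
ρⁿ n p x = ∀ i → ρ (λ k → lookup (decodeVec n (p k)) i) (x i)

-- q = s / (1 + s), for s ≥ 0.
IsRatio : ℝ → ℝ → Set
IsRatio s q = q * (1ℝ + s) ≃ s

-- d is the distance d(f,g) of the C¹ functions f and g, relative to the
-- sequence of balls B.
Distance : ∀ {n} → (ℕ → RationalBall n) → (Point n → Point n) → (Point n → Point n) → ℝ → Set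
Distance {n} B f g d =
  ∃[ Df ] ∃[ Dg ] IsJacobian f Df × IsJacobian g Dg ×
  (Σ (ℕ → ℝ) λ s → Σ (ℕ → ℝ) λ s′ → Σ (ℕ → ℝ) λ u → Σ (ℕ → ℝ) λ u′ →
    (∀ k → MaxOn (_∈ᶜ B k) (λ x → Norm (f x ⊟ g x)) (s k)) ×
    (∀ k → MaxOn (_∈ᶜ B k) (λ x → OpNorm (λ i j → Df x i j - Dg x i j)) (s′ k)) ×
    (∀ k → IsRatio (s k) (u k)) ×
    (∀ k → IsRatio (s′ k) (u′ k)) ×
    (sumℕ (λ k → const (2⁻ k) * (u k + u′ k)) ⟶ d))

ωRep : ∀ {n} → (ℕ → RationalBall n) → Representation (ω n)
ωRep {n} B p f = ∀ l →
  ∃[ d ] Distance B (fun f) ⟦ decodePolyMap n (p l) ⟧ᵐ d × d ≤ const (2⁻ l)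

DenseIn : ∀ {n} → (ℕ → Point n) → ClosedSet n → Set
DenseIn x X = (∀ j → x j ∈ X) ×
  (∀ z → z ∈ X → ∀ ε → 0ℚ ℚ.< ε → ∃[ j ] OpenBall (x j) ε z)

closedRep : ∀ n → Representation (ClosedSet n)
closedRep n p X =
  (∃[ x ] sequenceRep (ρⁿ n) (fst p) x × DenseIn x X) ×
  (∀ z → (¬ (z ∈ X)) ⇔ (∃[ k ] z ∈ᵇ decodeBall n (snd p k)))

-- An admissible choice of the balls B(a_k,r_k) in the definition of d.
record ComputableCover (n : ℕ) (B : ℕ → RationalBall n) : Set where
  field
    computable : ∃[ b ] ComputableSeq b × (∀ k → B k ≡ decodeBall n (b k))
    positive   : ∀ k → 0ℚ ℚ.< proj₂ (B k)
    covers     : ∀ x → ∃[ k ] x ∈ᵇ B k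

record _⇀_ {ℓ} (X : Set) (Y : Set ℓ) : Set (ℓ ⊔ lsuc 0ℓ) where
  field
    dom : X → Set
    app : ∀ x → dom x → Y

open _⇀_ public

Computable : ∀ {ℓ} {X : Set} {Y : Set ℓ} →
             Representation X → Representation Y → X ⇀ Y → Set
Computable δ δ′ g = ∃[ M ] ∀ x (x∈dom : dom g x) p → δ p x →
  ∃[ q ] Outputs M p q × δ′ q (app g x x∈dom)

ψ : ∀ n → (ω n × Point n) ⇀ ClosedSet n
dom (ψ n) (f , x₀)   = HyperbolicEquilibrium (fun f) x₀
app (ψ n) (f , x₀) _ = closure (UnstableManifold (fun f) x₀)

{-# OPTIONS --safe #-}

-- The field ẋ₀ = x₀ ((x₀ - 1)² + ε), ẋᵢ = xᵢ (xᵢ - 1)² has the hyperbolic equilibrium 0.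
-- For ε = 0 no solution starting beyond the double zero x₀ = 1 tends to 0 as t → -∞,
-- whereas for ε > 0 the solution through (2,0,…,0) does. A machine computing the
-- closure of the unstable manifold announces, for ε = 0, a ball of the complement
-- containing (2,0,…,0) after reading finitely many entries of a name of the field. These
-- entries can be continued to a name of the field for some small ε > 0, where the
-- announced ball is wrong.
--
-- For ε > 0 the solution is the limit of Euler polygons with rational vertices. For
-- ε = 0 a constructive mean value inequality bounds the speed at which x₀ can cross a
-- narrow band around 1, of width η, by a multiple of η².

module Submission where

open import Defs
open import Data.Bool using (Bool; true; false)
open import Data.Empty using (⊥; ⊥-elim)
open import Data.Fin using (Fin; zero; suc)
import Data.Fin.Properties as Finₚ
open import Data.Integer as ℤ using ()
import Data.Integer.Properties as ℤₚ
open import Data.List using (List; []; _∷_; _++_; applyUpTo; length)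
import Data.List.Properties as Listₚ
open import Data.Maybe using (just; nothing)
open import Data.Nat as ℕ using (ℕ; zero; suc; z≤n; s≤s)
import Data.Nat.Properties as ℕₚ
open import Data.Product using (∃-syntax; _×_; _,_; proj₁; proj₂)
open import Data.Rational as ℚ using (ℚ; mkℚ; 0ℚ; 1ℚ; ½)
  renaming (_+_ to _+′_; _*_ to _*′_; _-_ to _-′_; -_ to -′_; ∣_∣ to ∣_∣′; _≤_ to _≤′_; _<_ to _<′_)
import Data.Rational.Properties as ℚₚ
open import Data.Rational.Unnormalised as ℚᵘ using (mkℚᵘ)
import Data.Rational.Unnormalised.Properties as ℚᵘₚ
open import Data.Sum as Sum using (_⊎_; inj₁; inj₂)
open import Data.Vec using (Vec; []; _∷_; lookup; replicate; toList)
import Data.Vec as Vec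
import Data.Vec.Properties as Vecₚ
open import Function using (_∘_; Equivalence)
open import Level using (0ℓ)
open import Relation.Binary.PropositionalEquality
  using (_≡_; _≢_; refl; sym; trans; cong; cong₂; subst; subst₂)
open import Relation.Nullary using (¬_; yes; no)
open import Relation.Nullary.Decidable using (dec⇒maybe; from-yes)
open import Tactic.RingSolver using (solve-∀)
open import Tactic.RingSolver.Core.AlmostCommutativeRing using (AlmostCommutativeRing; fromCommutativeRing)

-- The field is chosen so that everything but the dynamics is exact. It is a rational polynomial
-- map; the perturbation ε x₀ is linear, so two such fields differ by a multiple of x₀ in one
-- component and their Jacobians by a constant matrix. Every maximum in the distance is then
-- rational and attained. At 0 the Jacobian is diagonal with entries at least 1.
--
-- Real operations act termwise on Cauchy sequences, so identities of reals become ring identities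
-- in ℚ, and inequalities become rational ones holding eventually. The order of the reals is
-- undecidable, so a solution cannot be asked when it passes 1. This shapes the case ε = 0: the band
-- has width 2η, and at a speed of order η² its crossing takes a time of order 1/η. A solution
-- tending to 0 would cross within some fixed time D, which η = 1/(4D) rules out. Case distinctions
-- on a real are made between overlapping alternatives, by looking at one late rational of its
-- sequence.

ℚ-ring : AlmostCommutativeRing 0ℓ 0ℓ
ℚ-ring = fromCommutativeRing ℚₚ.+-*-commutativeRing (λ x → dec⇒maybe (0ℚ ℚₚ.≟ x))

-- Ordered-field arithmetic in ℚ.

2ℚ 3ℚ 4ℚ 8ℚ : ℚ
2ℚ = 1ℚ +′ 1ℚ
3ℚ = 1ℚ +′ 2ℚ
4ℚ = 2ℚ +′ 2ℚ
8ℚ = 4ℚ +′ 4ℚ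

-- Inequalities between rationals are proved by certificates: b is written as
-- a + d by the ring solver, with d visibly nonnegative.
≤-cert : ∀ {a b d} → 0ℚ ≤′ d → b ≡ a +′ d → a ≤′ b
≤-cert {a} 0≤d refl = subst (_≤′ a +′ _) (ℚₚ.+-identityʳ a) (ℚₚ.+-monoʳ-≤ a 0≤d)

<-cert : ∀ {a b d} → 0ℚ <′ d → b ≡ a +′ d → a <′ b
<-cert {a} 0<d refl = subst (_<′ a +′ _) (ℚₚ.+-identityʳ a) (ℚₚ.+-monoʳ-< a 0<d)

slack : ∀ {a b} → a ≤′ b → 0ℚ ≤′ b -′ a
slack {a} {b} p = subst (_≤′ b -′ a) (ℚₚ.+-inverseʳ a) (ℚₚ.+-monoˡ-≤ (-′ a) p)

slack< : ∀ {a b} → a <′ b → 0ℚ <′ b -′ a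
slack< {a} {b} p = subst (_<′ b -′ a) (ℚₚ.+-inverseʳ a) (ℚₚ.+-monoˡ-< (-′ a) p)

infixl 6 _⊕_ _⊕<_
infixl 7 _⊗′_ _⊗<_

_⊕_ : ∀ {p q} → 0ℚ ≤′ p → 0ℚ ≤′ q → 0ℚ ≤′ p +′ q
_⊕_ = ℚₚ.+-mono-≤

_⊕<_ : ∀ {p q} → 0ℚ <′ p → 0ℚ ≤′ q → 0ℚ <′ p +′ q
_⊕<_ = ℚₚ.+-mono-<-≤

_⊗′_ : ∀ {p q} → 0ℚ ≤′ p → 0ℚ ≤′ q → 0ℚ ≤′ p *′ q
_⊗′_ {p} {q} 0≤p 0≤q = ℚₚ.nonNegative⁻¹ (p *′ q)
  {{ℚₚ.nonNeg*nonNeg⇒nonNeg p {{ℚ.nonNegative 0≤p}} q {{ℚ.nonNegative 0≤q}}}}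

_⊗<_ : ∀ {p q} → 0ℚ <′ p → 0ℚ <′ q → 0ℚ <′ p *′ q
_⊗<_ {p} {q} 0<p 0<q = ℚₚ.positive⁻¹ (p *′ q)
  {{ℚₚ.pos*pos⇒pos p {{ℚ.positive 0<p}} q {{ℚ.positive 0<q}}}}

0≤1 : 0ℚ ≤′ 1ℚ
0≤1 = from-yes (0ℚ ℚₚ.≤? 1ℚ)

0≤2 : 0ℚ ≤′ 2ℚ
0≤2 = from-yes (0ℚ ℚₚ.≤? 2ℚ)

0≤½ : 0ℚ ≤′ ½
0≤½ = from-yes (0ℚ ℚₚ.≤? ½)

0<1 : 0ℚ <′ 1ℚ
0<1 = from-yes (0ℚ ℚₚ.<? 1ℚ)

0<½ : 0ℚ <′ ½
0<½ = from-yes (0ℚ ℚₚ.<? ½)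

0<2 : 0ℚ <′ 2ℚ
0<2 = from-yes (0ℚ ℚₚ.<? 2ℚ)

½-pos : ∀ {ε} → 0ℚ <′ ε → 0ℚ <′ ½ *′ ε
½-pos = 0<½ ⊗<_

0≤∣∣ : ∀ a → 0ℚ ≤′ ∣ a ∣′
0≤∣∣ = ℚₚ.0≤∣p∣

∣∣-cases : ∀ a → (∣ a ∣′ ≡ a) ⊎ (∣ a ∣′ ≡ -′ a)
∣∣-cases = ℚₚ.∣p∣≡p∨∣p∣≡-p

neg-neg : ∀ (a : ℚ) → -′ (-′ a) ≡ a
neg-neg = solve-∀ ℚ-ring

a≤∣a∣ : ∀ a → a ≤′ ∣ a ∣′
a≤∣a∣ a with ∣∣-cases a
... | inj₁ e = ℚₚ.≤-reflexive (sym e)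
... | inj₂ e = ℚₚ.≤-trans (subst (_≤′ 0ℚ) (neg-neg a) (ℚₚ.neg-antimono-≤ (subst (0ℚ ≤′_) e (0≤∣∣ a)))) (0≤∣∣ a)

-a≤∣a∣ : ∀ a → -′ a ≤′ ∣ a ∣′
-a≤∣a∣ a = subst (-′ a ≤′_) (ℚₚ.∣-p∣≡∣p∣ a) (a≤∣a∣ (-′ a))

∣∣≤ : ∀ {a b} → a ≤′ b → -′ a ≤′ b → ∣ a ∣′ ≤′ b
∣∣≤ {a} p q with ∣∣-cases a
... | inj₁ e = subst (_≤′ _) (sym e) p
... | inj₂ e = subst (_≤′ _) (sym e) q

∣∣≤⇒≤ : ∀ {a b} → ∣ a ∣′ ≤′ b → a ≤′ b
∣∣≤⇒≤ {a} = ℚₚ.≤-trans (a≤∣a∣ a)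

∣∣≤⇒-≤ : ∀ {a b} → ∣ a ∣′ ≤′ b → -′ a ≤′ b
∣∣≤⇒-≤ {a} = ℚₚ.≤-trans (-a≤∣a∣ a)

∣∣-sq : ∀ a → ∣ a ∣′ *′ ∣ a ∣′ ≡ a *′ a
∣∣-sq a with ∣∣-cases a
... | inj₁ e = cong₂ _*′_ e e
... | inj₂ e = trans (cong₂ _*′_ e e) (lemma a)
  where
  lemma : ∀ (a : ℚ) → (-′ a) *′ (-′ a) ≡ a *′ a
  lemma = solve-∀ ℚ-ring

0≤sq : ∀ a → 0ℚ ≤′ a *′ a
0≤sq a = subst (0ℚ ≤′_) (∣∣-sq a) (0≤∣∣ a ⊗′ 0≤∣∣ a)

∣∣-sub-comm : ∀ a b → ∣ a -′ b ∣′ ≡ ∣ b -′ a ∣′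
∣∣-sub-comm a b = trans (sym (ℚₚ.∣-p∣≡∣p∣ (a -′ b))) (cong ∣_∣′ (lemma a b))
  where
  lemma : ∀ (a b : ℚ) → -′ (a -′ b) ≡ b -′ a
  lemma = solve-∀ ℚ-ring

∣∣-tri : ∀ a b c → ∣ a -′ c ∣′ ≤′ ∣ a -′ b ∣′ +′ ∣ b -′ c ∣′
∣∣-tri a b c = subst (λ d → ∣ d ∣′ ≤′ ∣ a -′ b ∣′ +′ ∣ b -′ c ∣′) (lemma a b c) (ℚₚ.∣p+q∣≤∣p∣+∣q∣ (a -′ b) (b -′ c))
  where
  lemma : ∀ (a b c : ℚ) → (a -′ b) +′ (b -′ c) ≡ a -′ c
  lemma = solve-∀ ℚ-ring

∣∣-lip : ∀ a b → ∣ ∣ a ∣′ -′ ∣ b ∣′ ∣′ ≤′ ∣ a -′ b ∣′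
∣∣-lip a b = ∣∣≤ (half a b) (subst₂ _≤′_ (lemma ∣ a ∣′ ∣ b ∣′) (∣∣-sub-comm b a) (half b a))
  where
  lemma : ∀ (p q : ℚ) → q -′ p ≡ -′ (p -′ q)
  lemma = solve-∀ ℚ-ring
  cancel : ∀ (p q r : ℚ) → r ≡ p -′ q +′ (q +′ r -′ p)
  cancel = solve-∀ ℚ-ring
  split : ∀ (p q : ℚ) → q +′ (p -′ q) ≡ p
  split = solve-∀ ℚ-ring
  half : ∀ a b → ∣ a ∣′ -′ ∣ b ∣′ ≤′ ∣ a -′ b ∣′
  half a b = ≤-cert (slack (subst (λ d → ∣ d ∣′ ≤′ ∣ b ∣′ +′ ∣ a -′ b ∣′) (split a b) (ℚₚ.∣p+q∣≤∣p∣+∣q∣ b (a -′ b))))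
    (cancel ∣ a ∣′ ∣ b ∣′ ∣ a -′ b ∣′)

sq-mono : ∀ {a b} → ∣ a ∣′ ≤′ b → a *′ a ≤′ b *′ b
sq-mono {a} {b} p = subst (_≤′ b *′ b) (∣∣-sq a)
  (≤-cert (slack p ⊗′ (0≤∣∣ a ⊕ ℚₚ.≤-trans (0≤∣∣ a) p)) (lemma ∣ a ∣′ b))
  where
  lemma : ∀ (a b : ℚ) → b *′ b ≡ a *′ a +′ (b -′ a) *′ (a +′ b)
  lemma = solve-∀ ℚ-ring

sq-cancel : ∀ {a b} → 0ℚ ≤′ b → a *′ a ≤′ b *′ b → ∣ a ∣′ ≤′ b
sq-cancel {a} {b} 0≤b p with ∣ a ∣′ ℚₚ.≤? b
... | yes q = q
... | no ¬q = ⊥-elim (ℚₚ.<⇒≢ (ℚₚ.<-≤-trans (0<d ⊗< 0<s) r) refl)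
  where
  0<d = slack< (ℚₚ.≰⇒> ¬q)
  0<s = 0<d ⊕< (0≤b ⊕ 0≤b)
  lemma : ∀ (a b : ℚ) → 0ℚ ≡ (a -′ b) *′ (a -′ b +′ (b +′ b)) +′ (b *′ b -′ a *′ a)
  lemma = solve-∀ ℚ-ring
  r : (∣ a ∣′ -′ b) *′ (∣ a ∣′ -′ b +′ (b +′ b)) ≤′ 0ℚ
  r = ≤-cert (slack (subst (_≤′ b *′ b) (sym (∣∣-sq a)) p)) (lemma ∣ a ∣′ b)

∣∣-mul : ∀ a b → ∣ a *′ b ∣′ ≡ ∣ a ∣′ *′ ∣ b ∣′
∣∣-mul = ℚₚ.∣p*q∣≡∣p∣*∣q∣

*-mono′ : ∀ {a b c d} → 0ℚ ≤′ a → a ≤′ b → 0ℚ ≤′ c → c ≤′ d → a *′ c ≤′ b *′ d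
*-mono′ {a} {b} {c} {d} 0≤a p 0≤c q = ≤-cert ((0≤a ⊕ slack p) ⊗′ slack q ⊕ slack p ⊗′ 0≤c) (lemma a b c d)
  where
  lemma : ∀ (a b c d : ℚ) → b *′ d ≡ a *′ c +′ ((a +′ (b -′ a)) *′ (d -′ c) +′ (b -′ a) *′ c)
  lemma = solve-∀ ℚ-ring

∣∣-mul-mono : ∀ {a b c d} → ∣ a ∣′ ≤′ b → ∣ c ∣′ ≤′ d → ∣ a *′ c ∣′ ≤′ b *′ d
∣∣-mul-mono {a} {b} {c} {d} p q = subst (_≤′ b *′ d) (sym (∣∣-mul a c)) (*-mono′ (0≤∣∣ a) p (0≤∣∣ c) q)

-- The ring solver knows no division, so a quotient δ = ε / b enters the certificates only through
-- the equation `b *′ δ ≡ ε`.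
quotient : ∀ {b ε} → 0ℚ <′ b → 0ℚ <′ ε → ∃[ δ ] 0ℚ <′ δ × b *′ δ ≡ ε
quotient {b} {ε} 0<b 0<ε = ℚ.1/ b *′ ε , ℚₚ.positive⁻¹ (ℚ.1/ b) {{ℚₚ.1/pos⇒pos b}} ⊗< 0<ε ,
  trans (sym (ℚₚ.*-assoc b (ℚ.1/ b) ε)) (trans (cong (_*′ ε) (ℚₚ.*-inverseʳ b)) (ℚₚ.*-identityˡ ε))
  where
  instance
    _ = ℚ.positive 0<b
    nz : ℚ.NonZero b
    nz = ℚₚ.pos⇒nonZero b

-- By recursion, so that `nat (suc k)` unfolds to `1ℚ +′ nat k` inside ring identities.
nat : ℕ → ℚ
nat zero    = 0ℚ
nat (suc k) = 1ℚ +′ nat k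

0≤nat : ∀ k → 0ℚ ≤′ nat k
0≤nat zero    = ℚₚ.≤-refl
0≤nat (suc k) = 0≤1 ⊕ 0≤nat k

nat-+ : ∀ j k → nat (j ℕ.+ k) ≡ nat j +′ nat k
nat-+ zero    k = sym (ℚₚ.+-identityˡ (nat k))
nat-+ (suc j) k = trans (cong (1ℚ +′_) (nat-+ j k)) (sym (ℚₚ.+-assoc 1ℚ (nat j) (nat k)))

nat-* : ∀ j k → nat (j ℕ.* k) ≡ nat j *′ nat k
nat-* zero    k = sym (ℚₚ.*-zeroˡ (nat k))
nat-* (suc j) k = trans (nat-+ k (j ℕ.* k)) (trans (cong (nat k +′_) (nat-* j k)) (lemma (nat j) (nat k)))
  where
  lemma : ∀ (j k : ℚ) → k +′ j *′ k ≡ (1ℚ +′ j) *′ k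
  lemma = solve-∀ ℚ-ring

nat-mono : ∀ {j k} → j ℕ.≤ k → nat j ≤′ nat k
nat-mono {k = k} z≤n = 0≤nat k
nat-mono (s≤s p)     = ℚₚ.+-monoʳ-≤ 1ℚ (nat-mono p)

toℚᵘ-nat : ∀ n → ℚ.toℚᵘ (nat n) ℚᵘ.≃ mkℚᵘ (ℤ.+ n) 0
toℚᵘ-nat zero    = ℚᵘₚ.≃-refl
toℚᵘ-nat (suc n) = ℚᵘₚ.≃-trans (ℚₚ.toℚᵘ-homo-+ 1ℚ (nat n))
  (ℚᵘₚ.≃-trans (ℚᵘₚ.+-congʳ (ℚ.toℚᵘ 1ℚ) (toℚᵘ-nat n))
    (ℚᵘ.*≡* (cong (ℤ._* ℤ.1ℤ) (cong (λ i → ℤ.1ℤ ℤ.+ i) (ℤₚ.*-identityʳ (ℤ.+ n))))))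

-- For a positive fraction q the denominator serves as n: n q is then the numerator, which is at
-- least 1.
archimedean⁻ : ∀ q → 0ℚ <′ q → ∃[ n ] 1ℚ ≤′ nat n *′ q
archimedean⁻ q@(mkℚ (ℤ.+ zero) d _) 0<q = ⊥-elim (ℚₚ.<⇒≢ 0<q (sym (ℚₚ.↥p≡0⇒p≡0 q refl)))
archimedean⁻ (mkℚ ℤ.-[1+ _ ] d _) (ℚ.*<* ())
archimedean⁻ q@(mkℚ (ℤ.+ suc a) d c) 0<q = suc d , ℚₚ.toℚᵘ-cancel-≤
  (ℚᵘₚ.≤-respʳ-≃ (ℚᵘₚ.≃-sym (ℚᵘₚ.≃-trans (ℚₚ.toℚᵘ-homo-* (nat (suc d)) q)
                                         (ℚᵘₚ.*-congʳ (toℚᵘ-nat (suc d)))))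
    (ℚᵘ.*≤* (ℤ.+≤+ (subst₂ ℕ._≤_ (sym (ℕₚ.*-identityˡ (suc d ℕ.+ 0))) (sym (ℕₚ.*-identityʳ (suc d ℕ.* suc a)))
      (subst (ℕ._≤ suc d ℕ.* suc a) (sym (ℕₚ.+-identityʳ (suc d))) (ℕₚ.m≤m*n (suc d) (suc a)))))))

archimedean : ∀ q → ∃[ n ] q ≤′ nat n
archimedean q with 0ℚ ℚₚ.<? q
... | no ¬p = 0 , ℚₚ.≮⇒≥ ¬p
... | yes p with quotient p 0<1
... | r , 0<r , e with archimedean⁻ r 0<r
... | n , h = n , ≤-cert (ℚₚ.<⇒≤ p ⊗′ slack h) (trans (sym (ℚₚ.*-identityʳ (nat n))) (trans (cong (nat n *′_) (sym e)) (lemma (nat n) q r)))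
  where
  lemma : ∀ (n q r : ℚ) → n *′ (q *′ r) ≡ q +′ q *′ (n *′ r -′ 1ℚ)
  lemma = solve-∀ ℚ-ring

0<2⁻ : ∀ k → 0ℚ <′ 2⁻ k
0<2⁻ zero    = 0<1
0<2⁻ (suc k) = ½-pos (0<2⁻ k)

0≤2⁻ : ∀ k → 0ℚ ≤′ 2⁻ k
0≤2⁻ k = ℚₚ.<⇒≤ (0<2⁻ k)

2⁻-suc-≤ : ∀ k → 2⁻ (suc k) ≤′ 2⁻ k
2⁻-suc-≤ k = ≤-cert (0≤½ ⊗′ 0≤2⁻ k) (lemma (2⁻ k))
  where
  lemma : ∀ (x : ℚ) → x ≡ ½ *′ x +′ ½ *′ x
  lemma = solve-∀ ℚ-ring

2⁻-+ : ∀ j k → 2⁻ (j ℕ.+ k) ≡ 2⁻ j *′ 2⁻ k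
2⁻-+ zero    k = sym (ℚₚ.*-identityˡ (2⁻ k))
2⁻-+ (suc j) k = trans (cong (½ *′_) (2⁻-+ j k)) (sym (ℚₚ.*-assoc ½ (2⁻ j) (2⁻ k)))

2⁻≤1 : ∀ k → 2⁻ k ≤′ 1ℚ
2⁻≤1 zero    = ℚₚ.≤-refl
2⁻≤1 (suc k) = ℚₚ.≤-trans (2⁻-suc-≤ k) (2⁻≤1 k)

2⁻-antitone : ∀ {j k} → j ℕ.≤ k → 2⁻ k ≤′ 2⁻ j
2⁻-antitone {k = k} z≤n = 2⁻≤1 k
2⁻-antitone {suc j} {suc k} (s≤s p) = ℚₚ.*-monoˡ-≤-nonNeg ½ (2⁻-antitone p)

nat*2⁻≤1 : ∀ k → nat k *′ 2⁻ k ≤′ 1ℚ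
nat*2⁻≤1 zero    = 0≤1
nat*2⁻≤1 (suc k) = ≤-cert (0≤½ ⊗′ (slack (nat*2⁻≤1 k) ⊕ slack (2⁻≤1 k))) (lemma (nat k) (2⁻ k))
  where
  lemma : ∀ (n x : ℚ) → 1ℚ ≡ (1ℚ +′ n) *′ (½ *′ x) +′ ½ *′ ((1ℚ -′ n *′ x) +′ (1ℚ -′ x))
  lemma = solve-∀ ℚ-ring

2⁻-small : ∀ ε → 0ℚ <′ ε → ∃[ k ] 2⁻ k ≤′ ε
2⁻-small ε 0<ε with archimedean⁻ ε 0<ε
... | k , h = k , ≤-cert (slack h ⊗′ 0≤2⁻ k ⊕ slack (nat*2⁻≤1 k) ⊗′ ℚₚ.<⇒≤ 0<ε) (lemma (nat k) (2⁻ k) ε)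
  where
  lemma : ∀ (n x e : ℚ) → e ≡ x +′ ((n *′ e -′ 1ℚ) *′ x +′ (1ℚ -′ n *′ x) *′ e)
  lemma = solve-∀ ℚ-ring

⊓-pos : ∀ {p q} → 0ℚ <′ p → 0ℚ <′ q → 0ℚ <′ p ℚ.⊓ q
⊓-pos {p} {q} 0<p 0<q with ℚₚ.≤-total p q
... | inj₁ h = subst (0ℚ <′_) (sym (ℚₚ.p≤q⇒p⊓q≡p h)) 0<p
... | inj₂ h = subst (0ℚ <′_) (sym (ℚₚ.p≥q⇒p⊓q≡q h)) 0<q

-- Eventual properties and the order of the reals.

Eventually : (ℕ → Set) → Set
Eventually P = ∃[ N ] ∀ n → N ℕ.≤ n → P n

always : ∀ {P : ℕ → Set} → (∀ n → P n) → Eventually P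
always h = 0 , λ n _ → h n

ev-map : ∀ {P Q : ℕ → Set} → (∀ n → P n → Q n) → Eventually P → Eventually Q
ev-map h (N , p) = N , λ n N≤n → h n (p n N≤n)

ev-× : ∀ {P Q : ℕ → Set} → Eventually P → Eventually Q → Eventually (λ n → P n × Q n)
ev-× (M , p) (N , q) = M ℕ.⊔ N , λ n h → p n (ℕₚ.m⊔n≤o⇒m≤o M N h) , q n (ℕₚ.m⊔n≤o⇒n≤o M N h)

ev-map₂ : ∀ {P Q R : ℕ → Set} → (∀ n → P n → Q n → R n) →
          Eventually P → Eventually Q → Eventually R
ev-map₂ h p q = ev-map (λ n (a , b) → h n a b) (ev-× p q)

ev-map₃ : ∀ {P Q R S : ℕ → Set} → (∀ n → P n → Q n → R n → S n) →
          Eventually P → Eventually Q → Eventually R → Eventually S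
ev-map₃ h p q r = ev-map₂ (λ n a (b , c) → h n a b c) p (ev-× q r)

ev-≥ : ∀ N → Eventually (N ℕ.≤_)
ev-≥ N = N , λ _ h → h

ev-absurd : ∀ {P : ℕ → Set} → Eventually P → (∀ n → ¬ P n) → ⊥
ev-absurd (N , p) h = h N (p N ℕₚ.≤-refl)

ev-Fin : ∀ {n} {P : Fin n → ℕ → Set} → (∀ i → Eventually (P i)) → Eventually (λ k → ∀ i → P i k)
ev-Fin {zero}  h = 0 , λ _ _ ()
ev-Fin {suc n} h = ev-map₂ (λ { k p q zero → p ; k p q (suc i) → q i }) (h zero) (ev-Fin (h ∘ suc))

half+half : ∀ (e : ℚ) → ½ *′ e +′ ½ *′ e ≡ e
half+half = solve-∀ ℚ-ring

-- One late entry stands for the whole real up to ε, so a decidable question about `seq x N` can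
-- replace an undecidable one about x.
settle : ∀ x ε → 0ℚ <′ ε → ∃[ N ] (∀ n → N ℕ.≤ n → ∣ seq x n -′ seq x N ∣′ ≤′ ε)
settle x ε 0<ε with cauchy x ε 0<ε
... | N , h = N , λ n p → h n N p ℕₚ.≤-refl

bounded : ∀ x → ∃[ b ] 0ℚ <′ b × Eventually (λ n → ∣ seq x n ∣′ ≤′ b)
bounded x with settle x 1ℚ 0<1
... | N , h = 1ℚ +′ ∣ seq x N ∣′ , 0<1 ⊕< 0≤∣∣ (seq x N) , N , λ n p →
      ≤-cert (slack (h n p) ⊕ slack (∣∣≤⇒≤ (∣∣-lip (seq x n) (seq x N))))
        (lemma ∣ seq x n ∣′ ∣ seq x N ∣′ ∣ seq x n -′ seq x N ∣′)
  where
  lemma : ∀ (a b c : ℚ) → 1ℚ +′ b ≡ a +′ ((1ℚ -′ c) +′ (c -′ (a -′ b)))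
  lemma = solve-∀ ℚ-ring

≡⇒∣∣≤ : ∀ {a b ε} → 0ℚ ≤′ ε → a ≡ b → ∣ a -′ b ∣′ ≤′ ε
≡⇒∣∣≤ {a} {ε = ε} 0≤ε refl = subst (_≤′ ε) (sym (cong ∣_∣′ (ℚₚ.+-inverseʳ a))) 0≤ε

weaken-≤ : ∀ {a b ε} → 0ℚ ≤′ ε → a ≤′ b → a ≤′ b +′ ε
weaken-≤ {a} {b} {ε} 0≤ε p = ≤-cert (slack p ⊕ 0≤ε) (lemma a b ε)
  where
  lemma : ∀ (a b e : ℚ) → b +′ e ≡ a +′ ((b -′ a) +′ e)
  lemma = solve-∀ ℚ-ring

≃-pointwise : ∀ x y → (∀ k → seq x k ≡ seq y k) → x ≃ y
≃-pointwise x y h ε 0<ε = always λ k → ≡⇒∣∣≤ (ℚₚ.<⇒≤ 0<ε) (h k)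

≤-eventually : ∀ x y → Eventually (λ k → seq x k ≤′ seq y k) → x ≤ y
≤-eventually x y h ε 0<ε = ev-map (λ k → weaken-≤ (ℚₚ.<⇒≤ 0<ε)) h

≤-pointwise : ∀ x y → (∀ k → seq x k ≤′ seq y k) → x ≤ y
≤-pointwise x y h = ≤-eventually x y (always h)

≃-sym : ∀ x y → x ≃ y → y ≃ x
≃-sym x y h ε 0<ε = ev-map (λ k → subst (_≤′ ε) (∣∣-sub-comm (seq x k) (seq y k))) (h ε 0<ε)

≃-trans : ∀ x y z → x ≃ y → y ≃ z → x ≃ z
≃-trans x y z p q ε 0<ε = ev-map₂
  (λ k a b → ℚₚ.≤-trans (∣∣-tri (seq x k) (seq y k) (seq z k))
    (subst (_ ≤′_) (half+half ε) (ℚₚ.+-mono-≤ a b)))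
  (p (½ *′ ε) (½-pos 0<ε)) (q (½ *′ ε) (½-pos 0<ε))

≃⇒≤ : ∀ x y → x ≃ y → x ≤ y
≃⇒≤ x y h ε 0<ε = ev-map (λ k p → ≤-cert (slack (∣∣≤⇒≤ p)) (lemma (seq x k) (seq y k) ε)) (h ε 0<ε)
  where
  lemma : ∀ (a b e : ℚ) → b +′ e ≡ a +′ (e -′ (a -′ b))
  lemma = solve-∀ ℚ-ring

≤-trans : ∀ x y z → x ≤ y → y ≤ z → x ≤ z
≤-trans x y z p q ε 0<ε = ev-map₂
  (λ k a b → ≤-cert (slack a ⊕ slack b) (lemma (seq x k) (seq y k) (seq z k) ε))
  (p (½ *′ ε) (½-pos 0<ε)) (q (½ *′ ε) (½-pos 0<ε))
  where
  lemma : ∀ (a b c e : ℚ) → c +′ e ≡ a +′ ((b +′ ½ *′ e -′ a) +′ (c +′ ½ *′ e -′ b))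
  lemma = solve-∀ ℚ-ring

+-cong-≃ : ∀ x x₁ y y₁ → x ≃ x₁ → y ≃ y₁ → x + y ≃ x₁ + y₁
+-cong-≃ x x₁ y y₁ p q ε 0<ε = ev-map₂
  (λ k a b → subst₂ _≤′_ (cong ∣_∣′ (lemma (seq x k) (seq x₁ k) (seq y k) (seq y₁ k))) (half+half ε)
    (ℚₚ.≤-trans (ℚₚ.∣p+q∣≤∣p∣+∣q∣ (seq x k -′ seq x₁ k) (seq y k -′ seq y₁ k)) (ℚₚ.+-mono-≤ a b)))
  (p (½ *′ ε) (½-pos 0<ε)) (q (½ *′ ε) (½-pos 0<ε))
  where
  lemma : ∀ (a b c d : ℚ) → (a -′ b) +′ (c -′ d) ≡ (a +′ c) -′ (b +′ d)
  lemma = solve-∀ ℚ-ring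

∣∣-*-sub : ∀ {a a₁ c c₁ A C δ δ′} → ∣ a ∣′ ≤′ A → ∣ c₁ ∣′ ≤′ C → ∣ a -′ a₁ ∣′ ≤′ δ′ → ∣ c -′ c₁ ∣′ ≤′ δ →
            ∣ a *′ c -′ a₁ *′ c₁ ∣′ ≤′ A *′ δ +′ C *′ δ′
∣∣-*-sub {a} {a₁} {c} {c₁} {A} {C} {δ} {δ′} hA hC h h₁ =
  subst (λ z → ∣ z ∣′ ≤′ A *′ δ +′ C *′ δ′) (lemma a a₁ c c₁)
    (ℚₚ.≤-trans (ℚₚ.∣p+q∣≤∣p∣+∣q∣ (a *′ (c -′ c₁)) (c₁ *′ (a -′ a₁)))
      (ℚₚ.+-mono-≤ (∣∣-mul-mono {a} {A} {c -′ c₁} {δ} hA h₁) (∣∣-mul-mono {c₁} {C} {a -′ a₁} {δ′} hC h)))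
  where
  lemma : ∀ (a b c d : ℚ) → a *′ (c -′ d) +′ d *′ (a -′ b) ≡ a *′ c -′ b *′ d
  lemma = solve-∀ ℚ-ring

*-cong-≃ : ∀ x x₁ y y₁ → x ≃ x₁ → y ≃ y₁ → x * y ≃ x₁ * y₁
*-cong-≃ x x₁ y y₁ p q ε 0<ε =
  let (b , 0<b , B) = bounded x
      (c , 0<c , C) = bounded y₁
      (δ , 0<δ , e) = quotient 0<b (½-pos 0<ε)
      (δ′ , 0<δ′ , e′) = quotient 0<c (½-pos 0<ε)
  in ev-map₂
    (λ k (hb , h) (hc , h′) → subst (∣ seq x k *′ seq y k -′ seq x₁ k *′ seq y₁ k ∣′ ≤′_)
      (trans (cong₂ _+′_ e e′) (half+half ε))
      (∣∣-*-sub {seq x k} {seq x₁ k} {seq y k} {seq y₁ k} hb hc h′ h))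
    (ev-× B (q δ 0<δ)) (ev-× C (p δ′ 0<δ′))

≃-refl : ∀ x → x ≃ x
≃-refl x = ≃-pointwise x x λ _ → refl

-- Eventually y is known only to be at least -ε/4. Hence (y + ε)² ≥ y² + ε²/2, which absorbs the
-- allowance ε²/4 granted to x² ≤ y².
sqrt-≤ : ∀ x y → 0ℝ ≤ y → x * x ≤ y * y → ∣ x ∣ ≤ y
sqrt-≤ x y 0≤y p ε 0<ε = ev-map₂
  (λ k a b → sq-cancel {seq x k} (ℚₚ.≤-trans 0≤½ε (≤-cert (slack a ⊕ ℚₚ.<⇒≤ 0<¼ε) (lemma₁ (seq y k) ε)))
    (≤-cert (slack b ⊕ (0≤2 ⊗′ (slack a ⊗′ ℚₚ.<⇒≤ 0<ε) ⊕ (0≤½ ⊗′ 0≤½ ⊗′ 0≤sq ε)))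
      (lemma₂ (seq x k) (seq y k) ε)))
  (0≤y (½ *′ ½ *′ ε) 0<¼ε) (p (½ *′ ½ *′ (ε *′ ε)) (½-pos 0<½ ⊗< (0<ε ⊗< 0<ε)))
  where
  0<¼ε = ½-pos 0<½ ⊗< 0<ε
  0≤½ε = ℚₚ.<⇒≤ (½-pos 0<ε)
  lemma₁ : ∀ (y e : ℚ) → y +′ e ≡ ½ *′ e +′ (y +′ ½ *′ ½ *′ e -′ 0ℚ +′ ½ *′ ½ *′ e)
  lemma₁ = solve-∀ ℚ-ring
  lemma₂ : ∀ (x y e : ℚ) → (y +′ e) *′ (y +′ e) ≡ x *′ x +′
    ((y *′ y +′ ½ *′ ½ *′ (e *′ e) -′ x *′ x) +′ (2ℚ *′ ((y +′ ½ *′ ½ *′ e -′ 0ℚ) *′ e) +′ ½ *′ ½ *′ (e *′ e)))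
  lemma₂ = solve-∀ ℚ-ring

-- Cutting the allowance η at 1 gives η² ≤ η, so (|v| + η)² ≤ v² + (2b + 1) η whenever |v| ≤ b.
square-≤ : ∀ x y → ∣ x ∣ ≤ ∣ y ∣ → x * x ≤ y * y
square-≤ x y p ε 0<ε =
  let (b , 0<b , B) = bounded y
      (δ , 0<δ , e) = quotient ((0<2 ⊗< 0<b) ⊕< 0≤1) 0<ε
  in ev-map₂ (λ k h hb → estimate b δ (seq x k) (seq y k) (ℚₚ.<⇒≤ 0<b) 0<δ e hb h)
       (p (δ ℚ.⊓ 1ℚ) (⊓-pos 0<δ 0<1)) B
  where
  lemma : ∀ (y b η δ : ℚ) → y *′ y +′ (2ℚ *′ b +′ 1ℚ) *′ δ ≡ (y +′ η) *′ (y +′ η) +′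
    (2ℚ *′ (b -′ y) *′ η +′ η *′ (1ℚ -′ η) +′ (2ℚ *′ b +′ 1ℚ) *′ (δ -′ η))
  lemma = solve-∀ ℚ-ring
  estimate : ∀ b δ u v → 0ℚ ≤′ b → 0ℚ <′ δ → (2ℚ *′ b +′ 1ℚ) *′ δ ≡ ε → ∣ v ∣′ ≤′ b →
             ∣ u ∣′ ≤′ ∣ v ∣′ +′ δ ℚ.⊓ 1ℚ → u *′ u ≤′ v *′ v +′ ε
  estimate b δ u v 0≤b 0<δ refl hb h = ℚₚ.≤-trans (sq-mono {u} h)
    (subst (λ z → (∣ v ∣′ +′ η) *′ (∣ v ∣′ +′ η) ≤′ z +′ (2ℚ *′ b +′ 1ℚ) *′ δ) (∣∣-sq v) bound)
    where
    η = δ ℚ.⊓ 1ℚ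
    0≤η : 0ℚ ≤′ η
    0≤η = ℚₚ.<⇒≤ (⊓-pos 0<δ 0<1)
    bound : (∣ v ∣′ +′ η) *′ (∣ v ∣′ +′ η) ≤′ ∣ v ∣′ *′ ∣ v ∣′ +′ (2ℚ *′ b +′ 1ℚ) *′ δ
    bound = ≤-cert (0≤2 ⊗′ slack hb ⊗′ 0≤η ⊕ 0≤η ⊗′ slack (ℚₚ.p⊓q≤q δ 1ℚ) ⊕ (0≤2 ⊗′ 0≤b ⊕ 0≤1) ⊗′ slack (ℚₚ.p⊓q≤p δ 1ℚ))
      (lemma ∣ v ∣′ b η δ)

-- Codes: inverting the decoding functions.

next-triangle : ∀ k b → b ℕ.≤ k → unpair (triangle k ℕ.+ b) ≡ (k ℕ.∸ b , b)
next-triangle zero    zero    _ = refl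
-- The start (suc k , 0) of an antidiagonal is the successor of the end (0 , k) of the one before.
next-triangle (suc k) zero    _ = trans (cong unpair (lemma k (triangle k)))
    (cong next (trans (next-triangle k k ℕₚ.≤-refl) (cong (_, k) (ℕₚ.n∸n≡0 k))))
  where
  lemma : ∀ k t → suc k ℕ.+ t ℕ.+ 0 ≡ suc (t ℕ.+ k)
  lemma k t = trans (ℕₚ.+-identityʳ (suc k ℕ.+ t)) (cong suc (ℕₚ.+-comm k t))
next-triangle k (suc b) b<k = trans (cong unpair (ℕₚ.+-suc (triangle k) b))
    (trans (cong next (trans (next-triangle k b (ℕₚ.<⇒≤ b<k)) (cong (_, b) (sym (ℕₚ.suc-pred (k ℕ.∸ b))))))
      (cong (_, suc b) (ℕₚ.pred[m∸n]≡m∸[1+n] k b)))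
  where
  instance
    _ = ℕ.>-nonZero (ℕₚ.m<n⇒0<n∸m b<k)

unpair-pair : ∀ a b → unpair (pair a b) ≡ (a , b)
unpair-pair a b = trans (next-triangle (a ℕ.+ b) b (ℕₚ.m≤n+m b a)) (cong (_, b) (ℕₚ.m+n∸n≡m a b))

encodeℤ : ℤ.ℤ → ℕ
encodeℤ (ℤ.+ a)    = pair a 0
encodeℤ ℤ.-[1+ a ] = pair 0 (suc a)

decode-encodeℤ : ∀ i → proj₁ (unpair (encodeℤ i)) ℤ.⊖ proj₂ (unpair (encodeℤ i)) ≡ i
decode-encodeℤ (ℤ.+ a)    = cong (λ (p , m) → p ℤ.⊖ m) (unpair-pair a 0)
decode-encodeℤ ℤ.-[1+ a ] = cong (λ (p , m) → p ℤ.⊖ m) (unpair-pair 0 (suc a))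

encodeℚ : ℚ → ℕ
encodeℚ (mkℚ i d _) = pair (encodeℤ i) d

decode-encodeℚ : ∀ q → decodeℚ (encodeℚ q) ≡ q
decode-encodeℚ q@(mkℚ i d _) = trans
  (cong (λ (num , den) → let (p , m) = unpair num in (p ℤ.⊖ m) ℚ./ suc den) (unpair-pair (encodeℤ i) d))
  (trans (cong (ℚ._/ suc d) (decode-encodeℤ i)) (ℚₚ.↥p/↧p≡p q))

encodeVec : ∀ {n} → Vec ℕ n → ℕ
encodeVec []      = 0
encodeVec (a ∷ v) = pair a (encodeVec v)

decode-encodeVec : ∀ {n} (v : Vec ℕ n) → decodeVec n (encodeVec v) ≡ v
decode-encodeVec []              = refl
decode-encodeVec {suc n} (a ∷ v) = trans
  (cong (λ (a , b) → a ∷ decodeVec n b) (unpair-pair a (encodeVec v))) (cong (a ∷_) (decode-encodeVec v))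

encodeTerm : ∀ {n} → ℚ × MultiIndex n → ℕ
encodeTerm (c , α) = pair (encodeℚ c) (encodeVec α)

decode-encodeTerm : ∀ {n} (u : ℚ × MultiIndex n) → decodeTerm n (encodeTerm u) ≡ u
decode-encodeTerm {n} (c , α) = trans
  (cong (λ (c , α) → decodeℚ c , decodeVec n α) (unpair-pair (encodeℚ c) (encodeVec α)))
  (cong₂ _,_ (decode-encodeℚ c) (decode-encodeVec α))

encodePoly : ∀ {n} → Poly n → ℕ
encodePoly P = pair (length P) (encodeVec (Vec.map encodeTerm (Vec.fromList P)))

map-decode-encode : ∀ {A : Set} (enc : A → ℕ) (dec : ℕ → A) → (∀ a → dec (enc a) ≡ a) →
                    ∀ {n} (v : Vec A n) → Vec.map dec (Vec.map enc v) ≡ v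
map-decode-encode enc dec h v = trans (sym (Vecₚ.map-∘ dec enc v)) (trans (Vecₚ.map-cong h v) (Vecₚ.map-id v))

decode-encodePoly : ∀ {n} (P : Poly n) → decodePoly n (encodePoly P) ≡ P
decode-encodePoly {n} P = trans
  (cong (λ (len , body) → toList (Vec.map (decodeTerm n) (decodeVec len body))) (unpair-pair (length P) _))
  (trans (cong (toList ∘ Vec.map (decodeTerm n)) (decode-encodeVec (Vec.map encodeTerm (Vec.fromList P))))
    (trans (cong toList (map-decode-encode encodeTerm (decodeTerm n) decode-encodeTerm (Vec.fromList P)))
      (Vecₚ.toList∘fromList P)))

encodePolyMap : ∀ {n} → PolyMap n → ℕ
encodePolyMap P = encodeVec (Vec.map encodePoly P)

decode-encodePolyMap : ∀ {n} (P : PolyMap n) → decodePolyMap n (encodePolyMap P) ≡ P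
decode-encodePolyMap {n} P = trans (cong (Vec.map (decodePoly n)) (decode-encodeVec (Vec.map encodePoly P)))
  (map-decode-encode encodePoly (decodePoly n) decode-encodePoly P)

-- Makes the constant sequence 0 a name of the origin.
decodeVec-0 : ∀ n i → lookup (decodeVec n 0) i ≡ 0
decodeVec-0 (suc n) zero    = refl
decodeVec-0 (suc n) (suc i) = decodeVec-0 n i

-- Finite use: each output entry depends on finitely many input entries.

AgreeUpTo : {A : Set} → ℕ → (ℕ → A) → (ℕ → A) → Set
AgreeUpTo N p q = ∀ i → i ℕ.< N → p i ≡ q i

-- Each entry occupies at least its terminating zero, so the symbols before position N involve only
-- c and the first N entries of p.
unaryFrom-agree : ∀ N c p q → AgreeUpTo N p q → AgreeUpTo N (unaryFrom c p) (unaryFrom c q)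
unaryFrom-agree N zero    p q h zero    _ = refl
unaryFrom-agree (suc N) zero p q h (suc i) (s≤s i<N) =
  trans (cong (λ c → unaryFrom c (p ∘ suc) i) (h 0 (s≤s z≤n)))
    (unaryFrom-agree N (q 0) (p ∘ suc) (q ∘ suc) (λ j j<N → h (suc j) (s≤s j<N)) i i<N)
unaryFrom-agree N (suc c) p q h zero    _ = refl
unaryFrom-agree (suc N) (suc c) p q h (suc i) (s≤s i<N) =
  unaryFrom-agree N c p q (λ j j<N → h j (ℕₚ.m<n⇒m<1+n j<N)) i i<N

unary-agree : ∀ N p q → AgreeUpTo (suc N) p q → AgreeUpTo N (unary p) (unary q)
unary-agree N p q h i i<N = trans (cong (λ c → unaryFrom c (p ∘ suc) i) (h 0 (s≤s z≤n)))
  (unaryFrom-agree N (q 0) (p ∘ suc) (q ∘ suc) (λ j j<N → h (suc j) (s≤s j<N)) i i<N)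

codeLength : (ℕ → ℕ) → ℕ → ℕ
codeLength p zero    = 0
codeLength p (suc k) = suc (p 0) ℕ.+ codeLength (p ∘ suc) k

-- The count `suc c` includes the terminator of the first block; without it only c ≤ c′ would
-- follow.
unaryFrom-injective : ∀ c c′ p q → AgreeUpTo (suc c) (unaryFrom c p) (unaryFrom c′ q) → c ≡ c′
unaryFrom-injective zero    zero     p q h = refl
unaryFrom-injective zero    (suc c′) p q h with h 0 (s≤s z≤n)
... | ()
unaryFrom-injective (suc c) zero     p q h with h 0 (s≤s z≤n)
... | ()
unaryFrom-injective (suc c) (suc c′) p q h =
  cong suc (unaryFrom-injective c c′ p q (λ i i≤c → h (suc i) (s≤s i≤c)))

unaryFrom-skip : ∀ c p i → unaryFrom c p (suc (c ℕ.+ i)) ≡ unary p i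
unaryFrom-skip zero    p i = refl
unaryFrom-skip (suc c) p i = unaryFrom-skip c p i

unary-injective : ∀ k p q → AgreeUpTo (codeLength p (suc k)) (unary p) (unary q) → p k ≡ q k
unary-injective k p q h with unaryFrom-injective (p 0) (q 0) (p ∘ suc) (q ∘ suc)
  (λ i i≤ → h i (ℕₚ.≤-trans i≤ (ℕₚ.m≤m+n (suc (p 0)) (codeLength (p ∘ suc) k))))
unary-injective zero    p q h | e = e
unary-injective (suc k) p q h | e = unary-injective k (p ∘ suc) (q ∘ suc) λ i i< →
  trans (sym (unaryFrom-skip (p 0) (p ∘ suc) i))
    (trans (h (suc (p 0 ℕ.+ i)) (ℕₚ.+-monoʳ-< (suc (p 0)) i<))
      (trans (cong (λ c → unary q (suc (c ℕ.+ i))) e) (unaryFrom-skip (q 0) (q ∘ suc) i)))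

applyUpTo-injective : ∀ {A : Set} m {u v : ℕ → A} → applyUpTo u m ≡ applyUpTo v m → AgreeUpTo m u v
applyUpTo-injective (suc m) e zero    _         = proj₁ (Listₚ.∷-injective e)
applyUpTo-injective (suc m) e (suc i) (s≤s i<m) = applyUpTo-injective m (proj₂ (Listₚ.∷-injective e)) i i<m

prefix-≡ : ∀ {A : Set} {o o′ r : List A} → o′ ≡ o ++ r → length o ≡ length o′ → o ≡ o′
prefix-≡ {o = []}    {[]}     e l = refl
prefix-≡ {o = a ∷ o} {b ∷ o′} e l = cong₂ _∷_ (sym (proj₁ (Listₚ.∷-injective e)))
  (prefix-≡ (proj₂ (Listₚ.∷-injective e)) (ℕₚ.suc-injective l))

module _ (M : Machine) where
  open Run M
  open Config

  position-≤ : ∀ input t → position (run input t) ℕ.≤ t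
  position-≤ input zero    = z≤n
  position-≤ input (suc t) with Action.advance (Machine.δ M (state (run input t)) (input (position (run input t)))
                                  (Vec.map Tape.head (work (run input t))))
  ... | true  = s≤s (position-≤ input t)
  ... | false = ℕₚ.m≤n⇒m≤1+n (position-≤ input t)

  -- The input head advances at most one cell per step, so t steps read only positions below t.
  run-agree : ∀ {u v} t → AgreeUpTo t u v → run u t ≡ run v t
  run-agree         zero    h = refl
  run-agree {u} {v} (suc t) h = trans
    (cong (step′ (run u t)) (h (position (run u t)) (s≤s (position-≤ u t))))
    (cong (step v) (run-agree t (λ i i<t → h i (ℕₚ.m<n⇒m<1+n i<t))))
    where
    step′ : Config → Bool → Config
    -- A step sees a single input symbol, so it coincides with the step on the constant input b.
    step′ c b = step (λ _ → b) c

  Extends : List Bool → List Bool → Set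
  Extends o o′ = ∃[ r ] o′ ≡ o ++ r

  write-extends : ∀ b o → Extends o (write b o)
  write-extends nothing  o = [] , sym (Listₚ.++-identityʳ o)
  write-extends (just b) o = b ∷ [] , refl

  output-extends : ∀ input t d → Extends (output (run input t)) (output (run input (d ℕ.+ t)))
  output-extends input t zero    = [] , sym (Listₚ.++-identityʳ _)
  output-extends input t (suc d) with output-extends input t d
  ... | r , e with write-extends (Action.emit (Machine.δ M (state c) (input (position c)) (Vec.map Tape.head (work c)))) (output c)
    where c = run input (d ℕ.+ t)
  ... | r′ , e′ = r ++ r′ , trans e′ (trans (cong (_++ r′) e) (Listₚ.++-assoc (output (run input t)) r r′))

  later : ∀ input s t m u v → s ℕ.≤ t → output (run input s) ≡ applyUpTo u m →
          output (run input t) ≡ applyUpTo v m → applyUpTo u m ≡ applyUpTo v m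
  later input s t m u v s≤t p q with output-extends input s (t ℕ.∸ s)
  ... | r , e rewrite ℕₚ.m∸n+n≡m s≤t = prefix-≡ (trans (sym q) (trans e (cong (_++ r) p)))
      (trans (Listₚ.length-applyUpTo u m) (sym (Listₚ.length-applyUpTo v m)))

  output-unique : ∀ input s t m u v → output (run input s) ≡ applyUpTo u m →
                  output (run input t) ≡ applyUpTo v m → applyUpTo u m ≡ applyUpTo v m
  output-unique input s t m u v p q with ℕₚ.≤-total s t
  ... | inj₁ s≤t = later input s t m u v s≤t p q
  ... | inj₂ t≤s = sym (later input t s m v u t≤s q p)

  -- Entry k of q is fixed by finitely many output symbols. They are written by some time t, when at
  -- most t input symbols, hence at most t + 1 entries, have been read.
  continuous : ∀ p q → Outputs M p q → ∀ k → ∃[ N ] (∀ p′ q′ → AgreeUpTo N p p′ → Outputs M p′ q′ → q′ k ≡ q k)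
  continuous p q out k =
    let m = codeLength q (suc k)
        (t , e) = out m
    in suc t , λ p′ q′ h out′ → let (t′ , e′) = out′ m in
      sym (unary-injective k q q′ (applyUpTo-injective m
        (output-unique (unary p′) t t′ m (unary q) (unary q′)
          (trans (cong output (sym (run-agree {unary p} {unary p′} t (unary-agree t p p′ h)))) e) e′)))

-- Sums and norms, entry by entry.

sum-zero : ∀ {n} (u : Fin n → ℝ) t → (∀ j → seq (u j) t ≡ 0ℚ) → seq (sum u) t ≡ 0ℚ
sum-zero {zero}  u t h = refl
sum-zero {suc n} u t h = cong₂ _+′_ (h zero) (sum-zero (u ∘ suc) t (h ∘ suc))

sum-single : ∀ {n} (i : Fin n) (u : Fin n → ℝ) t → (∀ j → i ≢ j → seq (u j) t ≡ 0ℚ) → seq (sum u) t ≡ seq (u i) t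
sum-single zero    u t h = trans (cong (seq (u zero) t +′_) (sum-zero (u ∘ suc) t (λ j → h (suc j) λ ())))
  (ℚₚ.+-identityʳ (seq (u zero) t))
sum-single (suc i) u t h = trans
  (cong₂ _+′_ (h zero λ ()) (sum-single i (u ∘ suc) t (λ j i≢j → h (suc j) (i≢j ∘ Finₚ.suc-injective))))
  (ℚₚ.+-identityˡ (seq (u (suc i)) t))

sum-nonneg : ∀ {n} (u : Fin n → ℝ) t → (∀ j → 0ℚ ≤′ seq (u j) t) → 0ℚ ≤′ seq (sum u) t
sum-nonneg {zero}  u t h = ℚₚ.≤-refl
sum-nonneg {suc n} u t h = h zero ⊕ sum-nonneg (u ∘ suc) t (h ∘ suc)

term≤sum : ∀ {n} (i : Fin n) (u : Fin n → ℝ) t → (∀ j → 0ℚ ≤′ seq (u j) t) → seq (u i) t ≤′ seq (sum u) t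
term≤sum zero    u t h = weaken-≤ (sum-nonneg (u ∘ suc) t (h ∘ suc)) ℚₚ.≤-refl
term≤sum (suc i) u t h = subst (_≤′ seq (sum u) t) (ℚₚ.+-identityˡ (seq (u (suc i)) t))
  (ℚₚ.+-mono-≤ (h zero) (term≤sum i (u ∘ suc) t (h ∘ suc)))

sum-≤-scale : ∀ {n} (c : ℚ) (u v : Fin n → ℝ) t → (∀ j → seq (u j) t ≤′ c *′ seq (v j) t) →
              seq (sum u) t ≤′ c *′ seq (sum v) t
sum-≤-scale {zero}  c u v t h = ℚₚ.≤-reflexive (sym (ℚₚ.*-zeroʳ c))
sum-≤-scale {suc n} c u v t h = subst (seq (sum u) t ≤′_)
  (sym (ℚₚ.*-distribˡ-+ c (seq (v zero) t) (seq (sum (v ∘ suc)) t)))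
  (ℚₚ.+-mono-≤ (h zero) (sum-≤-scale c (u ∘ suc) (v ∘ suc) t (h ∘ suc)))

square≤norm : ∀ {n} (x : Point n) i t → seq (x i) t *′ seq (x i) t ≤′ seq ∥ x ∥² t
square≤norm x i t = term≤sum i (λ j → x j * x j) t (λ j → 0≤sq (seq (x j) t))

bounded-point : ∀ {n} (x : Point n) → ∃[ b ] 0ℚ <′ b × Eventually (λ k → ∀ i → ∣ seq (x i) k ∣′ ≤′ b)
bounded-point {zero}  x = 1ℚ , 0<1 , always (λ _ ())
bounded-point {suc n} x =
  let (b , 0<b , B) = bounded (x zero)
      (c , 0<c , C) = bounded-point (x ∘ suc)
  in b +′ c , 0<b ⊕< ℚₚ.<⇒≤ 0<c , ev-map₂
     (λ { k p q zero    → weaken-≤ (ℚₚ.<⇒≤ 0<c) p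
        ; k p q (suc i) → subst (∣ seq (x (suc i)) k ∣′ ≤′_) (ℚₚ.+-comm c b) (weaken-≤ (ℚₚ.<⇒≤ 0<b) (q i)) }) B C

-- The field: analyticity, derivative, hyperbolicity.

pow : ℚ → ℕ → ℚ
pow x zero    = 1ℚ
pow x (suc k) = x *′ pow x k

seq-^ : ∀ x k t → seq (x ^ k) t ≡ pow (seq x t) k
seq-^ x zero    t = refl
seq-^ x (suc k) t = cong (seq x t *′_) (seq-^ x k t)

axis : ∀ {n} → Fin n → ℕ → MultiIndex n
axis zero    k = k ∷ replicate _ 0
axis (suc i) k = 0 ∷ axis i k

lookup-axis : ∀ {n} (i : Fin n) k → lookup (axis i k) i ≡ k
lookup-axis zero    k = refl
lookup-axis (suc i) k = lookup-axis i k

monomial-zero : ∀ {n} (x : Point n) t → seq (monomial (replicate n 0) x) t ≡ 1ℚ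
monomial-zero {zero}  x t = refl
monomial-zero {suc n} x t = trans (ℚₚ.*-identityˡ _) (monomial-zero (x ∘ suc) t)

monomial-axis : ∀ {n} (i : Fin n) k (x : Point n) t → seq (monomial (axis i k) x) t ≡ pow (seq (x i) t) k
monomial-axis zero    k x t = trans (cong₂ _*′_ (seq-^ (x zero) k t) (monomial-zero (x ∘ suc) t)) (ℚₚ.*-identityʳ _)
monomial-axis (suc i) k x t = trans (ℚₚ.*-identityˡ _) (monomial-axis i k (x ∘ suc) t)

g : ℚ → ℚ → ℚ
g e x = x *′ ((x -′ 1ℚ) *′ (x -′ 1ℚ) +′ e)

-- x (x - 1)² multiplied out, preceded by the perturbation e x. The coefficients are rational, so
-- the field approximates itself and one code repeated forever names it.
terms : ∀ {n} → ℚ → Fin n → Poly n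
terms e i = (e , axis i 1) ∷ (1ℚ , axis i 1) ∷ (-′ 2ℚ , axis i 2) ∷ (1ℚ , axis i 3) ∷ []

fieldPoly : ∀ {n} → (Fin n → ℚ) → PolyMap n
fieldPoly e = Vec.tabulate λ i → terms (e i) i

F : ∀ {n} → (Fin n → ℚ) → Point n → Point n
F e = ⟦ fieldPoly e ⟧ᵐ

seq-terms : ∀ {n} e i (x : Point n) t → seq (⟦ terms e i ⟧ x) t ≡ g e (seq (x i) t)
seq-terms e i x t = trans
  (cong₂ (λ m r → e *′ m +′ (1ℚ *′ m +′ r)) (monomial-axis i 1 x t)
    (cong₂ (λ m₂ m₃ → -′ 2ℚ *′ m₂ +′ (1ℚ *′ m₃ +′ 0ℚ)) (monomial-axis i 2 x t) (monomial-axis i 3 x t)))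
  (lemma e (seq (x i) t))
  where
  lemma : ∀ (e x : ℚ) → e *′ (x *′ 1ℚ) +′ (1ℚ *′ (x *′ 1ℚ) +′ (-′ 2ℚ *′ (x *′ (x *′ 1ℚ)) +′
    (1ℚ *′ (x *′ (x *′ (x *′ 1ℚ))) +′ 0ℚ))) ≡ x *′ ((x -′ 1ℚ) *′ (x -′ 1ℚ) +′ e)
  lemma = solve-∀ ℚ-ring

seq-F : ∀ {n} e (x : Point n) i t → seq (F e x i) t ≡ g (e i) (seq (x i) t)
seq-F e x i t = trans (cong (λ P → seq (⟦ P ⟧ x) t) (Vecₚ.lookup∘tabulate (λ i → terms (e i) i) i)) (seq-terms (e i) i x t)

G : ℚ → ℝ → ℝ
G e x = x * ((x - 1ℝ) * (x - 1ℝ) + const e)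

G-cong : ∀ e x y → x ≃ y → G e x ≃ G e y
G-cong e x y h = *-cong-≃ x y ((x - 1ℝ) * (x - 1ℝ) + const e) ((y - 1ℝ) * (y - 1ℝ) + const e) h
  (+-cong-≃ ((x - 1ℝ) * (x - 1ℝ)) ((y - 1ℝ) * (y - 1ℝ)) (const e) (const e)
    (*-cong-≃ (x - 1ℝ) (y - 1ℝ) (x - 1ℝ) (y - 1ℝ) h₁ h₁) (≃-refl (const e)))
  where h₁ = +-cong-≃ x y (- 1ℝ) (- 1ℝ) h (≃-refl (- 1ℝ))

F-cong : ∀ {n} (e : Fin n → ℚ) x y → x ≈ y → F e x ≈ F e y
F-cong e x y h i = ≃-trans (F e x i) (G (e i) (x i)) (F e y i) (≃-pointwise (F e x i) (G (e i) (x i)) (seq-F e x i))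
  (≃-trans (G (e i) (x i)) (G (e i) (y i)) (F e y i) (G-cong (e i) (x i) (y i) (h i))
    (≃-pointwise (G (e i) (y i)) (F e y i) (λ t → sym (seq-F e y i t))))

sumℕ-cong : ∀ {u v : ℕ → ℝ} t N → (∀ k → seq (u k) t ≡ seq (v k) t) → seq (sumℕ u N) t ≡ seq (sumℕ v N) t
sumℕ-cong t zero    h = refl
sumℕ-cong t (suc N) h = cong₂ _+′_ (sumℕ-cong t N h) (h N)

sumℕ-first : ∀ (u : ℕ → ℝ) t N → (∀ k → seq (u (suc k)) t ≡ 0ℚ) → seq (sumℕ u (suc N)) t ≡ seq (u 0) t
sumℕ-first u t zero    h = ℚₚ.+-identityˡ (seq (u 0) t)
sumℕ-first u t (suc N) h = trans (cong₂ _+′_ (sumℕ-first u t N h) (h N)) (ℚₚ.+-identityʳ (seq (u 0) t))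

sumℕ-stable : ∀ (u : ℕ → ℝ) t M j → (∀ k → seq (u (k ℕ.+ M)) t ≡ 0ℚ) → seq (sumℕ u (j ℕ.+ M)) t ≡ seq (sumℕ u M) t
sumℕ-stable u t M zero    h = refl
sumℕ-stable u t M (suc j) h = trans (cong₂ _+′_ (sumℕ-stable u t M j h) (h j)) (ℚₚ.+-identityʳ (seq (sumℕ u M) t))

boxSum-zero : ∀ {n} (u : MultiIndex n → ℝ) t N → (∀ α → α ≢ replicate n 0 → seq (u α) t ≡ 0ℚ) →
              seq (boxSum u (suc N)) t ≡ seq (u (replicate n 0)) t
boxSum-zero {zero}  u t N h = refl
boxSum-zero {suc n} u t N h = trans
  (sumℕ-first (λ k → boxSum (λ α → u (k ∷ α)) (suc N)) t N λ k →
    trans (boxSum-zero (λ α → u (suc k ∷ α)) t N (λ α _ → h (suc k ∷ α) λ ())) (h (suc k ∷ replicate n 0) λ ()))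
  (boxSum-zero (λ α → u (0 ∷ α)) t N (λ α α≢0 → h (0 ∷ α) (α≢0 ∘ Vecₚ.∷-injectiveʳ)))

-- The family is supported on the i-th coordinate axis of ℕⁿ: in every other coordinate only the
-- exponent 0 survives, and the n-fold sum becomes a single one.
boxSum-axis : ∀ {n} (i : Fin n) (u : MultiIndex n → ℝ) t N → (∀ α → α ≢ axis i (lookup α i) → seq (u α) t ≡ 0ℚ) →
              seq (boxSum u (suc N)) t ≡ seq (sumℕ (λ k → u (axis i k)) (suc N)) t
boxSum-axis zero    u t N h = sumℕ-cong t (suc N) λ k →
  boxSum-zero (λ α → u (k ∷ α)) t N (λ α α≢0 → h (k ∷ α) (α≢0 ∘ Vecₚ.∷-injectiveʳ))
boxSum-axis (suc i) u t N h = trans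
  (sumℕ-first (λ k → boxSum (λ α → u (k ∷ α)) (suc N)) t N λ k →
    trans (boxSum-axis i (λ α → u (suc k ∷ α)) t N (λ α _ → h (suc k ∷ α) λ ()))
      (sumℕ-zero (λ j → u (suc k ∷ axis i j)) (suc N) (λ j → h (suc k ∷ axis i j) λ ())))
  (boxSum-axis i (λ α → u (0 ∷ α)) t N (λ α α≢ → h (0 ∷ α) (α≢ ∘ Vecₚ.∷-injectiveʳ)))
  where
  sumℕ-zero : ∀ (u : ℕ → ℝ) N → (∀ k → seq (u k) t ≡ 0ℚ) → seq (sumℕ u N) t ≡ 0ℚ
  sumℕ-zero u zero    h = refl
  sumℕ-zero u (suc N) h = cong₂ _+′_ (sumℕ-zero u N h) (h N)

G′ : ℚ → ℝ → ℝ
G′ e x = const 3ℚ * (x * x) - const 4ℚ * x + (1ℝ + const e)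

-- The cubic's derivatives at a over factorials: value, first derivative, half the second, a sixth
-- of the third.
taylor : ℚ → ℝ → ℕ → ℝ
taylor e a 0 = G e a
taylor e a 1 = G′ e a
taylor e a 2 = const 3ℚ * a - const 2ℚ
taylor e a 3 = 1ℝ
taylor e a (suc (suc (suc (suc _)))) = 0ℝ

taylor-expansion : ∀ (e a x : ℚ) → let y = x -′ a in
  0ℚ +′ a *′ ((a -′ 1ℚ) *′ (a -′ 1ℚ) +′ e) *′ 1ℚ +′ (3ℚ *′ (a *′ a) -′ 4ℚ *′ a +′ (1ℚ +′ e)) *′ (y *′ 1ℚ)
    +′ (3ℚ *′ a -′ 2ℚ) *′ (y *′ (y *′ 1ℚ)) +′ 1ℚ *′ (y *′ (y *′ (y *′ 1ℚ))) ≡ x *′ ((x -′ 1ℚ) *′ (x -′ 1ℚ) +′ e)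
taylor-expansion = solve-∀ ℚ-ring

⟶-eventually : ∀ (a : ℕ → ℝ) l M → (∀ j t → seq (a (j ℕ.+ M)) t ≡ seq l t) → a ⟶ l
⟶-eventually a l M h ε 0<ε = M , λ m M≤m → ≤-pointwise ∣ a m - l ∣ (const ε) λ t →
  ≡⇒∣∣≤ (ℚₚ.<⇒≤ 0<ε) (trans (cong (λ m → seq (a m) t) (sym (ℕₚ.m∸n+n≡m M≤m))) (h (m ℕ.∸ M) t))

-- Component i is a cubic in the i-th coordinate, so its expansion at a is finite and any radius
-- serves. Coefficients off the i-th axis vanish, and box sums are constant from size 4 on.
F-analytic : ∀ {n} (e : Fin n → ℚ) → IsAnalytic (F e)
F-analytic {n} e a = 1ℚ , 0<1 , c , λ x _ i →
    (sumℕ (λ k → ∣ term x i (axis i k) ∣) 4 ,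
      ⟶-eventually (boxSum (λ α → ∣ term x i α ∣)) (sumℕ (λ k → ∣ term x i (axis i k) ∣) 4) 4 (λ j t →
        collapse i (λ α → ∣ term x i α ∣) t j
          (λ α α≢ → cong ∣_∣′ (off x i α t α≢)) (λ k → cong ∣_∣′ (high x i k t)))) ,
    ⟶-eventually (boxSum (term x i)) (F e x i) 4 λ j t →
      trans (collapse i (term x i) t j (λ α α≢ → off x i α t α≢) (λ k → high x i k t))
        (trans (low x i t) (sym (seq-F e x i t)))
  where
  c : Fin n → MultiIndex n → ℝ
  c i α with Vecₚ.≡-dec ℕ._≟_ α (axis i (lookup α i))
  ... | yes _ = taylor (e i) (a i) (lookup α i)
  ... | no  _ = 0ℝ
  term : Point n → Fin n → MultiIndex n → ℝ
  term x i α = c i α * monomial α (x ⊟ a)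
  c-axis : ∀ i k → c i (axis i k) ≡ taylor (e i) (a i) k
  c-axis i k with Vecₚ.≡-dec ℕ._≟_ (axis i k) (axis i (lookup (axis i k) i))
  ... | yes _ = cong (taylor (e i) (a i)) (lookup-axis i k)
  ... | no ¬p = ⊥-elim (¬p (cong (axis i) (sym (lookup-axis i k))))
  c-off : ∀ i α → α ≢ axis i (lookup α i) → c i α ≡ 0ℝ
  c-off i α ¬p with Vecₚ.≡-dec ℕ._≟_ α (axis i (lookup α i))
  ... | yes p = ⊥-elim (¬p p)
  ... | no  _ = refl
  off : ∀ x i α t → α ≢ axis i (lookup α i) → seq (term x i α) t ≡ 0ℚ
  off x i α t α≢ = trans (cong (λ r → seq r t *′ seq (monomial α (x ⊟ a)) t) (c-off i α α≢)) (ℚₚ.*-zeroˡ (seq (monomial α (x ⊟ a)) t))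
  on : ∀ x i k t → seq (term x i (axis i k)) t
                 ≡ seq (taylor (e i) (a i) k) t *′ pow (seq (x i) t -′ seq (a i) t) k
  on x i k t = cong₂ _*′_ (cong (λ r → seq r t) (c-axis i k)) (monomial-axis i k (x ⊟ a) t)
  high : ∀ x i k t → seq (term x i (axis i (k ℕ.+ 4))) t ≡ 0ℚ
  high x i k t rewrite ℕₚ.+-comm k 4 = trans (on x i (4 ℕ.+ k) t) (ℚₚ.*-zeroˡ (pow (seq (x i) t -′ seq (a i) t) (4 ℕ.+ k)))
  low : ∀ x i t → seq (sumℕ (λ k → term x i (axis i k)) 4) t ≡ g (e i) (seq (x i) t)
  low x i t = trans (cong₂ _+′_ (cong₂ _+′_ (cong₂ _+′_ (cong (0ℚ +′_) (on x i 0 t)) (on x i 1 t)) (on x i 2 t)) (on x i 3 t))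
    (taylor-expansion (e i) (seq (a i) t) (seq (x i) t))
  collapse : ∀ i (u : MultiIndex n → ℝ) t j → (∀ α → α ≢ axis i (lookup α i) → seq (u α) t ≡ 0ℚ) →
             (∀ k → seq (u (axis i (k ℕ.+ 4))) t ≡ 0ℚ) →
             seq (boxSum u (j ℕ.+ 4)) t ≡ seq (sumℕ (λ k → u (axis i k)) 4) t
  collapse i u t j h₁ h₂ = trans (cong (λ N → seq (boxSum u N) t) (ℕₚ.+-comm j 4))
    (trans (boxSum-axis i u t (3 ℕ.+ j) h₁) (trans (cong (λ N → seq (sumℕ (λ k → u (axis i k)) N) t) (ℕₚ.+-comm 4 j))
      (sumℕ-stable (λ k → u (axis i k)) t 4 j h₂)))

vectorField : ∀ {n} → (Fin n → ℚ) → ω n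
vectorField e = record { fun = F e ; cong-fun = F-cong e ; analytic = F-analytic e }

diag : ∀ {n} → (Fin n → ℝ) → Matrix n
diag d i j with i Finₚ.≟ j
... | yes _ = d i
... | no  _ = 0ℝ

diag-on : ∀ {n} (d : Fin n → ℝ) i → diag d i i ≡ d i
diag-on d i with i Finₚ.≟ i
... | yes _ = refl
... | no ¬p = ⊥-elim (¬p refl)

diag-off : ∀ {n} (d : Fin n → ℝ) i j → i ≢ j → diag d i j ≡ 0ℝ
diag-off d i j i≢j with i Finₚ.≟ j
... | yes p = ⊥-elim (i≢j p)
... | no  _ = refl

diag-· : ∀ {n} (d : Fin n → ℝ) v i t → seq ((diag d · v) i) t ≡ seq (d i) t *′ seq (v i) t
diag-· d v i t = trans
  (sum-single i (λ j → diag d i j * v j) t (λ j i≢j →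
    trans (cong (λ a → seq a t *′ seq (v j) t) (diag-off d i j i≢j)) (ℚₚ.*-zeroˡ (seq (v j) t))))
  (cong (λ a → seq a t *′ seq (v i) t) (diag-on d i))

DF : ∀ {n} → (Fin n → ℚ) → Point n → Matrix n
DF e a = diag λ i → G′ (e i) (a i)

-- A real inequality holds for the entries only up to an allowance; the allowance 3δ² turns δ² into
-- (2δ)².
ball⇒small : ∀ {n} (h : Point n) δ → 0ℚ <′ δ → ClosedBall 0ⁿ δ h →
             Eventually (λ k → ∀ i → ∣ seq (h i) k ∣′ ≤′ 2ℚ *′ δ)
ball⇒small h δ 0<δ (_ , p) = ev-map (λ k q i → sq-cancel {seq (h i) k} (ℚₚ.<⇒≤ (0<2 ⊗< 0<δ))
    (subst₂ _≤′_ (cong (λ z → z *′ z) (ℚₚ.+-identityʳ (seq (h i) k))) (lemma δ)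
      (ℚₚ.≤-trans (square≤norm (h ⊟ 0ⁿ) i k) q)))
  (p (3ℚ *′ (δ *′ δ)) ((0<1 ⊕< 0≤2) ⊗< (0<δ ⊗< 0<δ)))
  where
  lemma : ∀ (d : ℚ) → d *′ d +′ 3ℚ *′ (d *′ d) ≡ (2ℚ *′ d) *′ (2ℚ *′ d)
  lemma = solve-∀ ℚ-ring

-- h² (3a - 2 + h) is the Taylor remainder of the cubic. As |h| ≤ 1, the bracket is at most 3b + 3;
-- together with one factor h, at most 2δ, it stays below ε, and the other factor h remains.
remainder-≤ : ∀ b δ ε a h → 0ℚ ≤′ b → 0ℚ ≤′ δ → 2ℚ *′ δ ≤′ 1ℚ → 2ℚ *′ δ *′ (3ℚ *′ b +′ 3ℚ) ≤′ ε → ∣ a ∣′ ≤′ b → ∣ h ∣′ ≤′ 2ℚ *′ δ →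
              let r = h *′ (h *′ (3ℚ *′ a -′ 2ℚ +′ h)) in r *′ r ≤′ (ε *′ ε) *′ (h *′ h)
remainder-≤ b δ ε a h 0≤b 0≤δ δ≤½ small ha hh = subst₂ _≤′_ (lemma₁ h r′) (lemma₂ ε h)
    (*-mono′ (0≤sq h) ℚₚ.≤-refl (0≤sq r′) (sq-mono {r′} r′≤ε))
  where
  r′ = h *′ (3ℚ *′ a -′ 2ℚ +′ h)
  0≤3 : 0ℚ ≤′ 3ℚ
  0≤3 = 0≤1 ⊕ 0≤2
  lemma₁ : ∀ (h r : ℚ) → (h *′ h) *′ (r *′ r) ≡ (h *′ r) *′ (h *′ r)
  lemma₁ = solve-∀ ℚ-ring
  lemma₂ : ∀ (e h : ℚ) → (h *′ h) *′ (e *′ e) ≡ (e *′ e) *′ (h *′ h)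
  lemma₂ = solve-∀ ℚ-ring
  up : ∀ (a b d h : ℚ) → 3ℚ *′ b +′ 3ℚ ≡ 3ℚ *′ a -′ 2ℚ +′ h +′ (3ℚ *′ (b -′ a) +′ (2ℚ *′ d -′ h) +′ (1ℚ -′ 2ℚ *′ d) +′ 4ℚ)
  up = solve-∀ ℚ-ring
  down : ∀ (a b d h : ℚ) → 3ℚ *′ b +′ 3ℚ ≡ -′ (3ℚ *′ a -′ 2ℚ +′ h) +′ (3ℚ *′ (b -′ -′ a) +′ (2ℚ *′ d -′ -′ h) +′ (1ℚ -′ 2ℚ *′ d))
  down = solve-∀ ℚ-ring
  factor : ∣ 3ℚ *′ a -′ 2ℚ +′ h ∣′ ≤′ 3ℚ *′ b +′ 3ℚ
  factor = ∣∣≤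
    (≤-cert (0≤3 ⊗′ slack (∣∣≤⇒≤ ha) ⊕ slack (∣∣≤⇒≤ hh) ⊕ slack δ≤½ ⊕ (0≤2 ⊕ 0≤2)) (up a b δ h))
    (≤-cert (0≤3 ⊗′ slack (∣∣≤⇒-≤ ha) ⊕ slack (∣∣≤⇒-≤ hh) ⊕ slack δ≤½) (down a b δ h))
  r′≤ε : ∣ r′ ∣′ ≤′ ε
  r′≤ε = ℚₚ.≤-trans (∣∣-mul-mono {h} {2ℚ *′ δ} {3ℚ *′ a -′ 2ℚ +′ h} {3ℚ *′ b +′ 3ℚ} hh factor) small

F-jacobian : ∀ {n} (e : Fin n → ℚ) → IsJacobian (F e) (DF e)
F-jacobian {n} e a ε 0<ε =
  let (b , 0<b , B) = bounded-point a
      (δ₀ , 0<δ₀ , eq) = quotient (0<c b 0<b) 0<ε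
      δ = δ₀ ℚ.⊓ ½
      0<δ = ⊓-pos 0<δ₀ 0<½
      small = ≤-cert (ℚₚ.<⇒≤ (0<c b 0<b) ⊗′ slack (ℚₚ.p⊓q≤p δ₀ ½)) (trans (sym eq) (lemma₁ b δ δ₀))
      δ≤½ = ≤-cert (0≤2 ⊗′ slack (ℚₚ.p⊓q≤q δ₀ ½)) (lemma₂ δ)
  in δ , 0<δ , λ h h∈ → ≤-eventually ∥ (F e (a ⊞ h) ⊟ F e a) ⊟ DF e a · h ∥² (const (ε *′ ε) * ∥ h ∥²)
       (ev-map₂ (λ k ha hh → sum-≤-scale (ε *′ ε)
           (λ i → let r = F e (a ⊞ h) i - F e a i - (DF e a · h) i in r * r) (λ i → h i * h i) k
           (λ i → subst (λ r → r *′ r ≤′ ε *′ ε *′ (seq (h i) k *′ seq (h i) k)) (sym (remainder h i k))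
             (remainder-≤ b δ ε (seq (a i) k) (seq (h i) k) (ℚₚ.<⇒≤ 0<b) (ℚₚ.<⇒≤ 0<δ) δ≤½ small (ha i) (hh i))))
         B (ball⇒small h δ 0<δ h∈))
  where
  0<c : ∀ b → 0ℚ <′ b → 0ℚ <′ 2ℚ *′ (3ℚ *′ b +′ 3ℚ)
  0<c b 0<b = 0<2 ⊗< ((0<1 ⊕< 0≤2) ⊗< 0<b ⊕< (0≤1 ⊕ 0≤2))
  lemma₁ : ∀ (b d d₀ : ℚ) → 2ℚ *′ (3ℚ *′ b +′ 3ℚ) *′ d₀ ≡ 2ℚ *′ d *′ (3ℚ *′ b +′ 3ℚ) +′ 2ℚ *′ (3ℚ *′ b +′ 3ℚ) *′ (d₀ -′ d)
  lemma₁ = solve-∀ ℚ-ring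
  lemma₂ : ∀ (d : ℚ) → 1ℚ ≡ 2ℚ *′ d +′ 2ℚ *′ (½ -′ d)
  lemma₂ = solve-∀ ℚ-ring
  lemma₃ : ∀ (e a h : ℚ) → (a +′ h) *′ ((a +′ h -′ 1ℚ) *′ (a +′ h -′ 1ℚ) +′ e) -′ a *′ ((a -′ 1ℚ) *′ (a -′ 1ℚ) +′ e)
    -′ (3ℚ *′ (a *′ a) -′ 4ℚ *′ a +′ (1ℚ +′ e)) *′ h ≡ h *′ (h *′ (3ℚ *′ a -′ 2ℚ +′ h))
  lemma₃ = solve-∀ ℚ-ring
  remainder : ∀ h i k → seq (F e (a ⊞ h) i - F e a i - (DF e a · h) i) k
    ≡ seq (h i) k *′ (seq (h i) k *′ (3ℚ *′ seq (a i) k -′ 2ℚ +′ seq (h i) k))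
  remainder h i k = trans
    (cong₂ _-′_ (cong₂ _-′_ (seq-F e (a ⊞ h) i k) (seq-F e a i k)) (diag-· (λ i → G′ (e i) (a i)) h i k))
    (lemma₃ (e i) (seq (a i) k) (seq (h i) k))

sumᶜ-re : ∀ {n} (u : Fin n → ℂ) → proj₁ (sumᶜ u) ≡ sum (proj₁ ∘ u)
sumᶜ-re {zero}  u = refl
sumᶜ-re {suc n} u = cong (proj₁ (u zero) +_) (sumᶜ-re (u ∘ suc))

sumᶜ-im : ∀ {n} (u : Fin n → ℂ) → proj₂ (sumᶜ u) ≡ sum (proj₂ ∘ u)
sumᶜ-im {zero}  u = refl
sumᶜ-im {suc n} u = cong (proj₂ (u zero) +_) (sumᶜ-im (u ∘ suc))

-- A purely imaginary μ with μ v = λ v, λ ≥ 1, forces |v|² ≤ λ |v|² = Re (v̄ (λ - μ) v) = 0.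
eigenvector-≤ : ∀ l m w a b B δ → 1ℚ ≤′ l → 0ℚ ≤′ δ → ∣ a ∣′ ≤′ B → ∣ b ∣′ ≤′ B →
  ∣ l *′ a -′ (m *′ a -′ w *′ b) ∣′ ≤′ δ → ∣ l *′ b -′ (m *′ b +′ w *′ a) ∣′ ≤′ δ → ∣ m ∣′ ≤′ δ →
  a *′ a +′ b *′ b ≤′ 2ℚ *′ B *′ δ +′ 2ℚ *′ (B *′ B) *′ δ
eigenvector-≤ l m w a b B δ 1≤l 0≤δ ha hb h₁ h₂ hm =
  ≤-cert (slack 1≤l ⊗′ (0≤sq a ⊕ 0≤sq b)
          ⊕ slack (∣∣≤⇒≤ (∣∣-mul-mono {a} {B} {r} {δ} ha h₁)) ⊕ slack (∣∣≤⇒≤ (∣∣-mul-mono {b} {B} {s} {δ} hb h₂))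
          ⊕ slack (∣∣≤⇒≤ hm) ⊗′ (0≤sq a ⊕ 0≤sq b)
          ⊕ 0≤δ ⊗′ (slack (sq-mono {a} ha) ⊕ slack (sq-mono {b} hb)))
    (lemma l m w a b B δ)
  where
  r = l *′ a -′ (m *′ a -′ w *′ b)
  s = l *′ b -′ (m *′ b +′ w *′ a)
  lemma : ∀ (l m w a b B d : ℚ) → 2ℚ *′ B *′ d +′ 2ℚ *′ (B *′ B) *′ d ≡ a *′ a +′ b *′ b +′
    ((l -′ 1ℚ) *′ (a *′ a +′ b *′ b) +′ (B *′ d -′ a *′ (l *′ a -′ (m *′ a -′ w *′ b))) +′ (B *′ d -′ b *′ (l *′ b -′ (m *′ b +′ w *′ a)))
      +′ (d -′ m) *′ (a *′ a +′ b *′ b) +′ d *′ ((B *′ B -′ a *′ a) +′ (B *′ B -′ b *′ b)))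
  lemma = solve-∀ ℚ-ring

-- An eigenvector is nonzero only in the negative sense, so no nonzero coordinate has to be found:
-- `eigenvector-≤` makes every |v i|² smaller than any ε², and thus all coordinates vanish.
diag-hyperbolic : ∀ {n} (d : Fin n → ℝ) → (∀ i t → 1ℚ ≤′ seq (d i) t) →
                  ∀ μ → IsEigenvalue (diag d) μ → ¬ (re μ ≃ 0ℝ)
diag-hyperbolic d 1≤d (m , w) (v , v≄0 , eig) m≃0 = v≄0 λ i →
    (λ ε 0<ε → ev-map (λ k h → subst (λ z → ∣ z ∣′ ≤′ ε) (sym (ℚₚ.+-identityʳ (seq (proj₁ (v i)) k)))
      (sq-cancel {seq (proj₁ (v i)) k} (ℚₚ.<⇒≤ 0<ε)
        (≤-cert (slack h ⊕ 0≤sq (seq (proj₂ (v i)) k)) (lemma₁ (seq (proj₁ (v i)) k) (seq (proj₂ (v i)) k) ε)))) (small i ε 0<ε)) ,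
    (λ ε 0<ε → ev-map (λ k h → subst (λ z → ∣ z ∣′ ≤′ ε) (sym (ℚₚ.+-identityʳ (seq (proj₂ (v i)) k)))
      (sq-cancel {seq (proj₂ (v i)) k} (ℚₚ.<⇒≤ 0<ε)
        (≤-cert (slack h ⊕ 0≤sq (seq (proj₁ (v i)) k)) (lemma₂ (seq (proj₁ (v i)) k) (seq (proj₂ (v i)) k) ε)))) (small i ε 0<ε))
  where
  lemma₁ : ∀ (a b e : ℚ) → e *′ e ≡ a *′ a +′ ((e *′ e -′ (a *′ a +′ b *′ b)) +′ b *′ b)
  lemma₁ = solve-∀ ℚ-ring
  lemma₂ : ∀ (a b e : ℚ) → e *′ e ≡ b *′ b +′ ((e *′ e -′ (a *′ a +′ b *′ b)) +′ a *′ a)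
  lemma₂ = solve-∀ ℚ-ring
  lemma₃ : ∀ (B δ : ℚ) → 2ℚ *′ B *′ δ +′ 2ℚ *′ (B *′ B) *′ δ ≡ (2ℚ *′ B +′ 2ℚ *′ (B *′ B)) *′ δ
  lemma₃ = solve-∀ ℚ-ring
  lemma₄ : ∀ (l a b : ℚ) → l *′ a -′ 0ℚ *′ b ≡ l *′ a
  lemma₄ = solve-∀ ℚ-ring
  lemma₅ : ∀ (l a b : ℚ) → l *′ b +′ 0ℚ *′ a ≡ l *′ b
  lemma₅ = solve-∀ ℚ-ring
  lemma₆ : ∀ (a b : ℚ) → 0ℚ *′ a -′ 0ℚ *′ b ≡ 0ℚ
  lemma₆ = solve-∀ ℚ-ring
  lemma₇ : ∀ (a b : ℚ) → 0ℚ *′ b +′ 0ℚ *′ a ≡ 0ℚ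
  lemma₇ = solve-∀ ℚ-ring
  row : ∀ i → Fin _ → ℂ
  row i j = (diag d i j , 0ℝ) *ᶜ v j
  row-re : ∀ i k → seq (proj₁ (sumᶜ (row i))) k ≡ seq (d i) k *′ seq (proj₁ (v i)) k
  row-re i k = trans (cong (λ x → seq x k) (sumᶜ-re (row i)))
    (trans (sum-single i (proj₁ ∘ row i) k (λ j i≢j → trans
        (cong (λ l → seq l k *′ seq (proj₁ (v j)) k -′ 0ℚ *′ seq (proj₂ (v j)) k) (diag-off d i j i≢j))
        (lemma₆ (seq (proj₁ (v j)) k) (seq (proj₂ (v j)) k))))
      (trans (cong (λ l → seq l k *′ seq (proj₁ (v i)) k -′ 0ℚ *′ seq (proj₂ (v i)) k) (diag-on d i))
        (lemma₄ (seq (d i) k) (seq (proj₁ (v i)) k) (seq (proj₂ (v i)) k))))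
  row-im : ∀ i k → seq (proj₂ (sumᶜ (row i))) k ≡ seq (d i) k *′ seq (proj₂ (v i)) k
  row-im i k = trans (cong (λ x → seq x k) (sumᶜ-im (row i)))
    (trans (sum-single i (proj₂ ∘ row i) k (λ j i≢j → trans
        (cong (λ l → seq l k *′ seq (proj₂ (v j)) k +′ 0ℚ *′ seq (proj₁ (v j)) k) (diag-off d i j i≢j))
        (lemma₇ (seq (proj₁ (v j)) k) (seq (proj₂ (v j)) k))))
      (trans (cong (λ l → seq l k *′ seq (proj₂ (v i)) k +′ 0ℚ *′ seq (proj₁ (v i)) k) (diag-on d i))
        (lemma₅ (seq (d i) k) (seq (proj₁ (v i)) k) (seq (proj₂ (v i)) k))))
  small : ∀ i ε → 0ℚ <′ ε → Eventually (λ k →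
    seq (proj₁ (v i)) k *′ seq (proj₁ (v i)) k +′ seq (proj₂ (v i)) k *′ seq (proj₂ (v i)) k ≤′ ε *′ ε)
  small i ε 0<ε =
    let (A , 0<A , hA) = bounded (proj₁ (v i))
        (C , 0<C , hC) = bounded (proj₂ (v i))
        B = A +′ C
        0<B = 0<A ⊕< ℚₚ.<⇒≤ 0<C
        (δ , 0<δ , eq) = quotient (0<2 ⊗< 0<B ⊕< (0≤2 ⊗′ 0≤sq B)) (0<ε ⊗< 0<ε)
    in ev-map₃ (λ k (ha , hc) (h₁ , h₂) hm → subst (_ ≤′_) (trans (lemma₃ B δ) eq)
         (eigenvector-≤ (seq (d i) k) (seq m k) (seq w k) (seq (proj₁ (v i)) k) (seq (proj₂ (v i)) k) B δ
           (1≤d i k) (ℚₚ.<⇒≤ 0<δ) (weaken-≤ (ℚₚ.<⇒≤ 0<C) ha)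
           (subst (∣ seq (proj₂ (v i)) k ∣′ ≤′_) (ℚₚ.+-comm C A) (weaken-≤ (ℚₚ.<⇒≤ 0<A) hc))
           (subst (λ z → ∣ z -′ _ ∣′ ≤′ δ) (row-re i k) h₁) (subst (λ z → ∣ z -′ _ ∣′ ≤′ δ) (row-im i k) h₂)
           (subst (λ z → ∣ z ∣′ ≤′ δ) (ℚₚ.+-identityʳ (seq m k)) hm)))
       (ev-× hA hC) (ev-× (proj₁ (eig i) δ 0<δ) (proj₂ (eig i) δ 0<δ)) (m≃0 δ 0<δ)

F-hyperbolic : ∀ {n} (e : Fin n → ℚ) → (∀ i → 0ℚ ≤′ e i) → HyperbolicEquilibrium (F e) 0ⁿ
F-hyperbolic e 0≤e =
  (λ i → ≃-pointwise (F e 0ⁿ i) 0ℝ (λ t → trans (seq-F e 0ⁿ i t) (lemma₁ (e i)))) ,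
  DF e 0ⁿ , F-jacobian e 0ⁿ , diag-hyperbolic (λ i → G′ (e i) 0ℝ) (λ i _ → ≤-cert (0≤e i) (lemma₂ (e i)))
  where
  lemma₁ : ∀ (e : ℚ) → 0ℚ *′ ((0ℚ -′ 1ℚ) *′ (0ℚ -′ 1ℚ) +′ e) ≡ 0ℚ
  lemma₁ = solve-∀ ℚ-ring
  lemma₂ : ∀ (e : ℚ) → 3ℚ *′ (0ℚ *′ 0ℚ) -′ 4ℚ *′ 0ℚ +′ (1ℚ +′ e) ≡ 1ℚ +′ e
  lemma₂ = solve-∀ ℚ-ring

-- The C¹ distance between two of the fields.

≤∣∣ : ∀ x → x ≤ ∣ x ∣
≤∣∣ x = ≤-pointwise x ∣ x ∣ (λ t → a≤∣a∣ (seq x t))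

norm-single : ∀ {m} (v : Point (suc m)) t → (∀ j → seq (v (suc j)) t ≡ 0ℚ) → seq ∥ v ∥² t ≡ seq (v zero) t *′ seq (v zero) t
norm-single v t h = sum-single zero (λ i → v i * v i) t λ
  { zero 0≢0 → ⊥-elim (0≢0 refl) ; (suc j) _ → cong (λ z → z *′ z) (h j) }

-- For η ≥ 0, the maximum of |η x₀| over a closed ball of radius s whose centre has first coordinate
-- c.
gain : ℚ → ℚ → ℚ → ℚ
gain η c s = η *′ (∣ c ∣′ +′ s)

-- Covers both kinds of maximum in the distance: the fields differ by (ε - ε₀) x₀ in the first
-- component, and the difference of their Jacobians maps v to (ε - ε₀) v₀ in the first component.
module _ {m : ℕ} (V : Point (suc m) → Point (suc m)) (η : ℚ) (0≤η : 0ℚ ≤′ η)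
         (normV : ∀ x t → seq ∥ V x ∥² t ≡ η *′ seq (x zero) t *′ (η *′ seq (x zero) t))
         (a : Point (suc m)) (c : ℚ) (a₀≡c : ∀ t → seq (a zero) t ≡ c) (s : ℚ) (0≤s : 0ℚ ≤′ s) where

  private
    M : ℚ
    M = gain η c s

    0≤M : 0ℚ ≤′ M
    0≤M = 0≤η ⊗′ (0≤∣∣ c ⊕ 0≤s)

    -- A maximum must be attained, so a first coordinate r is moved from c by s away from 0. The
    -- direction is decidable because c is rational.
    away : ∃[ r ] (r -′ c) *′ (r -′ c) ≡ s *′ s × η *′ r *′ (η *′ r) ≡ M *′ M
    away with ∣∣-cases c
    ... | inj₁ e rewrite e = c +′ s , lemma₁ c s , refl
      where
      lemma₁ : ∀ (c s : ℚ) → (c +′ s -′ c) *′ (c +′ s -′ c) ≡ s *′ s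
      lemma₁ = solve-∀ ℚ-ring
    ... | inj₂ e rewrite e = c -′ s , lemma₁ c s , lemma₂ η c s
      where
      lemma₁ : ∀ (c s : ℚ) → (c -′ s -′ c) *′ (c -′ s -′ c) ≡ s *′ s
      lemma₁ = solve-∀ ℚ-ring
      lemma₂ : ∀ (η c s : ℚ) → η *′ (c -′ s) *′ (η *′ (c -′ s)) ≡ η *′ (-′ c +′ s) *′ (η *′ (-′ c +′ s))
      lemma₂ = solve-∀ ℚ-ring

    extremal : Point (suc m)
    extremal zero    = const (proj₁ away)
    extremal (suc i) = a (suc i)

    extremal∈ : ClosedBall a s extremal
    extremal∈ = 0≤s , ≤-pointwise ∥ extremal ⊟ a ∥² (const (s *′ s)) λ t → ℚₚ.≤-reflexive
      (trans (norm-single (extremal ⊟ a) t (λ j → ℚₚ.+-inverseʳ (seq (a (suc j)) t)))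
        (trans (cong (λ c → (proj₁ away -′ c) *′ (proj₁ away -′ c)) (a₀≡c t)) (proj₁ (proj₂ away))))

    first-≤ : ∀ x → ClosedBall a s x → ∣ x zero ∣ ≤ const (∣ c ∣′ +′ s)
    first-≤ x (_ , p) ε 0<ε = ev-map (λ t h → subst (_≤′ ∣ c ∣′ +′ s +′ ε) (cong ∣_∣′ (lemma₁ c (seq (x zero) t)))
        (ℚₚ.≤-trans (ℚₚ.∣p+q∣≤∣p∣+∣q∣ c (seq (x zero) t -′ c))
          (≤-cert (slack (subst (λ c → ∣ seq (x zero) t -′ c ∣′ ≤′ s +′ ε) (a₀≡c t) h))
            (lemma₂ ∣ c ∣′ ∣ seq (x zero) t -′ c ∣′ s ε))))
      (sqrt-≤ (x zero - a zero) (const s) (≤-pointwise 0ℝ (const s) (λ _ → 0≤s))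
        (≤-trans ((x zero - a zero) * (x zero - a zero)) ∥ x ⊟ a ∥² (const (s *′ s))
          (≤-pointwise ((x zero - a zero) * (x zero - a zero)) ∥ x ⊟ a ∥² (square≤norm (x ⊟ a) zero)) p) ε 0<ε)
      where
      lemma₁ : ∀ (c x : ℚ) → c +′ (x -′ c) ≡ x
      lemma₁ = solve-∀ ℚ-ring
      lemma₂ : ∀ (c z s e : ℚ) → c +′ s +′ e ≡ c +′ z +′ (s +′ e -′ z)
      lemma₂ = solve-∀ ℚ-ring

    scaled-≤ : ∀ x → ∣ x ∣ ≤ const (∣ c ∣′ +′ s) → ∣ const η * x ∣ ≤ ∣ const M ∣
    scaled-≤ x p = ≤-trans (∣ const η * x ∣) (const M) (∣ const M ∣) step (≤∣∣ (const M))
      where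
      lemma : ∀ (η u v d : ℚ) → η *′ v +′ (1ℚ +′ η) *′ d ≡ η *′ u +′ (η *′ (v +′ d -′ u) +′ d)
      lemma = solve-∀ ℚ-ring
      step : ∣ const η * x ∣ ≤ const M
      step ε 0<ε =
        let (δ , 0<δ , e) = quotient (0<1 ⊕< 0≤η) 0<ε
        in ev-map (λ t h → subst (_≤′ M +′ ε) (sym (trans (∣∣-mul η (seq x t)) (cong (_*′ ∣ seq x t ∣′) (ℚₚ.0≤p⇒∣p∣≡p 0≤η))))
             (≤-cert (0≤η ⊗′ slack h ⊕ ℚₚ.<⇒≤ 0<δ) (trans (cong (M +′_) (sym e)) (lemma η ∣ seq x t ∣′ (∣ c ∣′ +′ s) δ)))) (p δ 0<δ)

  max-norm : MaxOn (ClosedBall a s) (λ x → Norm (V x)) (const M)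
  max-norm = (extremal , extremal∈ , ≤-pointwise 0ℝ (const M) (λ _ → 0≤M) ,
      ≃-pointwise (const M * const M) ∥ V extremal ∥² (λ t → sym (trans (normV extremal t) (proj₂ (proj₂ away))))) ,
    λ x r x∈ (0≤r , e) → ≤-trans r (∣ r ∣) (const M) (≤∣∣ r)
      (sqrt-≤ r (const M) (≤-pointwise 0ℝ (const M) (λ _ → 0≤M))
        (≤-trans (r * r) ∥ V x ∥² (const M * const M) (≃⇒≤ (r * r) ∥ V x ∥² e)
          (≤-trans ∥ V x ∥² ((const η * x zero) * (const η * x zero)) (const M * const M)
            (≤-pointwise ∥ V x ∥² ((const η * x zero) * (const η * x zero)) (λ t → ℚₚ.≤-reflexive (normV x t)))
            (square-≤ (const η * x zero) (const M) (scaled-≤ (x zero) (first-≤ x x∈))))))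

perturb : ∀ {m} → ℚ → Fin (suc m) → ℚ
perturb ε zero    = ε
perturb ε (suc _) = 0ℚ

module _ {m : ℕ} (ε ε₀ : ℚ) where

  F-difference : ∀ (x : Point (suc m)) t → seq ∥ F (perturb ε) x ⊟ F (perturb ε₀) x ∥² t
    ≡ (ε -′ ε₀) *′ seq (x zero) t *′ ((ε -′ ε₀) *′ seq (x zero) t)
  F-difference x t = trans
    (norm-single (F (perturb ε) x ⊟ F (perturb ε₀) x) t λ j →
      trans (cong₂ _-′_ (seq-F (perturb ε) x (suc j) t) (seq-F (perturb ε₀) x (suc j) t)) (ℚₚ.+-inverseʳ (g 0ℚ (seq (x (suc j)) t))))
    (cong (λ z → z *′ z) (trans (cong₂ _-′_ (seq-F (perturb ε) x zero t) (seq-F (perturb ε₀) x zero t))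
      (lemma ε ε₀ (seq (x zero) t))))
    where
    lemma : ∀ (e e₀ x : ℚ) → x *′ ((x -′ 1ℚ) *′ (x -′ 1ℚ) +′ e) -′ x *′ ((x -′ 1ℚ) *′ (x -′ 1ℚ) +′ e₀) ≡ (e -′ e₀) *′ x
    lemma = solve-∀ ℚ-ring

  DF-difference : ∀ (x v : Point (suc m)) t →
    seq ∥ (λ i j → DF (perturb ε) x i j - DF (perturb ε₀) x i j) · v ∥² t
    ≡ (ε -′ ε₀) *′ seq (v zero) t *′ ((ε -′ ε₀) *′ seq (v zero) t)
  DF-difference x v t = trans
    (norm-single (A · v) t λ j → trans (entry (suc j)) (trans (cong (_*′ seq (v (suc j)) t) (lemma 0ℚ 0ℚ (seq (x (suc j)) t)))
      (ℚₚ.*-zeroˡ (seq (v (suc j)) t))))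
    (cong (λ z → z *′ z) (trans (entry zero) (cong (_*′ seq (v zero) t) (lemma ε ε₀ (seq (x zero) t)))))
    where
    A : Matrix (suc m)
    A i j = DF (perturb ε) x i j - DF (perturb ε₀) x i j
    lemma : ∀ (e e₀ x : ℚ) → (3ℚ *′ (x *′ x) -′ 4ℚ *′ x +′ (1ℚ +′ e)) -′ (3ℚ *′ (x *′ x) -′ 4ℚ *′ x +′ (1ℚ +′ e₀)) ≡ e -′ e₀
    lemma = solve-∀ ℚ-ring
    d d₀ : Fin (suc m) → ℝ
    d i  = G′ (perturb ε i) (x i)
    d₀ i = G′ (perturb ε₀ i) (x i)
    entry : ∀ i → seq ((A · v) i) t ≡ (seq (d i) t -′ seq (d₀ i) t) *′ seq (v i) t
    entry i = trans
      (sum-single i (λ j → A i j * v j) t λ j i≢j → trans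
        (cong₂ (λ a b → (seq a t -′ seq b t) *′ seq (v j) t) (diag-off d i j i≢j) (diag-off d₀ i j i≢j))
        (ℚₚ.*-zeroˡ (seq (v j) t)))
      (cong₂ (λ a b → (seq a t -′ seq b t) *′ seq (v i) t) (diag-on d i) (diag-on d₀ i))

ratio : ∀ q → 0ℚ ≤′ q → ∃[ u ] u *′ (1ℚ +′ q) ≡ q × 0ℚ ≤′ u × u ≤′ 1ℚ × u ≤′ q
ratio q 0≤q =
  let (δ , 0<δ , e) = quotient (0<1 ⊕< 0≤q) 0<1
      0≤δ = ℚₚ.<⇒≤ 0<δ
  in q *′ δ , trans (lemma₁ q δ) (trans (cong (q *′_) e) (ℚₚ.*-identityʳ q)) , 0≤q ⊗′ 0≤δ ,
     ≤-cert 0≤δ (trans (sym e) (lemma₂ q δ)) ,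
     ≤-cert (0≤q ⊗′ (0≤q ⊗′ 0≤δ)) (trans (sym (ℚₚ.*-identityʳ q)) (trans (cong (q *′_) (sym e)) (lemma₃ q δ)))
  where
  lemma₁ : ∀ (q d : ℚ) → q *′ d *′ (1ℚ +′ q) ≡ q *′ ((1ℚ +′ q) *′ d)
  lemma₁ = solve-∀ ℚ-ring
  lemma₂ : ∀ (q d : ℚ) → (1ℚ +′ q) *′ d ≡ q *′ d +′ d
  lemma₂ = solve-∀ ℚ-ring
  lemma₃ : ∀ (q d : ℚ) → q *′ ((1ℚ +′ q) *′ d) ≡ q *′ d +′ q *′ (q *′ d)
  lemma₃ = solve-∀ ℚ-ring

partial : (ℕ → ℚ) → ℕ → ℚ
partial w zero    = 0ℚ
partial w (suc N) = partial w N +′ w N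

seq-sumℕ : ∀ (u : ℕ → ℝ) (w : ℕ → ℚ) t → (∀ k → seq (u k) t ≡ w k) → ∀ N → seq (sumℕ u N) t ≡ partial w N
seq-sumℕ u w t h zero    = refl
seq-sumℕ u w t h (suc N) = cong₂ _+′_ (seq-sumℕ u w t h N) (h N)

partial-≤-scale : ∀ η w c → (∀ k → w k ≤′ η *′ c k) → ∀ N → partial w N ≤′ η *′ partial c N
partial-≤-scale η w c h zero    = ℚₚ.≤-reflexive (sym (ℚₚ.*-zeroʳ η))
partial-≤-scale η w c h (suc N) = subst (partial w (suc N) ≤′_) (sym (ℚₚ.*-distribˡ-+ η (partial c N) (c N)))
  (ℚₚ.+-mono-≤ (partial-≤-scale η w c h N) (h N))

module _ (w : ℕ → ℚ) (0≤w : ∀ k → 0ℚ ≤′ w k) (w≤ : ∀ k → w k ≤′ 2⁻ k *′ 2ℚ) where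

  partial-mono : ∀ j M → partial w M ≤′ partial w (j ℕ.+ M)
  partial-mono zero    M = ℚₚ.≤-refl
  partial-mono (suc j) M = weaken-≤ (0≤w (j ℕ.+ M)) (partial-mono j M)

  -- Including the bound 4 · 2⁻ᵏ for the remaining tail makes the induction close: each halving
  -- releases 2 · 2⁻ᵏ, enough for the next term.
  partial-tail : ∀ j M → partial w (j ℕ.+ M) +′ 4ℚ *′ 2⁻ (j ℕ.+ M) ≤′ partial w M +′ 4ℚ *′ 2⁻ M
  partial-tail zero    M = ℚₚ.≤-refl
  partial-tail (suc j) M = ℚₚ.≤-trans
    (≤-cert (slack (w≤ (j ℕ.+ M))) (lemma (partial w (j ℕ.+ M)) (w (j ℕ.+ M)) (2⁻ (j ℕ.+ M)))) (partial-tail j M)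
    where
    lemma : ∀ (S w t : ℚ) → S +′ 4ℚ *′ t ≡ S +′ w +′ 4ℚ *′ (½ *′ t) +′ (t *′ 2ℚ -′ w)
    lemma = solve-∀ ℚ-ring

  0≤4*2⁻ : ∀ k → 0ℚ ≤′ 4ℚ *′ 2⁻ k
  0≤4*2⁻ k = (0≤2 ⊕ 0≤2) ⊗′ 0≤2⁻ k

  partial-≤ : ∀ M t → partial w t ≤′ partial w M +′ 4ℚ *′ 2⁻ M
  partial-≤ M t with ℕₚ.≤-total t M
  ... | inj₁ t≤M = weaken-≤ (0≤4*2⁻ M)
    (subst (λ M → partial w t ≤′ partial w M) (ℕₚ.m∸n+n≡m t≤M) (partial-mono (M ℕ.∸ t) t))
  ... | inj₂ M≤t = subst (λ t → partial w t ≤′ partial w M +′ 4ℚ *′ 2⁻ M) (ℕₚ.m∸n+n≡m M≤t)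
    (ℚₚ.≤-trans (weaken-≤ (0≤4*2⁻ (t ℕ.∸ M ℕ.+ M)) ℚₚ.≤-refl) (partial-tail (t ℕ.∸ M) M))

  partial-cauchy : IsCauchy (partial w)
  partial-cauchy ε 0<ε =
    let (δ , 0<δ , e) = quotient (0<2 ⊕< 0≤2) 0<ε
        (M , h) = 2⁻-small δ 0<δ
        close : ∀ m n → M ℕ.≤ m → partial w n -′ partial w m ≤′ ε
        close m n M≤m = ≤-cert (slack (partial-≤ m n) ⊕ (0≤2 ⊕ 0≤2) ⊗′ slack (ℚₚ.≤-trans (2⁻-antitone M≤m) h))
          (trans (sym e) (lemma₁ (partial w m) (partial w n) (2⁻ m) δ))
    in M , λ m n M≤m M≤n → ∣∣≤ (close n m M≤n) (subst (_≤′ ε) (lemma₂ (partial w n) (partial w m)) (close m n M≤m))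
    where
    lemma₁ : ∀ (a b t d : ℚ) → 4ℚ *′ d ≡ b -′ a +′ ((a +′ 4ℚ *′ t -′ b) +′ 4ℚ *′ (d -′ t))
    lemma₁ = solve-∀ ℚ-ring
    lemma₂ : ∀ (a b : ℚ) → a -′ b ≡ -′ (b -′ a)
    lemma₂ = solve-∀ ℚ-ring

  series : ℝ
  series = mkℝ (partial w) partial-cauchy

  series-sum : (u : ℕ → ℝ) → (∀ k t → seq (u k) t ≡ w k) → sumℕ u ⟶ series
  series-sum u h ε 0<ε =
    let (N , close) = partial-cauchy ε 0<ε
    in N , λ M N≤M → ≤-eventually ∣ sumℕ u M - series ∣ (const ε) (ev-map
         (λ t N≤t → subst (λ s → ∣ s -′ partial w t ∣′ ≤′ ε) (sym (seq-sumℕ u w t (λ k → h k t) M)) (close M t N≤M N≤t)) (ev-≥ N))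

module _ {m : ℕ} (B : ℕ → RationalBall (suc m)) (0<radius : ∀ k → 0ℚ <′ proj₂ (B k)) where

  private
    centre radius : ℕ → ℚ
    centre k = lookup (proj₁ (B k)) zero
    radius k = proj₂ (B k)

  -- The k-th summand of the distance with q / (1 + q) replaced by its upper bound q, per unit of ε
  -- - ε₀.
  weight : ℕ → ℚ
  weight k = 2⁻ k *′ ((∣ centre k ∣′ +′ radius k) +′ (∣ 0ℚ ∣′ +′ 1ℚ))

  0≤weight : ∀ k → 0ℚ ≤′ weight k
  0≤weight k = 0≤2⁻ k ⊗′ ((0≤∣∣ (centre k) ⊕ ℚₚ.<⇒≤ (0<radius k)) ⊕ (0≤∣∣ 0ℚ ⊕ 0≤1))

  -- The balls of the cover may grow without bound, so the weights need not be summable. The second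
  -- bound is therefore linear in ε - ε₀ only for the first M summands and takes the geometric tail
  -- for the rest. The first bound serves the case ε = ε₀, where its factor vanishes.
  distance : ∀ ε ε₀ → ε₀ ≤′ ε → ∃[ d ] Distance B (F (perturb ε)) (F (perturb ε₀)) d ×
    (∀ t → seq d t ≤′ (ε -′ ε₀) *′ partial weight t) ×
    (∀ M t → seq d t ≤′ (ε -′ ε₀) *′ partial weight M +′ 4ℚ *′ 2⁻ M)
  distance ε ε₀ ε₀≤ε = series w 0≤w w≤2 ,
    (DF (perturb ε) , DF (perturb ε₀) , F-jacobian (perturb ε) , F-jacobian (perturb ε₀) ,
      (λ k → const (s k)) , (λ k → const s′) , (λ k → const (u k)) , (λ k → const u′) ,
      (λ k → max-norm (λ x → F (perturb ε) x ⊟ F (perturb ε₀) x) η 0≤η (F-difference ε ε₀) (ι (proj₁ (B k))) (centre k) (λ _ → refl)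
               (radius k) (0≤radius k)) ,
      -- The Jacobians differ by a constant matrix, so the centre attains the maximum. An operator
      -- norm at another point is attained at some v, where the same bound applies.
      (λ k → (ι (proj₁ (B k)) , centre∈ k , max-opNorm (ι (proj₁ (B k)))) ,
             λ x r _ ((v , v∈ , n) , _) → proj₂ (max-opNorm x) v r v∈ n) ,
      (λ k → ≃-pointwise (const (u k) * (1ℝ + const (s k))) (const (s k)) (λ _ → proj₁ (proj₂ (ratio (s k) (0≤s k))))) ,
      (λ k → ≃-pointwise (const u′ * (1ℝ + const s′)) (const s′) (λ _ → proj₁ (proj₂ (ratio s′ 0≤s′)))) ,
      series-sum w 0≤w w≤2 (λ k → const (2⁻ k) * (const (u k) + const u′)) (λ _ _ → refl)) ,
    partial-≤-scale η w weight w≤weight ,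
    λ M t → ℚₚ.≤-trans (partial-≤ w 0≤w w≤2 M t) (ℚₚ.+-monoˡ-≤ (4ℚ *′ 2⁻ M) (partial-≤-scale η w weight w≤weight M))
    where
    η = ε -′ ε₀
    0≤η : 0ℚ ≤′ η
    0≤η = slack ε₀≤ε
    0≤radius : ∀ k → 0ℚ ≤′ radius k
    0≤radius k = ℚₚ.<⇒≤ (0<radius k)
    s : ℕ → ℚ
    s k = gain η (centre k) (radius k)
    0≤s : ∀ k → 0ℚ ≤′ s k
    0≤s k = 0≤η ⊗′ (0≤∣∣ (centre k) ⊕ 0≤radius k)
    s′ : ℚ
    s′ = gain η 0ℚ 1ℚ
    0≤s′ : 0ℚ ≤′ s′
    0≤s′ = 0≤η ⊗′ (0≤∣∣ 0ℚ ⊕ 0≤1)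
    u : ℕ → ℚ
    u k = proj₁ (ratio (s k) (0≤s k))
    u′ : ℚ
    u′ = proj₁ (ratio s′ 0≤s′)
    w : ℕ → ℚ
    w k = 2⁻ k *′ (u k +′ u′)
    0≤w : ∀ k → 0ℚ ≤′ w k
    0≤w k = let (_ , _ , 0≤u , _) = ratio (s k) (0≤s k) ; (_ , _ , 0≤u′ , _) = ratio s′ 0≤s′ in 0≤2⁻ k ⊗′ (0≤u ⊕ 0≤u′)
    w≤2 : ∀ k → w k ≤′ 2⁻ k *′ 2ℚ
    w≤2 k = let (_ , _ , 0≤u , u≤1 , _) = ratio (s k) (0≤s k) ; (_ , _ , 0≤u′ , u′≤1 , _) = ratio s′ 0≤s′ in
      *-mono′ (0≤2⁻ k) ℚₚ.≤-refl (0≤u ⊕ 0≤u′) (ℚₚ.+-mono-≤ u≤1 u′≤1)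
    lemma : ∀ (t η p q : ℚ) → t *′ (η *′ p +′ η *′ q) ≡ η *′ (t *′ (p +′ q))
    lemma = solve-∀ ℚ-ring
    w≤weight : ∀ k → w k ≤′ η *′ weight k
    w≤weight k = let (_ , _ , 0≤u , _ , u≤s) = ratio (s k) (0≤s k) ; (_ , _ , 0≤u′ , _ , u′≤s′) = ratio s′ 0≤s′ in
      subst (w k ≤′_) (lemma (2⁻ k) η (∣ centre k ∣′ +′ radius k) (∣ 0ℚ ∣′ +′ 1ℚ))
        (*-mono′ (0≤2⁻ k) ℚₚ.≤-refl (0≤u ⊕ 0≤u′) (ℚₚ.+-mono-≤ u≤s u′≤s′))
    max-opNorm : ∀ x → OpNorm (λ i j → DF (perturb ε) x i j - DF (perturb ε₀) x i j) (const s′)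
    max-opNorm x = max-norm (λ v → (λ i j → DF (perturb ε) x i j - DF (perturb ε₀) x i j) · v) η 0≤η (DF-difference ε ε₀ x)
      0ⁿ 0ℚ (λ _ → refl) 1ℚ 0≤1
    centre∈ : ∀ k → ι (proj₁ (B k)) ∈ᶜ B k
    centre∈ k = 0≤radius k , ≤-pointwise ∥ a ⊟ a ∥² (const (radius k *′ radius k)) λ t →
      ℚₚ.≤-trans (ℚₚ.≤-reflexive (sum-zero (λ i → (a ⊟ a) i * (a ⊟ a) i) t
        (λ i → cong (λ z → z *′ z) (ℚₚ.+-inverseʳ (seq (a i) t))))) (0≤sq (radius k))
      where a = ι (proj₁ (B k))

-- Integer parts and bounds for powers.

floor : ℕ → ℚ → ℕ
floor zero    q = 0
floor (suc k) q with nat (suc k) ℚₚ.≤? q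
... | yes _ = suc k
... | no  _ = floor k q

floor-≤ : ∀ k q → 0ℚ ≤′ q → nat (floor k q) ≤′ q
floor-≤ zero    q 0≤q = 0≤q
floor-≤ (suc k) q 0≤q with nat (suc k) ℚₚ.≤? q
... | yes p = p
... | no  _ = floor-≤ k q 0≤q

<-floor : ∀ k q → q <′ nat (suc k) → q <′ 1ℚ +′ nat (floor k q)
<-floor zero    q p = p
<-floor (suc k) q p with nat (suc k) ℚₚ.≤? q
... | yes _ = p
... | no ¬p = <-floor k q (ℚₚ.≰⇒> ¬p)

abstract
  -- A downward search from an Archimedean bound; `abstract` keeps it from unfolding inside grid
  -- indices.
  ⌊_⌋ : ℚ → ℕ
  ⌊ q ⌋ = floor (proj₁ (archimedean q)) q

  ⌊⌋-≤ : ∀ q → 0ℚ ≤′ q → nat ⌊ q ⌋ ≤′ q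
  ⌊⌋-≤ q = floor-≤ (proj₁ (archimedean q)) q

  ≤-⌊⌋ : ∀ q → q ≤′ 1ℚ +′ nat ⌊ q ⌋
  ≤-⌊⌋ q = let (k , q≤k) = archimedean q in
    ℚₚ.<⇒≤ (<-floor k q (ℚₚ.≤-<-trans q≤k (<-cert 0<1 (ℚₚ.+-comm 1ℚ (nat k)))))

nat-2^ : ∀ n → nat (2 ℕ.^ n) *′ 2⁻ n ≡ 1ℚ
nat-2^ zero    = refl
nat-2^ (suc n) = trans (cong (_*′ 2⁻ (suc n)) (nat-* 2 (2 ℕ.^ n))) (trans (lemma (nat (2 ℕ.^ n)) (2⁻ n)) (nat-2^ n))
  where
  lemma : ∀ (a b : ℚ) → 2ℚ *′ a *′ (½ *′ b) ≡ a *′ b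
  lemma = solve-∀ ℚ-ring

pow-+ : ∀ x j k → pow x (j ℕ.+ k) ≡ pow x j *′ pow x k
pow-+ x zero    k = sym (ℚₚ.*-identityˡ (pow x k))
pow-+ x (suc j) k = trans (cong (x *′_) (pow-+ x j k)) (sym (ℚₚ.*-assoc x (pow x j) (pow x k)))

1≤pow : ∀ x k → 1ℚ ≤′ x → 1ℚ ≤′ pow x k
1≤pow x zero    1≤x = ℚₚ.≤-refl
1≤pow x (suc k) 1≤x = *-mono′ 0≤1 1≤x 0≤1 (1≤pow x k 1≤x)

pow-mono : ∀ x {j k} → 1ℚ ≤′ x → j ℕ.≤ k → pow x j ≤′ pow x k
pow-mono x {k = k} 1≤x z≤n = 1≤pow x k 1≤x
pow-mono x {suc j} {suc k} 1≤x (s≤s p) = *-mono′ (ℚₚ.≤-trans 0≤1 1≤x) ℚₚ.≤-refl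
  (ℚₚ.≤-trans 0≤1 (1≤pow x j 1≤x)) (pow-mono x 1≤x p)

-- A converse of Bernoulli's inequality. In the inductive step the product term 2 k u · u is at most
-- u, because 2 k u ≤ 1.
pow-small : ∀ u k → 0ℚ ≤′ u → 2ℚ *′ (nat k *′ u) ≤′ 1ℚ → pow (1ℚ +′ u) k ≤′ 1ℚ +′ 2ℚ *′ (nat k *′ u)
pow-small u zero    0≤u p = ℚₚ.≤-reflexive (lemma u)
  where
  lemma : ∀ (u : ℚ) → 1ℚ ≡ 1ℚ +′ 2ℚ *′ (0ℚ *′ u)
  lemma = solve-∀ ℚ-ring
pow-small u (suc k) 0≤u p = ≤-cert
    ((0≤1 ⊕ 0≤u) ⊗′ slack (pow-small u k 0≤u p′) ⊕ 0≤u ⊗′ slack p′)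
    (lemma (nat k) u (pow (1ℚ +′ u) k))
  where
  lemma′ : ∀ (k u : ℚ) → 1ℚ ≡ 2ℚ *′ (k *′ u) +′ ((1ℚ -′ 2ℚ *′ ((1ℚ +′ k) *′ u)) +′ 2ℚ *′ u)
  lemma′ = solve-∀ ℚ-ring
  p′ : 2ℚ *′ (nat k *′ u) ≤′ 1ℚ
  p′ = ≤-cert (slack p ⊕ 0≤2 ⊗′ 0≤u) (lemma′ (nat k) u)
  lemma : ∀ (k u x : ℚ) → 1ℚ +′ 2ℚ *′ ((1ℚ +′ k) *′ u) ≡ (1ℚ +′ u) *′ x +′
    ((1ℚ +′ u) *′ (1ℚ +′ 2ℚ *′ (k *′ u) -′ x) +′ u *′ (1ℚ -′ 2ℚ *′ (k *′ u)))
  lemma = solve-∀ ℚ-ring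

pow-blocks : ∀ x k b → 1ℚ ≤′ x → pow x k ≤′ 2ℚ → pow x (b ℕ.* k) ≤′ pow 2ℚ b
pow-blocks x k zero    1≤x p = ℚₚ.≤-refl
pow-blocks x k (suc b) 1≤x p = subst (_≤′ 2ℚ *′ pow 2ℚ b) (sym (pow-+ x k (b ℕ.* k)))
  (*-mono′ (ℚₚ.≤-trans 0≤1 (1≤pow x k 1≤x)) p (ℚₚ.≤-trans 0≤1 (1≤pow x (b ℕ.* k) 1≤x)) (pow-blocks x k b 1≤x p))

16ℚ 64ℚ 128ℚ 512ℚ : ℚ
16ℚ  = 8ℚ +′ 8ℚ
64ℚ  = 4ℚ *′ 16ℚ
128ℚ = 2ℚ *′ 64ℚ
512ℚ = 4ℚ *′ 128ℚ

0≤4 : 0ℚ ≤′ 4ℚ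
0≤4 = 0≤2 ⊕ 0≤2

0≤16 : 0ℚ ≤′ 16ℚ
0≤16 = from-yes (0ℚ ℚₚ.≤? 16ℚ)

0≤64 : 0ℚ ≤′ 64ℚ
0≤64 = 0≤4 ⊗′ 0≤16

0≤128 : 0ℚ ≤′ 128ℚ
0≤128 = 0≤2 ⊗′ 0≤64

0<512 : 0ℚ <′ 512ℚ
0<512 = from-yes (0ℚ ℚₚ.<? 512ℚ)

-- A rational substitute for exp(16 T), the amplification of errors over time T under the Lipschitz
-- constant 16.
growth : ℕ → ℚ
growth T = pow 2ℚ (T ℕ.* 32)

-- With u = 16 · 2⁻⁽⁵⁺ⁿ⁾, half of 2⁻ⁿ, a block of 2ⁿ factors 1 + u is at most 2 by `pow-small`, and
-- there are at most 32 T blocks.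
growth-bound : ∀ T n j → j ℕ.≤ T ℕ.* 2 ℕ.^ (5 ℕ.+ n) → pow (1ℚ +′ 16ℚ *′ 2⁻ (5 ℕ.+ n)) j ≤′ growth T
growth-bound T n j j≤ = ℚₚ.≤-trans (pow-mono (1ℚ +′ u) 1≤1+u
    (subst (j ℕ.≤_) (trans (cong (T ℕ.*_) (ℕₚ.^-distribˡ-+-* 2 5 n)) (sym (ℕₚ.*-assoc T 32 (2 ℕ.^ n)))) j≤))
  (pow-blocks (1ℚ +′ u) (2 ℕ.^ n) (T ℕ.* 32) 1≤1+u
    (subst (pow (1ℚ +′ u) (2 ℕ.^ n) ≤′_) (cong (1ℚ +′_) exact) (pow-small u (2 ℕ.^ n) 0≤u (ℚₚ.≤-reflexive exact))))
  where
  u = 16ℚ *′ 2⁻ (5 ℕ.+ n)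
  0≤u : 0ℚ ≤′ u
  0≤u = 0≤16 ⊗′ 0≤2⁻ (5 ℕ.+ n)
  1≤1+u : 1ℚ ≤′ 1ℚ +′ u
  1≤1+u = ≤-cert 0≤u refl
  lemma : ∀ (k x : ℚ) → 2ℚ *′ (k *′ (16ℚ *′ (½ *′ (½ *′ (½ *′ (½ *′ (½ *′ x))))))) ≡ k *′ x
  lemma = solve-∀ ℚ-ring
  exact : 2ℚ *′ (nat (2 ℕ.^ n) *′ u) ≡ 1ℚ
  exact = trans (lemma (nat (2 ℕ.^ n)) (2⁻ n)) (nat-2^ n)

-- Euler polygons of the reversed flow on the band [0, 2].

InBand : ℚ → Set
InBand x = 0ℚ ≤′ x × x ≤′ 2ℚ

-- Euler's method for ẋ = - g(x), which follows the flow of g backwards.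
module Euler (e : ℚ) (0≤e : 0ℚ ≤′ e) (e≤1 : e ≤′ 1ℚ) where

  iter : ℚ → ℚ → ℕ → ℚ
  iter h x zero    = x
  iter h x (suc k) = iter h x k -′ h *′ g e (iter h x k)

  iter-+ : ∀ h x k j → iter h x (k ℕ.+ j) ≡ iter h (iter h x j) k
  iter-+ h x zero    j = refl
  iter-+ h x (suc k) j = cong (λ z → z -′ h *′ g e z) (iter-+ h x k j)

  0≤rate : ∀ x → 0ℚ ≤′ (x -′ 1ℚ) *′ (x -′ 1ℚ) +′ e
  0≤rate x = 0≤sq (x -′ 1ℚ) ⊕ 0≤e

  rate≤2 : ∀ {x} → InBand x → (x -′ 1ℚ) *′ (x -′ 1ℚ) +′ e ≤′ 2ℚ
  rate≤2 {x} (0≤x , x≤2) = ≤-cert (0≤x ⊗′ slack x≤2 ⊕ slack e≤1) (lemma x e)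
    where
    lemma : ∀ (x e : ℚ) → 2ℚ ≡ (x -′ 1ℚ) *′ (x -′ 1ℚ) +′ e +′ (x *′ (2ℚ -′ x) +′ (1ℚ -′ e))
    lemma = solve-∀ ℚ-ring

  0≤g : ∀ {x} → InBand x → 0ℚ ≤′ g e x
  0≤g {x} (0≤x , _) = 0≤x ⊗′ 0≤rate x

  g≤4 : ∀ {x} → InBand x → g e x ≤′ 4ℚ
  g≤4 {x} b@(0≤x , x≤2) = ≤-cert (0≤2 ⊗′ slack (rate≤2 b) ⊕ slack x≤2 ⊗′ 0≤rate x) (lemma x ((x -′ 1ℚ) *′ (x -′ 1ℚ) +′ e))
    where
    lemma : ∀ (x q : ℚ) → 4ℚ ≡ x *′ q +′ (2ℚ *′ (2ℚ -′ q) +′ (2ℚ -′ x) *′ q)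
    lemma = solve-∀ ℚ-ring

  -- K is the divided difference of the cubic, and crude estimates on the band keep it between -16
  -- and 16.
  g-lip : ∀ {x y} → InBand x → InBand y → ∣ g e x -′ g e y ∣′ ≤′ 16ℚ *′ ∣ x -′ y ∣′
  g-lip {x} {y} (0≤x , x≤2) (0≤y , y≤2) = subst (λ z → ∣ z ∣′ ≤′ 16ℚ *′ ∣ x -′ y ∣′) (sym (factor x y e))
    (∣∣-mul-mono {K} {16ℚ} {x -′ y}
      (∣∣≤ (≤-cert (slack x≤2 ⊗′ (0≤2 ⊕ 0≤x) ⊕ (0≤2 ⊗′ slack x≤2 ⊕ 0≤x ⊗′ slack y≤2) ⊕ slack y≤2 ⊗′ (0≤2 ⊕ 0≤y)
                     ⊕ 0≤2 ⊗′ (0≤x ⊕ 0≤y) ⊕ slack e≤1 ⊕ 0≤2) (upper x y e))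
           (≤-cert (0≤sq x ⊕ 0≤x ⊗′ 0≤y ⊕ 0≤sq y ⊕ 0≤e ⊕ 0≤2 ⊗′ slack x≤2 ⊕ 0≤2 ⊗′ slack y≤2 ⊕ 0≤9) (lower x y e)))
      ℚₚ.≤-refl)
    where
    K = x *′ x +′ x *′ y +′ y *′ y -′ 2ℚ *′ (x +′ y) +′ 1ℚ +′ e
    0≤9 : 0ℚ ≤′ 8ℚ +′ 1ℚ
    0≤9 = from-yes (0ℚ ℚₚ.≤? 8ℚ +′ 1ℚ)
    factor : ∀ (x y e : ℚ) → x *′ ((x -′ 1ℚ) *′ (x -′ 1ℚ) +′ e) -′ y *′ ((y -′ 1ℚ) *′ (y -′ 1ℚ) +′ e) ≡
      (x *′ x +′ x *′ y +′ y *′ y -′ 2ℚ *′ (x +′ y) +′ 1ℚ +′ e) *′ (x -′ y)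
    factor = solve-∀ ℚ-ring
    upper : ∀ (x y e : ℚ) → 16ℚ ≡ x *′ x +′ x *′ y +′ y *′ y -′ 2ℚ *′ (x +′ y) +′ 1ℚ +′ e +′
      ((2ℚ -′ x) *′ (2ℚ +′ x) +′ (2ℚ *′ (2ℚ -′ x) +′ x *′ (2ℚ -′ y)) +′ (2ℚ -′ y) *′ (2ℚ +′ y)
        +′ 2ℚ *′ (x +′ y) +′ (1ℚ -′ e) +′ 2ℚ)
    upper = solve-∀ ℚ-ring
    lower : ∀ (x y e : ℚ) → 16ℚ ≡ -′ (x *′ x +′ x *′ y +′ y *′ y -′ 2ℚ *′ (x +′ y) +′ 1ℚ +′ e) +′
      (x *′ x +′ x *′ y +′ y *′ y +′ e +′ 2ℚ *′ (2ℚ -′ x) +′ 2ℚ *′ (2ℚ -′ y) +′ (8ℚ +′ 1ℚ))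
    lower = solve-∀ ℚ-ring

  module _ (h : ℚ) (0≤h : 0ℚ ≤′ h) (2h≤1 : 2ℚ *′ h ≤′ 1ℚ) where

    -- A step multiplies z by 1 - h q, where 0 ≤ q ≤ 2 and 2h ≤ 1, hence by a factor in [0, 1].
    iter-band : ∀ {x} k → InBand x → InBand (iter h x k)
    iter-band     zero    b = b
    iter-band {x} (suc k) b = subst (0ℚ ≤′_) (lemma₁ z h q) (0≤z ⊗′ (slack 2h≤1 ⊕ 0≤h ⊗′ slack (rate≤2 zb))) ,
      ≤-cert (slack z≤2 ⊕ 0≤h ⊗′ (0≤z ⊗′ 0≤rate z)) (lemma₂ z h q)
      where
      z = iter h x k
      q = (z -′ 1ℚ) *′ (z -′ 1ℚ) +′ e
      zb = iter-band k b
      0≤z = proj₁ zb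
      z≤2 = proj₂ zb
      lemma₁ : ∀ (z h q : ℚ) → z *′ ((1ℚ -′ 2ℚ *′ h) +′ h *′ (2ℚ -′ q)) ≡ z -′ h *′ (z *′ q)
      lemma₁ = solve-∀ ℚ-ring
      lemma₂ : ∀ (z h q : ℚ) → 2ℚ ≡ z -′ h *′ (z *′ q) +′ ((2ℚ -′ z) +′ h *′ (z *′ q))
      lemma₂ = solve-∀ ℚ-ring

    displacement : ∀ {x} k → InBand x → ∣ iter h x k -′ x ∣′ ≤′ 4ℚ *′ (nat k *′ h)
    displacement {x} zero    b = subst (λ z → ∣ z ∣′ ≤′ 4ℚ *′ (0ℚ *′ h)) (sym (ℚₚ.+-inverseʳ x)) (0≤4 ⊗′ (ℚₚ.≤-refl ⊗′ 0≤h))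
    displacement {x} (suc k) b = ∣∣≤
        (≤-cert (slack (∣∣≤⇒≤ IH) ⊕ 0≤h ⊗′ 0≤g zb ⊕ 0≤4 ⊗′ 0≤h) (lemma₁ x z h (g e z) (nat k)))
        (≤-cert (slack (∣∣≤⇒-≤ IH) ⊕ 0≤h ⊗′ slack (g≤4 zb)) (lemma₂ x z h (g e z) (nat k)))
      where
      z = iter h x k
      zb = iter-band k b
      IH = displacement k b
      lemma₁ : ∀ (x z h q k : ℚ) → 4ℚ *′ ((1ℚ +′ k) *′ h) ≡ z -′ h *′ q -′ x +′ ((4ℚ *′ (k *′ h) -′ (z -′ x)) +′ h *′ q +′ 4ℚ *′ h)
      lemma₁ = solve-∀ ℚ-ring
      lemma₂ : ∀ (x z h q k : ℚ) → 4ℚ *′ ((1ℚ +′ k) *′ h) ≡ -′ (z -′ h *′ q -′ x) +′ ((4ℚ *′ (k *′ h) -′ -′ (z -′ x)) +′ h *′ (4ℚ -′ q))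
      lemma₂ = solve-∀ ℚ-ring

    -- Along the polygon g differs from its initial value by at most 16 · 4 k h, Lipschitz constant
    -- times displacement. Summed over the steps with weight h, this stays below 64 (k h)².
    consistency : ∀ {x} k → InBand x → ∣ iter h x k -′ x +′ nat k *′ h *′ g e x ∣′ ≤′ 64ℚ *′ (nat k *′ h *′ (nat k *′ h))
    consistency {x} zero    b = subst₂ (λ z w → ∣ z ∣′ ≤′ w) (sym (lemma₁ x h (g e x))) (sym (lemma₂ h)) ℚₚ.≤-refl
      where
      lemma₁ : ∀ (x h q : ℚ) → x -′ x +′ 0ℚ *′ h *′ q ≡ 0ℚ
      lemma₁ = solve-∀ ℚ-ring
      lemma₂ : ∀ (h : ℚ) → 64ℚ *′ (0ℚ *′ h *′ (0ℚ *′ h)) ≡ 0ℚ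
      lemma₂ = solve-∀ ℚ-ring
    consistency {x} (suc k) b = ∣∣≤
        (≤-cert (slack (∣∣≤⇒≤ IH) ⊕ 0≤h ⊗′ slack (∣∣≤⇒-≤ lip) ⊕ 0≤rest) (lemma₁ x z h (g e z) (g e x) (nat k)))
        (≤-cert (slack (∣∣≤⇒-≤ IH) ⊕ 0≤h ⊗′ slack (∣∣≤⇒≤ lip) ⊕ 0≤rest) (lemma₂ x z h (g e z) (g e x) (nat k)))
      where
      z = iter h x k
      zb = iter-band k b
      IH = consistency k b
      0≤rest = 0≤64 ⊗′ (0≤h ⊗′ 0≤h ⊗′ (0≤nat k ⊕ 0≤1))
      lip : ∣ g e z -′ g e x ∣′ ≤′ 16ℚ *′ (4ℚ *′ (nat k *′ h))
      lip = ℚₚ.≤-trans (g-lip zb b) (ℚₚ.*-monoˡ-≤-nonNeg 16ℚ (displacement k b))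
      lemma₁ : ∀ (x z h q p k : ℚ) → 64ℚ *′ ((1ℚ +′ k) *′ h *′ ((1ℚ +′ k) *′ h)) ≡ z -′ h *′ q -′ x +′ (1ℚ +′ k) *′ h *′ p +′
        ((64ℚ *′ (k *′ h *′ (k *′ h)) -′ (z -′ x +′ k *′ h *′ p))
          +′ h *′ (16ℚ *′ (4ℚ *′ (k *′ h)) -′ -′ (q -′ p)) +′ 64ℚ *′ (h *′ h *′ (k +′ 1ℚ)))
      lemma₁ = solve-∀ ℚ-ring
      lemma₂ : ∀ (x z h q p k : ℚ) → 64ℚ *′ ((1ℚ +′ k) *′ h *′ ((1ℚ +′ k) *′ h)) ≡ -′ (z -′ h *′ q -′ x +′ (1ℚ +′ k) *′ h *′ p) +′
        ((64ℚ *′ (k *′ h *′ (k *′ h)) -′ -′ (z -′ x +′ k *′ h *′ p))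
          +′ h *′ (16ℚ *′ (4ℚ *′ (k *′ h)) -′ (q -′ p)) +′ 64ℚ *′ (h *′ h *′ (k +′ 1ℚ)))
      lemma₂ = solve-∀ ℚ-ring

    split-≤ : ∀ {x j k} → j ℕ.≤ k → iter h x k ≡ iter h (iter h x j) (k ℕ.∸ j) × nat k ≡ nat (k ℕ.∸ j) +′ nat j
    split-≤ {x} {j} {k} j≤k = trans (cong (iter h x) (sym (ℕₚ.m∸n+n≡m j≤k))) (iter-+ h x (k ℕ.∸ j) j) ,
      trans (cong nat (sym (ℕₚ.m∸n+n≡m j≤k))) (nat-+ (k ℕ.∸ j) j)

    iter-lip-≤ : ∀ {x} j k → InBand x → j ℕ.≤ k → ∣ iter h x k -′ iter h x j ∣′ ≤′ 4ℚ *′ ∣ nat k *′ h -′ nat j *′ h ∣′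
    iter-lip-≤ {x} j k b j≤k =
      let (p , q) = split-≤ {x} j≤k
          elapsed = trans (lemma (nat (k ℕ.∸ j)) (nat j) h) (cong (λ m → m *′ h -′ nat j *′ h) (sym q))
      in subst (λ z → ∣ z -′ iter h x j ∣′ ≤′ 4ℚ *′ ∣ nat k *′ h -′ nat j *′ h ∣′) (sym p)
        (ℚₚ.≤-trans (displacement (k ℕ.∸ j) (iter-band j b)) (ℚₚ.*-monoˡ-≤-nonNeg 4ℚ
          (subst (_≤′ ∣ nat k *′ h -′ nat j *′ h ∣′) (sym elapsed) (a≤∣a∣ (nat k *′ h -′ nat j *′ h)))))
      where
      lemma : ∀ (d j h : ℚ) → d *′ h ≡ (d +′ j) *′ h -′ j *′ h
      lemma = solve-∀ ℚ-ring

    iter-lip : ∀ {x} j k → InBand x → ∣ iter h x k -′ iter h x j ∣′ ≤′ 4ℚ *′ ∣ nat k *′ h -′ nat j *′ h ∣′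
    iter-lip {x} j k b with ℕₚ.≤-total j k
    ... | inj₁ j≤k = iter-lip-≤ j k b j≤k
    ... | inj₂ k≤j = subst₂ (λ a b → a ≤′ 4ℚ *′ b) (∣∣-sub-comm (iter h x j) (iter h x k))
      (∣∣-sub-comm (nat j *′ h) (nat k *′ h)) (iter-lip-≤ k j b k≤j)

    consistency-≤ : ∀ {x} j k → InBand x → j ℕ.≤ k → let D = nat k *′ h -′ nat j *′ h in
      ∣ iter h x k -′ iter h x j +′ D *′ g e (iter h x j) ∣′ ≤′ 64ℚ *′ (D *′ D)
    consistency-≤ {x} j k b j≤k =
      let (p , q) = split-≤ {x} j≤k
          elapsed = trans (lemma (nat (k ℕ.∸ j)) (nat j) h) (cong (λ m → m *′ h -′ nat j *′ h) (sym q))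
      in subst₂ (λ z D → ∣ z -′ iter h x j +′ D *′ g e (iter h x j) ∣′ ≤′ 64ℚ *′ (D *′ D)) (sym p) elapsed
        (consistency (k ℕ.∸ j) (iter-band j b))
      where
      lemma : ∀ (d j h : ℚ) → d *′ h ≡ (d +′ j) *′ h -′ j *′ h
      lemma = solve-∀ ℚ-ring

    -- The derivative has to be taken from both sides. For k < j the one-sided estimate is based at
    -- the wrong endpoint; moving g to the other one costs |D| · 16 · 4 |D| = 64 D², whence 128.
    consistency-± : ∀ {x} j k → InBand x → let D = nat k *′ h -′ nat j *′ h in
      ∣ iter h x k -′ iter h x j +′ D *′ g e (iter h x j) ∣′ ≤′ 128ℚ *′ (D *′ D)
    consistency-± {x} j k b with ℕₚ.≤-total j k
    ... | inj₁ j≤k = ℚₚ.≤-trans (consistency-≤ j k b j≤k) (≤-cert (0≤64 ⊗′ 0≤sq D) (lemma D))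
      where
      D = nat k *′ h -′ nat j *′ h
      lemma : ∀ (D : ℚ) → 128ℚ *′ (D *′ D) ≡ 64ℚ *′ (D *′ D) +′ 64ℚ *′ (D *′ D)
      lemma = solve-∀ ℚ-ring
    ... | inj₂ k≤j = ∣∣≤
        (≤-cert (slack (∣∣≤⇒-≤ E) ⊕ slack (∣∣≤⇒≤ R)) (lemma₁ v w (nat j *′ h) (nat k *′ h) (g e v) (g e w)))
        (≤-cert (slack (∣∣≤⇒≤ E) ⊕ slack (∣∣≤⇒-≤ R)) (lemma₂ v w (nat j *′ h) (nat k *′ h) (g e v) (g e w)))
      where
      v = iter h x j
      w = iter h x k
      D = nat j *′ h -′ nat k *′ h
      E : ∣ v -′ w +′ D *′ g e w ∣′ ≤′ 64ℚ *′ (D *′ D)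
      E = consistency-≤ k j b k≤j
      lemma₀ : ∀ (D : ℚ) → D *′ (16ℚ *′ (4ℚ *′ D)) ≡ 64ℚ *′ (D *′ D)
      lemma₀ = solve-∀ ℚ-ring
      R : ∣ D *′ (g e w -′ g e v) ∣′ ≤′ 64ℚ *′ (D *′ D)
      R = subst₂ _≤′_ (sym (∣∣-mul D (g e w -′ g e v))) (trans (lemma₀ ∣ D ∣′) (cong (64ℚ *′_) (∣∣-sq D)))
        (ℚₚ.*-monoˡ-≤-nonNeg ∣ D ∣′ {{ℚ.nonNegative (0≤∣∣ D)}}
          (ℚₚ.≤-trans (g-lip (iter-band k b) (iter-band j b))
            (ℚₚ.*-monoˡ-≤-nonNeg 16ℚ (subst (λ a → a ≤′ 4ℚ *′ ∣ D ∣′) (∣∣-sub-comm v w) (iter-lip k j b)))))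
      lemma₁ : ∀ (v w j k p q : ℚ) → 128ℚ *′ ((k -′ j) *′ (k -′ j)) ≡ w -′ v +′ (k -′ j) *′ p +′
        ((64ℚ *′ ((j -′ k) *′ (j -′ k)) -′ -′ (v -′ w +′ (j -′ k) *′ q)) +′ (64ℚ *′ ((j -′ k) *′ (j -′ k)) -′ (j -′ k) *′ (q -′ p)))
      lemma₁ = solve-∀ ℚ-ring
      lemma₂ : ∀ (v w j k p q : ℚ) → 128ℚ *′ ((k -′ j) *′ (k -′ j)) ≡ -′ (w -′ v +′ (k -′ j) *′ p) +′
        ((64ℚ *′ ((j -′ k) *′ (j -′ k)) -′ (v -′ w +′ (j -′ k) *′ q)) +′ (64ℚ *′ ((j -′ k) *′ (j -′ k)) -′ -′ ((j -′ k) *′ (q -′ p))))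
      lemma₂ = solve-∀ ℚ-ring

    -- The iterate falls at relative rate at least e, and (1 - h e)(1 + (k + 1) h e) ≤ 1 + k h e.
    -- The bound 2 / (1 + τ e) at time τ is a rational substitute for exponential decay.
    decay : ∀ {x} k → InBand x → iter h x k *′ (1ℚ +′ nat k *′ h *′ e) ≤′ 2ℚ
    decay {x} zero    (_ , x≤2) = subst (_≤′ 2ℚ) (lemma x h e) x≤2
      where
      lemma : ∀ (x h e : ℚ) → x ≡ x *′ (1ℚ +′ 0ℚ *′ h *′ e)
      lemma = solve-∀ ℚ-ring
    decay {x} (suc k) b = ≤-cert
        (slack (decay k b) ⊕ 0≤z ⊗′ (0≤h ⊗′ 0≤e ⊗′ (0≤nat (suc k) ⊗′ 0≤h ⊗′ 0≤e))
          ⊕ 0≤z ⊗′ (0≤h ⊗′ 0≤sq (z -′ 1ℚ) ⊗′ (0≤1 ⊕ 0≤nat (suc k) ⊗′ 0≤h ⊗′ 0≤e)))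
        (lemma z h e (nat k))
      where
      z = iter h x k
      0≤z = proj₁ (iter-band k b)
      lemma : ∀ (z h e k : ℚ) → 2ℚ ≡ (z -′ h *′ (z *′ ((z -′ 1ℚ) *′ (z -′ 1ℚ) +′ e))) *′ (1ℚ +′ (1ℚ +′ k) *′ h *′ e) +′
        ((2ℚ -′ z *′ (1ℚ +′ k *′ h *′ e)) +′ z *′ (h *′ e *′ ((1ℚ +′ k) *′ h *′ e))
          +′ z *′ (h *′ ((z -′ 1ℚ) *′ (z -′ 1ℚ)) *′ (1ℚ +′ (1ℚ +′ k) *′ h *′ e)))
      lemma = solve-∀ ℚ-ring

  -- One coarse step of size k h against k fine steps of size h.
  refine : ∀ h k x j → 0ℚ ≤′ h → 2ℚ *′ h ≤′ 1ℚ → 2ℚ *′ (nat k *′ h) ≤′ 1ℚ → InBand x → let H = nat k *′ h in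
    ∣ iter H x j -′ iter h x (j ℕ.* k) ∣′ ≤′ 4ℚ *′ H *′ (pow (1ℚ +′ 16ℚ *′ H) j -′ 1ℚ)
  refine h k x zero    0≤h 2h≤1 2H≤1 b = subst₂ (λ z w → ∣ z ∣′ ≤′ w) (sym (ℚₚ.+-inverseʳ x)) (lemma (nat k *′ h)) ℚₚ.≤-refl
    where
    lemma : ∀ (H : ℚ) → 0ℚ ≡ 4ℚ *′ H *′ (1ℚ -′ 1ℚ)
    lemma = solve-∀ ℚ-ring
  refine h k x (suc j) 0≤h 2h≤1 2H≤1 b = ∣∣≤
      (≤-cert ((0≤1 ⊕ 0≤16 ⊗′ 0≤H) ⊗′ slack IH ⊕ slack (a≤∣a∣ (X -′ Y)) ⊕ 0≤H ⊗′ slack (∣∣≤⇒-≤ lip) ⊕ slack (∣∣≤⇒-≤ con))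
        (lemma₁ X Y Z H (g e X) (g e Y) ∣ X -′ Y ∣′ P))
      (≤-cert ((0≤1 ⊕ 0≤16 ⊗′ 0≤H) ⊗′ slack IH ⊕ slack (-a≤∣a∣ (X -′ Y)) ⊕ 0≤H ⊗′ slack (∣∣≤⇒≤ lip) ⊕ slack (∣∣≤⇒≤ con))
        (lemma₂ X Y Z H (g e X) (g e Y) ∣ X -′ Y ∣′ P))
    where
    H = nat k *′ h
    0≤H = 0≤nat k ⊗′ 0≤h
    P = pow (1ℚ +′ 16ℚ *′ H) j
    X = iter H x j
    Y = iter h x (j ℕ.* k)
    Z = iter h x (k ℕ.+ j ℕ.* k)
    Yb = iter-band h 0≤h 2h≤1 (j ℕ.* k) b
    IH = refine h k x j 0≤h 2h≤1 2H≤1 b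
    lip = g-lip (iter-band H 0≤H 2H≤1 j b) Yb
    con : ∣ Z -′ Y +′ H *′ g e Y ∣′ ≤′ 64ℚ *′ (H *′ H)
    con = subst (λ z → ∣ z -′ Y +′ H *′ g e Y ∣′ ≤′ 64ℚ *′ (H *′ H)) (sym (iter-+ h x k (j ℕ.* k))) (consistency h 0≤h 2h≤1 k Yb)
    lemma₁ : ∀ (X Y Z H p q a P : ℚ) → 4ℚ *′ H *′ ((1ℚ +′ 16ℚ *′ H) *′ P -′ 1ℚ) ≡ X -′ H *′ p -′ Z +′
      ((1ℚ +′ 16ℚ *′ H) *′ (4ℚ *′ H *′ (P -′ 1ℚ) -′ a) +′ (a -′ (X -′ Y)) +′ H *′ (16ℚ *′ a -′ -′ (p -′ q))
        +′ (64ℚ *′ (H *′ H) -′ -′ (Z -′ Y +′ H *′ q)))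
    lemma₁ = solve-∀ ℚ-ring
    lemma₂ : ∀ (X Y Z H p q a P : ℚ) → 4ℚ *′ H *′ ((1ℚ +′ 16ℚ *′ H) *′ P -′ 1ℚ) ≡ -′ (X -′ H *′ p -′ Z) +′
      ((1ℚ +′ 16ℚ *′ H) *′ (4ℚ *′ H *′ (P -′ 1ℚ) -′ a) +′ (a -′ -′ (X -′ Y)) +′ H *′ (16ℚ *′ a -′ (p -′ q))
        +′ (64ℚ *′ (H *′ H) -′ (Z -′ Y +′ H *′ q)))
    lemma₂ = solve-∀ ℚ-ring

-- The limit trajectory for e > 0.

nat-cancel-≤ : ∀ {j k} → nat j ≤′ nat k → j ℕ.≤ k
nat-cancel-≤ {j} {k} p with j ℕ.≤? k
... | yes q = q
... | no ¬q = ⊥-elim (ℚₚ.<⇒≢ (ℚₚ.<-≤-trans (<-cert 0<1 (ℚₚ.+-comm 1ℚ (nat k))) (ℚₚ.≤-trans (nat-mono (ℕₚ.≰⇒> ¬q)) p)) refl)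

-- Powers of ½ make the grids nested; the shift by 5 makes 16 times the step equal to half of 2⁻ⁿ,
-- as in `growth-bound`.
step : ℕ → ℚ
step n = 2⁻ (5 ℕ.+ n)

0≤step : ∀ n → 0ℚ ≤′ step n
0≤step n = 0≤2⁻ (5 ℕ.+ n)

2step≤1 : ∀ n → 2ℚ *′ step n ≤′ 1ℚ
2step≤1 n = subst (_≤′ 1ℚ) (lemma (2⁻ (4 ℕ.+ n))) (2⁻≤1 (4 ℕ.+ n))
  where
  lemma : ∀ (x : ℚ) → x ≡ 2ℚ *′ (½ *′ x)
  lemma = solve-∀ ℚ-ring

step-antitone : ∀ {m n} → m ℕ.≤ n → step n ≤′ step m
step-antitone m≤n = 2⁻-antitone (ℕₚ.+-monoʳ-≤ 5 m≤n)

step-small : ∀ ε → 0ℚ <′ ε → Eventually (λ n → step n ≤′ ε)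
step-small ε 0<ε = let (k , p) = 2⁻-small ε 0<ε in
  k , λ n k≤n → ℚₚ.≤-trans (2⁻-antitone (ℕₚ.≤-trans k≤n (ℕₚ.m≤n+m n 5))) p

step-refine : ∀ d n → nat (2 ℕ.^ d) *′ step (d ℕ.+ n) ≡ step n
step-refine d n = trans (cong (nat (2 ℕ.^ d) *′_) (trans (cong 2⁻ index) (2⁻-+ d (5 ℕ.+ n))))
  (trans (sym (ℚₚ.*-assoc (nat (2 ℕ.^ d)) (2⁻ d) (step n))) (trans (cong (_*′ step n) (nat-2^ d)) (ℚₚ.*-identityˡ (step n))))
  where
  index : 5 ℕ.+ (d ℕ.+ n) ≡ d ℕ.+ (5 ℕ.+ n)
  index = trans (sym (ℕₚ.+-assoc 5 d n)) (trans (cong (ℕ._+ n) (ℕₚ.+-comm 5 d)) (ℕₚ.+-assoc d 5 n))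

-- The number of steps fitting into the elapsed time. A real t ≤ 0 may have positive entries, so
-- that time is taken to be |τ|, which is Lipschitz for all rational τ.
idx : ℕ → ℚ → ℕ
idx n τ = ⌊ ∣ τ ∣′ *′ nat (2 ℕ.^ (5 ℕ.+ n)) ⌋

time : ℕ → ℚ → ℚ
time n τ = nat (idx n τ) *′ step n

private
  0≤scaled : ∀ n τ → 0ℚ ≤′ ∣ τ ∣′ *′ nat (2 ℕ.^ (5 ℕ.+ n))
  0≤scaled n τ = 0≤∣∣ τ ⊗′ 0≤nat (2 ℕ.^ (5 ℕ.+ n))

  unscale : ∀ n τ → ∣ τ ∣′ *′ nat (2 ℕ.^ (5 ℕ.+ n)) *′ step n ≡ ∣ τ ∣′
  unscale n τ = trans (ℚₚ.*-assoc ∣ τ ∣′ (nat (2 ℕ.^ (5 ℕ.+ n))) (step n))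
    (trans (cong (∣ τ ∣′ *′_) (nat-2^ (5 ℕ.+ n))) (ℚₚ.*-identityʳ ∣ τ ∣′))

time-≤ : ∀ n τ → time n τ ≤′ ∣ τ ∣′
time-≤ n τ = subst (time n τ ≤′_) (unscale n τ)
  (*-mono′ (0≤nat (idx n τ)) (⌊⌋-≤ (∣ τ ∣′ *′ nat (2 ℕ.^ (5 ℕ.+ n))) (0≤scaled n τ)) (0≤step n) ℚₚ.≤-refl)

≤-time : ∀ n τ → ∣ τ ∣′ ≤′ time n τ +′ step n
≤-time n τ = subst₂ _≤′_ (unscale n τ) (lemma (nat (idx n τ)) (step n))
  (*-mono′ (0≤scaled n τ) (≤-⌊⌋ (∣ τ ∣′ *′ nat (2 ℕ.^ (5 ℕ.+ n)))) (0≤step n) ℚₚ.≤-refl)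
  where
  lemma : ∀ (k h : ℚ) → (1ℚ +′ k) *′ h ≡ k *′ h +′ h
  lemma = solve-∀ ℚ-ring

idx-≤ : ∀ n τ T → ∣ τ ∣′ ≤′ nat T → idx n τ ℕ.≤ T ℕ.* 2 ℕ.^ (5 ℕ.+ n)
idx-≤ n τ T p = nat-cancel-≤ (ℚₚ.≤-trans (⌊⌋-≤ (∣ τ ∣′ *′ nat (2 ℕ.^ (5 ℕ.+ n))) (0≤scaled n τ))
  (subst (∣ τ ∣′ *′ nat (2 ℕ.^ (5 ℕ.+ n)) ≤′_) (sym (nat-* T (2 ℕ.^ (5 ℕ.+ n))))
    (*-mono′ (0≤∣∣ τ) p (0≤nat (2 ℕ.^ (5 ℕ.+ n))) ℚₚ.≤-refl)))

time-lip : ∀ m n σ τ → ∣ time m σ -′ time n τ ∣′ ≤′ ∣ σ -′ τ ∣′ +′ (step m +′ step n)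
time-lip m n σ τ = ∣∣≤
    (≤-cert (slack (∣∣≤⇒≤ (∣∣-lip σ τ)) ⊕ slack (time-≤ m σ) ⊕ slack (≤-time n τ) ⊕ 0≤step m)
      (lemma₁ (time m σ) (time n τ) ∣ σ ∣′ ∣ τ ∣′ ∣ σ -′ τ ∣′ (step m) (step n)))
    (≤-cert (slack (∣∣≤⇒-≤ (∣∣-lip σ τ)) ⊕ slack (time-≤ n τ) ⊕ slack (≤-time m σ) ⊕ 0≤step n)
      (lemma₂ (time m σ) (time n τ) ∣ σ ∣′ ∣ τ ∣′ ∣ σ -′ τ ∣′ (step m) (step n)))
  where
  lemma₁ : ∀ (a b s t d h k : ℚ) → d +′ (h +′ k) ≡ a -′ b +′ ((d -′ (s -′ t)) +′ (s -′ a) +′ (b +′ k -′ t) +′ h)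
  lemma₁ = solve-∀ ℚ-ring
  lemma₂ : ∀ (a b s t d h k : ℚ) → d +′ (h +′ k) ≡ -′ (a -′ b) +′ ((d -′ -′ (s -′ t)) +′ (t -′ b) +′ (a +′ h -′ s) +′ k)
  lemma₂ = solve-∀ ℚ-ring

2∈band : InBand 2ℚ
2∈band = 0≤2 , ℚₚ.≤-refl

module Trajectory (e : ℚ) (0<e : 0ℚ <′ e) (e≤1 : e ≤′ 1ℚ) where

  open Euler e (ℚₚ.<⇒≤ 0<e) e≤1

  Y : ℕ → ℚ → ℚ
  Y n τ = iter (step n) 2ℚ (idx n τ)

  Y-band : ∀ n τ → InBand (Y n τ)
  Y-band n τ = iter-band (step n) (0≤step n) (2step≤1 n) (idx n τ) 2∈band

  Y-lip : ∀ n σ τ → ∣ Y n σ -′ Y n τ ∣′ ≤′ 4ℚ *′ (∣ σ -′ τ ∣′ +′ (step n +′ step n))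
  Y-lip n σ τ = ℚₚ.≤-trans (iter-lip (step n) (0≤step n) (2step≤1 n) (idx n τ) (idx n σ) 2∈band)
    (ℚₚ.*-monoˡ-≤-nonNeg 4ℚ (time-lip n n σ τ))

  -- The coarse polygon is compared with the fine one at the same grid time by `refine`. The other
  -- term is a move along the fine polygon, at speed at most 4, from the grid time of σ to that of
  -- τ.
  Y-refine : ∀ n d σ τ T → ∣ σ ∣′ ≤′ nat T →
    ∣ Y n σ -′ Y (d ℕ.+ n) τ ∣′ ≤′ 4ℚ *′ step n *′ growth T +′ 4ℚ *′ (∣ σ -′ τ ∣′ +′ (step n +′ step (d ℕ.+ n)))
  Y-refine n d σ τ T σ≤T = ℚₚ.≤-trans (∣∣-tri (Y n σ) (iter h 2ℚ (j ℕ.* 2 ℕ.^ d)) (Y (d ℕ.+ n) τ)) (ℚₚ.+-mono-≤ coarse fine)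
    where
    h = step (d ℕ.+ n)
    j = idx n σ
    P = pow (1ℚ +′ 16ℚ *′ step n) j
    lemma : ∀ (s p G : ℚ) → 4ℚ *′ s *′ G ≡ 4ℚ *′ s *′ (p -′ 1ℚ) +′ 4ℚ *′ s *′ ((G -′ p) +′ 1ℚ)
    lemma = solve-∀ ℚ-ring
    coarse : ∣ Y n σ -′ iter h 2ℚ (j ℕ.* 2 ℕ.^ d) ∣′ ≤′ 4ℚ *′ step n *′ growth T
    coarse = ℚₚ.≤-trans
      (subst (λ H → ∣ iter H 2ℚ j -′ iter h 2ℚ (j ℕ.* 2 ℕ.^ d) ∣′ ≤′ 4ℚ *′ H *′ (pow (1ℚ +′ 16ℚ *′ H) j -′ 1ℚ)) (step-refine d n)
        (refine h (2 ℕ.^ d) 2ℚ j (0≤step (d ℕ.+ n)) (2step≤1 (d ℕ.+ n))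
          (subst (λ H → 2ℚ *′ H ≤′ 1ℚ) (sym (step-refine d n)) (2step≤1 n)) 2∈band))
      (≤-cert (0≤4 ⊗′ 0≤step n ⊗′ (slack (growth-bound T n j (idx-≤ n σ T σ≤T)) ⊕ 0≤1)) (lemma (step n) P (growth T)))
    same-time : nat (j ℕ.* 2 ℕ.^ d) *′ h ≡ time n σ
    same-time = trans (cong (_*′ h) (nat-* j (2 ℕ.^ d)))
      (trans (ℚₚ.*-assoc (nat j) (nat (2 ℕ.^ d)) h) (cong (nat j *′_) (step-refine d n)))
    fine : ∣ iter h 2ℚ (j ℕ.* 2 ℕ.^ d) -′ Y (d ℕ.+ n) τ ∣′ ≤′ 4ℚ *′ (∣ σ -′ τ ∣′ +′ (step n +′ step (d ℕ.+ n)))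
    fine = ℚₚ.≤-trans (iter-lip h (0≤step (d ℕ.+ n)) (2step≤1 (d ℕ.+ n)) (idx (d ℕ.+ n) τ) (j ℕ.* 2 ℕ.^ d) 2∈band)
      (ℚₚ.*-monoˡ-≤-nonNeg 4ℚ (subst (λ t → ∣ t -′ time (d ℕ.+ n) τ ∣′ ≤′ ∣ σ -′ τ ∣′ +′ (step n +′ step (d ℕ.+ n)))
        (sym same-time) (time-lip n (d ℕ.+ n) σ τ)))

  abstract
    -- Entry n refines the step and the approximation of t at once. A bound T on |t| is fixed first,
    -- since refinement costs the step times `growth T`; this is why δ′ is δ / (1 + `growth T`). The
    -- constant 512 is merely ample.
    Y-cauchy : ∀ t → IsCauchy (λ n → Y n (seq t n))
    Y-cauchy t ε 0<ε =
      let (b , _ , M , B) = bounded t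
          (T , b≤T) = archimedean b
          (δ , 0<δ , eδ) = quotient 0<512 0<ε
          (δ′ , 0<δ′ , eδ′) = quotient (0<1 ⊕< 0≤growth T) 0<δ
          (N , C) = cauchy t δ 0<δ
          (K , S) = step-small (δ′ ℚ.⊓ δ) (⊓-pos 0<δ′ 0<δ)
          N₀ = M ℕ.⊔ (N ℕ.⊔ K)
          ordered : ∀ m n → N₀ ℕ.≤ m → m ℕ.≤ n → ∣ Y m (seq t m) -′ Y n (seq t n) ∣′ ≤′ ε
          ordered m n N₀≤m m≤n =
            let M≤m = ℕₚ.m⊔n≤o⇒m≤o M (N ℕ.⊔ K) N₀≤m
                NK≤m = ℕₚ.m⊔n≤o⇒n≤o M (N ℕ.⊔ K) N₀≤m
                N≤m = ℕₚ.m⊔n≤o⇒m≤o N K NK≤m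
                S≤ = S m (ℕₚ.m⊔n≤o⇒n≤o N K NK≤m)
            in ℚₚ.≤-trans
              (subst (λ k → ∣ Y m (seq t m) -′ Y k (seq t n) ∣′ 
                         ≤′ 4ℚ *′ step m *′ growth T +′ 4ℚ *′ (∣ seq t m -′ seq t n ∣′ +′ (step m +′ step k)))
                (ℕₚ.m∸n+n≡m m≤n)
                (Y-refine m (n ℕ.∸ m) (seq t m) (seq t n) T (ℚₚ.≤-trans (B m M≤m) b≤T)))
              (estimate (step m) (step n) (growth T) ∣ seq t m -′ seq t n ∣′ δ δ′ (0≤step m) (0≤growth T) (ℚₚ.<⇒≤ 0<δ)
                (ℚₚ.≤-trans S≤ (ℚₚ.p⊓q≤q δ′ δ)) (ℚₚ.≤-trans S≤ (ℚₚ.p⊓q≤p δ′ δ)) (step-antitone m≤n)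
                (C m n N≤m (ℕₚ.≤-trans N≤m m≤n)) eδ′ eδ)
      in N₀ , λ m n p q → Sum.[ ordered m n p ,
           (λ n≤m → subst (_≤′ ε) (∣∣-sub-comm (Y n (seq t n)) (Y m (seq t m))) (ordered n m q n≤m)) ]′ (ℕₚ.≤-total m n)
      where
      0≤growth : ∀ T → 0ℚ ≤′ growth T
      0≤growth T = ℚₚ.≤-trans 0≤1 (1≤pow 2ℚ (T ℕ.* 32) (from-yes (1ℚ ℚₚ.≤? 2ℚ)))
      lemma : ∀ (h k G d δ′ : ℚ) → 512ℚ *′ ((1ℚ +′ G) *′ δ′) ≡ 4ℚ *′ h *′ G +′ 4ℚ *′ (d +′ (h +′ k)) +′
        (4ℚ *′ ((δ′ -′ h) *′ G) +′ 4ℚ *′ (((1ℚ +′ G) *′ δ′ -′ d) +′ 2ℚ *′ ((1ℚ +′ G) *′ δ′ -′ h) +′ (h -′ k))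
          +′ (4ℚ *′ δ′ +′ (512ℚ -′ 16ℚ) *′ ((1ℚ +′ G) *′ δ′)))
      lemma = solve-∀ ℚ-ring
      estimate : ∀ (h k G d δ δ′ : ℚ) → 0ℚ ≤′ h → 0ℚ ≤′ G → 0ℚ ≤′ δ → h ≤′ δ → h ≤′ δ′ → k ≤′ h → d ≤′ δ →
        (1ℚ +′ G) *′ δ′ ≡ δ → 512ℚ *′ δ ≡ ε → 4ℚ *′ h *′ G +′ 4ℚ *′ (d +′ (h +′ k)) ≤′ ε
      estimate h k G d _ δ′ 0≤h 0≤G 0≤δ h≤δ h≤δ′ k≤h d≤δ refl refl = ≤-cert
        (0≤4 ⊗′ (slack h≤δ′ ⊗′ 0≤G) ⊕ 0≤4 ⊗′ (slack d≤δ ⊕ 0≤2 ⊗′ slack h≤δ ⊕ slack k≤h)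
          ⊕ (0≤4 ⊗′ ℚₚ.≤-trans 0≤h h≤δ′ ⊕ from-yes (0ℚ ℚₚ.≤? 512ℚ -′ 16ℚ) ⊗′ 0≤δ))
        (lemma h k G d δ′)

  y : ℝ → ℝ
  y t = mkℝ (λ n → Y n (seq t n)) (Y-cauchy t)

  y-cong : ∀ s t → s ≃ t → y s ≃ y t
  y-cong s t s≃t ε 0<ε =
    let (δ , 0<δ , eδ) = quotient (0<512) 0<ε
    in ev-map₂ (λ n p q → ℚₚ.≤-trans (Y-lip n (seq s n) (seq t n))
        (estimate (step n) ∣ seq s n -′ seq t n ∣′ δ (ℚₚ.<⇒≤ 0<δ) eδ p q)) (s≃t δ 0<δ) (step-small δ 0<δ)
    where
    lemma : ∀ (h d δ : ℚ) → 512ℚ *′ δ ≡ 4ℚ *′ (d +′ (h +′ h)) +′ (4ℚ *′ ((δ -′ d) +′ 2ℚ *′ (δ -′ h)) +′ (512ℚ -′ 4ℚ *′ 3ℚ) *′ δ)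
    lemma = solve-∀ ℚ-ring
    estimate : ∀ (h d δ : ℚ) → 0ℚ ≤′ δ → 512ℚ *′ δ ≡ ε → d ≤′ δ → h ≤′ δ → 4ℚ *′ (d +′ (h +′ h)) ≤′ ε
    estimate h d δ 0≤δ refl d≤δ h≤δ = ≤-cert
      (0≤4 ⊗′ (slack d≤δ ⊕ 0≤2 ⊗′ slack h≤δ) ⊕ from-yes (0ℚ ℚₚ.≤? 512ℚ -′ 4ℚ *′ 3ℚ) ⊗′ 0≤δ) (lemma h d δ)

  y-initial : y 0ℝ ≃ const 2ℚ
  y-initial ε 0<ε = always λ n → ℚₚ.≤-trans
      (iter-lip (step n) (0≤step n) (2step≤1 n) 0 (idx n 0ℚ) 2∈band)
      (≤-cert (0≤4 ⊗′ slack (elapsed n) ⊕ ℚₚ.<⇒≤ 0<ε) (lemma₃ ∣ time n 0ℚ -′ 0ℚ *′ step n ∣′ ε))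
    where
    lemma₁ : ∀ (a h : ℚ) → a ≡ a -′ 0ℚ *′ h
    lemma₁ = solve-∀ ℚ-ring
    lemma₂ : ∀ (a h : ℚ) → 0ℚ ≡ -′ (a -′ 0ℚ *′ h) +′ a
    lemma₂ = solve-∀ ℚ-ring
    elapsed : ∀ n → ∣ time n 0ℚ -′ 0ℚ *′ step n ∣′ ≤′ 0ℚ
    elapsed n = ∣∣≤ {time n 0ℚ -′ 0ℚ *′ step n} {0ℚ}
      (subst (_≤′ 0ℚ) (lemma₁ (time n 0ℚ) (step n)) (time-≤ n 0ℚ))
      (≤-cert (0≤nat (idx n 0ℚ) ⊗′ 0≤step n) (lemma₂ (time n 0ℚ) (step n)))
    lemma₃ : ∀ (a e : ℚ) → e ≡ 4ℚ *′ a +′ (4ℚ *′ (0ℚ -′ a) +′ e)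
    lemma₃ = solve-∀ ℚ-ring

  -- With q = 2 / (ε e), the bound of `decay` at time q is below ε. The extra `step n` covers the
  -- rounding of |τ| down to the grid.
  Y-decay : ∀ ε q n τ → 0ℚ <′ ε → 0ℚ <′ q → ε *′ e *′ q ≡ 2ℚ → q +′ step n ≤′ ∣ τ ∣′ → Y n τ ≤′ ε
  Y-decay ε q n τ 0<ε 0<q eq late = ℚₚ.*-cancelʳ-≤-pos (e *′ q) {{ℚ.positive (0<e ⊗< 0<q)}}
    (subst (Y n τ *′ (e *′ q) ≤′_) (trans (sym eq) (ℚₚ.*-assoc ε e q))
      (≤-cert (slack (decay (step n) (0≤step n) (2step≤1 n) (idx n τ) 2∈band) ⊕ 0≤Y
               ⊕ 0≤Y ⊗′ ((slack late ⊕ slack (≤-time n τ)) ⊗′ ℚₚ.<⇒≤ 0<e))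
        (lemma (Y n τ) e q (time n τ) (step n) ∣ τ ∣′)))
    where
    0≤Y = proj₁ (Y-band n τ)
    lemma : ∀ (Y e q t h s : ℚ) → 2ℚ ≡ Y *′ (e *′ q) +′ ((2ℚ -′ Y *′ (1ℚ +′ t *′ e)) +′ Y +′ Y *′ (((s -′ (q +′ h)) +′ (t +′ h -′ s)) *′ e))
    lemma = solve-∀ ℚ-ring

int : ℕ → ℚ
int k = ℤ.+ k ℚ./ 1

0≤int : ∀ k → 0ℚ ≤′ int k
0≤int k = ℚₚ.nonNegative⁻¹ (int k) {{ℚₚ.normalize-nonNeg k 1}}

module _ (e : ℚ) (0<e : 0ℚ <′ e) (e≤1 : e ≤′ 1ℚ) where

  open Trajectory e 0<e e≤1
  open Euler e (ℚₚ.<⇒≤ 0<e) e≤1 using (consistency-±; g≤4; 0≤g)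

  ∣g∣≤4 : ∀ {x} → InBand x → ∣ g e x ∣′ ≤′ 4ℚ
  ∣g∣≤4 {x} b = ∣∣≤ (g≤4 b) (≤-cert (0≤g b ⊕ 0≤4) (lemma (g e x)))
    where
    lemma : ∀ (q : ℚ) → 4ℚ ≡ -′ q +′ (q +′ 4ℚ)
    lemma = solve-∀ ℚ-ring

  -- Since |s| = -s up to 2ν, the grid times of s and t differ by t - s up to μ = 6ν.
  Y-increment : ∀ n s t ν → step n ≤′ ν → s ≤′ ν → t ≤′ ν → let u = ∣ s -′ t ∣′ ; μ = int 6 *′ ν in
    ∣ Y n s -′ Y n t -′ (s -′ t) *′ g e (Y n t) ∣′ ≤′ 128ℚ *′ ((u +′ μ) *′ (u +′ μ)) +′ 4ℚ *′ μ
  Y-increment n s t ν h≤ν s≤ν t≤ν = subst (λ z → ∣ z ∣′ ≤′ 128ℚ *′ ((u +′ μ) *′ (u +′ μ)) +′ 4ℚ *′ μ)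
      (lemma₁ (Y n s) (Y n t) (g e (Y n t)) D (s -′ t))
      (ℚₚ.≤-trans (ℚₚ.∣p+q∣≤∣p∣+∣q∣ (Y n s -′ Y n t +′ D *′ g e (Y n t)) (-′ ((D +′ (s -′ t)) *′ g e (Y n t))))
        (ℚₚ.+-mono-≤
          (ℚₚ.≤-trans (consistency-± (step n) (0≤step n) (2step≤1 n) (idx n t) (idx n s) 2∈band)
            (ℚₚ.*-monoˡ-≤-nonNeg 128ℚ (sq-mono {D} ∣D∣≤)))
          (subst₂ _≤′_ (sym (ℚₚ.∣-p∣≡∣p∣ ((D +′ (s -′ t)) *′ g e (Y n t)))) (ℚₚ.*-comm μ 4ℚ)
            (∣∣-mul-mono {D +′ (s -′ t)} {μ} {g e (Y n t)} {4ℚ} drift (∣g∣≤4 (Y-band n t))))))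
    where
    u = ∣ s -′ t ∣′
    μ = int 6 *′ ν
    D = time n s -′ time n t
    lemma₁ : ∀ (a b q D r : ℚ) → a -′ b +′ D *′ q +′ -′ ((D +′ r) *′ q) ≡ a -′ b -′ r *′ q
    lemma₁ = solve-∀ ℚ-ring
    reflect : ∀ r → r ≤′ ν → ∣ r ∣′ +′ r ≤′ 2ℚ *′ ν
    reflect r r≤ν with ∣∣-cases r
    ... | inj₁ eq rewrite eq = ≤-cert (0≤2 ⊗′ slack r≤ν) (lemma r ν)
      where
      lemma : ∀ (r ν : ℚ) → 2ℚ *′ ν ≡ r +′ r +′ 2ℚ *′ (ν -′ r)
      lemma = solve-∀ ℚ-ring
    ... | inj₂ eq rewrite eq = ≤-cert (0≤2 ⊗′ ℚₚ.≤-trans (0≤step n) h≤ν) (lemma r ν)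
      where
      lemma : ∀ (r ν : ℚ) → 2ℚ *′ ν ≡ -′ r +′ r +′ 2ℚ *′ ν
      lemma = solve-∀ ℚ-ring
    drift : ∣ D +′ (s -′ t) ∣′ ≤′ μ
    drift = ∣∣≤
      (≤-cert (slack (time-≤ n s) ⊕ slack (reflect s s≤ν) ⊕ slack (≤-time n t) ⊕ slack (-a≤∣a∣ t) ⊕ (slack h≤ν ⊕ (0≤1 ⊕ 0≤2) ⊗′ 0≤ν))
        (lemma₃ (time n s) (time n t) ∣ s ∣′ ∣ t ∣′ s t (step n) ν))
      (≤-cert (slack (time-≤ n t) ⊕ slack (reflect t t≤ν) ⊕ slack (≤-time n s) ⊕ slack (-a≤∣a∣ s) ⊕ (slack h≤ν ⊕ (0≤1 ⊕ 0≤2) ⊗′ 0≤ν))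
        (lemma₄ (time n s) (time n t) ∣ s ∣′ ∣ t ∣′ s t (step n) ν))
      where
      0≤ν = ℚₚ.≤-trans (0≤step n) h≤ν
      lemma₃ : ∀ (a b p q s t h ν : ℚ) → int 6 *′ ν ≡ a -′ b +′ (s -′ t) +′
        ((p -′ a) +′ (2ℚ *′ ν -′ (p +′ s)) +′ (b +′ h -′ q) +′ (q -′ -′ t) +′ ((ν -′ h) +′ 3ℚ *′ ν))
      lemma₃ = solve-∀ ℚ-ring
      lemma₄ : ∀ (a b p q s t h ν : ℚ) → int 6 *′ ν ≡ -′ (a -′ b +′ (s -′ t)) +′
        ((q -′ b) +′ (2ℚ *′ ν -′ (q +′ t)) +′ (a +′ h -′ p) +′ (p -′ -′ s) +′ ((ν -′ h) +′ 3ℚ *′ ν))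
      lemma₄ = solve-∀ ℚ-ring
    ∣D∣≤ : ∣ D ∣′ ≤′ u +′ μ
    ∣D∣≤ = ∣∣≤
      (≤-cert (slack (∣∣≤⇒≤ drift) ⊕ slack (-a≤∣a∣ (s -′ t))) (lemma₅ D (s -′ t) u μ))
      (≤-cert (slack (∣∣≤⇒-≤ drift) ⊕ slack (a≤∣a∣ (s -′ t))) (lemma₆ D (s -′ t) u μ))
      where
      lemma₅ : ∀ (D r u μ : ℚ) → u +′ μ ≡ D +′ ((μ -′ (D +′ r)) +′ (u -′ -′ r))
      lemma₅ = solve-∀ ℚ-ring
      lemma₆ : ∀ (D r u μ : ℚ) → u +′ μ ≡ -′ D +′ ((μ -′ -′ (D +′ r)) +′ (u -′ r))
      lemma₆ = solve-∀ ℚ-ring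

  -- With u = |s - t| ≤ 2δ, the quadratic error 128 u² is at most 256 δ u ≤ ε u. All terms
  -- containing ν go into the allowance κ; ν bounds the step and the accuracy to which the signs of
  -- s and t and the size of u are known.
  y-derivative : ∀ t → t ≤ 0ℝ → ∀ ε → 0ℚ <′ ε → ∃[ δ ] 0ℚ <′ δ × (∀ s → s ≤ 0ℝ → ∣ s - t ∣ ≤ const δ →
    ∣ (y s - y t) - (s - t) * G e (y t) ∣ ≤ ∣ const ε * (s - t) ∣)
  y-derivative t t≤0 ε 0<ε =
    let (δ₀ , 0<δ₀ , eδ) = quotient 0<512 0<ε
        δ = δ₀ ℚ.⊓ ½
        0<δ = ⊓-pos 0<δ₀ 0<½
    in δ , 0<δ , λ s s≤0 s~t κ 0<κ →
      let (ν₀ , 0<ν₀ , eν) = quotient (0<512 ⊗< 0<512) 0<κ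
          ν = (ν₀ ℚ.⊓ δ) ℚ.⊓ (½ *′ ½ *′ ½)
          0<ν = ⊓-pos (⊓-pos 0<ν₀ 0<δ) (½-pos 0<½ ⊗< 0<½)
          ν≤ = ℚₚ.p⊓q≤p (ν₀ ℚ.⊓ δ) (½ *′ ½ *′ ½)
      in ev-map₂ (λ n h≤ν (s≤ν , t≤ν , near) →
           subst (λ b → ∣ Y n (seq s n) -′ Y n (seq t n) -′ (seq s n -′ seq t n) *′ g e (Y n (seq t n)) ∣′ ≤′ b +′ κ)
             (sym (trans (∣∣-mul ε (seq s n -′ seq t n))
               (cong (_*′ ∣ seq s n -′ seq t n ∣′) (ℚₚ.0≤p⇒∣p∣≡p (ℚₚ.<⇒≤ 0<ε)))))
             (ℚₚ.≤-trans (Y-increment n (seq s n) (seq t n) ν h≤ν (drop₀ s≤ν) (drop₀ t≤ν))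
               (estimate ∣ seq s n -′ seq t n ∣′ δ δ₀ ν ν₀ κ (0≤∣∣ (seq s n -′ seq t n)) (ℚₚ.<⇒≤ 0<ν) near
                 (ℚₚ.p⊓q≤p δ₀ ½) (ℚₚ.p⊓q≤q δ₀ ½)
                 (ℚₚ.≤-trans ν≤ (ℚₚ.p⊓q≤p ν₀ δ)) (ℚₚ.≤-trans ν≤ (ℚₚ.p⊓q≤q ν₀ δ)) (ℚₚ.p⊓q≤q (ν₀ ℚ.⊓ δ) (½ *′ ½ *′ ½)) eδ eν)))
         (step-small ν 0<ν) (ev-× (s≤0 ν 0<ν) (ev-× (t≤0 ν 0<ν) (s~t ν 0<ν)))
    where
    drop₀ : ∀ {a b} → a ≤′ 0ℚ +′ b → a ≤′ b
    drop₀ {a} {b} = subst (a ≤′_) (ℚₚ.+-identityˡ b)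
    lemma : ∀ (u δ δ₀ ν ν₀ : ℚ) → 512ℚ *′ δ₀ *′ u +′ 512ℚ *′ 512ℚ *′ ν₀ ≡
      128ℚ *′ ((u +′ int 6 *′ ν) *′ (u +′ int 6 *′ ν)) +′ 4ℚ *′ (int 6 *′ ν) +′
      (128ℚ *′ ((2ℚ *′ δ -′ u) *′ u) +′ int 256 *′ ((δ₀ -′ δ) *′ u) +′ int 256 *′ (δ₀ *′ u)
        +′ (int 1536 *′ (ν *′ (2ℚ *′ δ -′ u)) +′ int 3072 *′ (ν *′ (½ -′ δ)) +′ int 4608 *′ (ν *′ (½ *′ ½ *′ ½ -′ ν)))
        +′ 512ℚ *′ 512ℚ *′ (ν₀ -′ ν) +′ (512ℚ *′ 512ℚ -′ int 2136) *′ ν)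
    lemma = solve-∀ ℚ-ring
    estimate : ∀ (u δ δ₀ ν ν₀ κ : ℚ) → 0ℚ ≤′ u → 0ℚ ≤′ ν → u ≤′ δ +′ ν → δ ≤′ δ₀ → δ ≤′ ½ → ν ≤′ ν₀ → ν ≤′ δ → ν ≤′ ½ *′ ½ *′ ½ →
      512ℚ *′ δ₀ ≡ ε → 512ℚ *′ 512ℚ *′ ν₀ ≡ κ →
      128ℚ *′ ((u +′ int 6 *′ ν) *′ (u +′ int 6 *′ ν)) +′ 4ℚ *′ (int 6 *′ ν) ≤′ ε *′ u +′ κ
    estimate u δ δ₀ ν ν₀ _ 0≤u 0≤ν u≤ δ≤δ₀ δ≤½ ν≤ν₀ ν≤δ ν≤⅛ refl refl = ≤-cert
      (0≤128 ⊗′ (slack u≤2δ ⊗′ 0≤u) ⊕ 0≤int 256 ⊗′ (slack δ≤δ₀ ⊗′ 0≤u)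
        ⊕ 0≤int 256 ⊗′ (ℚₚ.≤-trans 0≤ν (ℚₚ.≤-trans ν≤δ δ≤δ₀) ⊗′ 0≤u)
        ⊕ (0≤int 1536 ⊗′ (0≤ν ⊗′ slack u≤2δ) ⊕ 0≤int 3072 ⊗′ (0≤ν ⊗′ slack δ≤½) ⊕ 0≤int 4608 ⊗′ (0≤ν ⊗′ slack ν≤⅛))
        ⊕ ℚₚ.<⇒≤ (0<512 ⊗< 0<512) ⊗′ slack ν≤ν₀ ⊕ from-yes (0ℚ ℚₚ.≤? 512ℚ *′ 512ℚ -′ int 2136) ⊗′ 0≤ν)
      (lemma u δ δ₀ ν ν₀)
      where
      lemma′ : ∀ (u δ ν : ℚ) → 2ℚ *′ δ ≡ u +′ ((δ +′ ν -′ u) +′ (δ -′ ν))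
      lemma′ = solve-∀ ℚ-ring
      u≤2δ : u ≤′ 2ℚ *′ δ
      u≤2δ = ≤-cert (slack u≤ ⊕ slack ν≤δ) (lemma′ u δ ν)

-- For e > 0 the point (2,0,...,0) lies in the closure.

onAxis : ∀ {m} → ℝ → Point (suc m)
onAxis x zero    = x
onAxis x (suc _) = 0ℝ

F-onAxis : ∀ {m} e x t (j : Fin m) → seq (F (perturb e) (onAxis x) (suc j)) t ≡ 0ℚ
F-onAxis e x t j = trans (seq-F (perturb e) (onAxis x) (suc j) t) (lemma 0ℚ)
  where
  lemma : ∀ (e : ℚ) → 0ℚ *′ ((0ℚ -′ 1ℚ) *′ (0ℚ -′ 1ℚ) +′ e) ≡ 0ℚ
  lemma = solve-∀ ℚ-ring

Closure-⊇ : ∀ {n} (W : Point n → Set) x → W x → Closure W x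
Closure-⊇ W x x∈W ε 0<ε = x , x∈W , 0<ε , ε *′ ε , 0<ε ⊗< 0<ε , always λ t → ℚₚ.≤-reflexive
  (trans (cong (_+′ ε *′ ε) (sum-zero (λ i → (x ⊟ x) i * (x ⊟ x) i) t (λ i → cong (λ z → z *′ z) (ℚₚ.+-inverseʳ (seq (x i) t)))))
    (ℚₚ.+-identityˡ (ε *′ ε)))

module _ (e : ℚ) (0<e : 0ℚ <′ e) (e≤1 : e ≤′ 1ℚ) where

  open Trajectory e 0<e e≤1

  -- The first axis is invariant: the other components of the field vanish on it, and the system
  -- reduces to the scalar equation solved by `y`.
  backward-solution : ∀ {m} → BackwardSolution (F (perturb {m} e)) (λ t → onAxis (y t))
  backward-solution {m} = record
    { cong-y     = λ { s t _ _ s≃t zero → y-cong s t s≃t ; s t _ _ s≃t (suc i) → ≃-refl 0ℝ }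
    ; derivative = λ t t≤0 ε 0<ε →
        let (δ , 0<δ , D) = y-derivative e 0<e e≤1 t t≤0 ε 0<ε
        in δ , 0<δ , λ s s≤0 s~t → let v = error s t ; a = (y s - y t) - (s - t) * G e (y t) ; b = const ε * (s - t) in
          ≤-trans ∥ v ∥² (a * a) (const (ε *′ ε) * ((s - t) * (s - t)))
            (≤-pointwise ∥ v ∥² (a * a) (λ k → ℚₚ.≤-reflexive (norm-error s t k)))
            (≤-trans (a * a) (b * b) (const (ε *′ ε) * ((s - t) * (s - t))) (square-≤ a b (D s s≤0 s~t))
              (≤-pointwise (b * b) (const (ε *′ ε) * ((s - t) * (s - t))) (λ k → ℚₚ.≤-reflexive (lemma₁ ε (seq s k -′ seq t k)))))
    }
    where
    error : ℝ → ℝ → Point (suc m)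
    error s t = (onAxis (y s) ⊟ onAxis (y t)) ⊟ (s - t) ⊡ F (perturb e) (onAxis (y t))
    lemma₁ : ∀ (ε r : ℚ) → ε *′ r *′ (ε *′ r) ≡ ε *′ ε *′ (r *′ r)
    lemma₁ = solve-∀ ℚ-ring
    lemma₂ : ∀ (r : ℚ) → 0ℚ -′ 0ℚ -′ r *′ 0ℚ ≡ 0ℚ
    lemma₂ = solve-∀ ℚ-ring
    norm-error : ∀ s t k → let a = (y s - y t) - (s - t) * G e (y t) in seq ∥ error s t ∥² k ≡ seq (a * a) k
    norm-error s t k = trans
      (norm-single (error s t) k λ j → trans
        (cong (λ f → 0ℚ -′ 0ℚ -′ (seq s k -′ seq t k) *′ f) (F-onAxis e (y t) k j)) (lemma₂ (seq s k -′ seq t k)))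
      (cong (λ f → let a = (seq (y s) k -′ seq (y t) k) -′ (seq s k -′ seq t k) *′ f in a *′ a)
        (seq-F (perturb {m} e) (onAxis (y t)) zero k))

  tends-to-0 : ∀ {m} → TendsToAt-∞ {suc m} (λ t → onAxis (y t)) 0ⁿ
  tends-to-0 {m} ε 0<ε =
    let (q , 0<q , eq) = quotient (0<ε ⊗< 0<e) 0<2
    -- Of the extra 2, one unit pays for the allowance in t ≤ T and one for `step n` ≤ 1.
    in -′ (q +′ 2ℚ) , λ t _ t≤T → ℚₚ.<⇒≤ 0<ε , ≤-eventually ∥ onAxis {m} (y t) ⊟ 0ⁿ ∥² (const (ε *′ ε))
         (ev-map₂ (λ n t≤ h≤1 → subst (_≤′ ε *′ ε) (sym (norm-y {m} t n))
             (sq-mono {Y n (seq t n)} (subst (_≤′ ε) (sym (ℚₚ.0≤p⇒∣p∣≡p (proj₁ (Y-band n (seq t n)))))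
               (Y-decay ε q n (seq t n) 0<ε 0<q eq
                 (ℚₚ.≤-trans (≤-cert (slack t≤ ⊕ slack h≤1) (lemma q (step n) (seq t n))) (-a≤∣a∣ (seq t n)))))))
           (t≤T 1ℚ 0<1) (step-small 1ℚ 0<1))
    where
    lemma : ∀ (q h t : ℚ) → -′ t ≡ q +′ h +′ ((-′ (q +′ 2ℚ) +′ 1ℚ -′ t) +′ (1ℚ -′ h))
    lemma = solve-∀ ℚ-ring
    norm-y : ∀ {m} t n → seq ∥ onAxis {m} (y t) ⊟ 0ⁿ ∥² n ≡ Y n (seq t n) *′ Y n (seq t n)
    norm-y {m} t n = trans (norm-single (onAxis {m} (y t) ⊟ 0ⁿ) n (λ _ → refl))
      (cong (λ z → z *′ z) (ℚₚ.+-identityʳ (Y n (seq t n))))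

  target∈ : ∀ {m} → onAxis (const 2ℚ) ∈ closure (UnstableManifold (F (perturb {m} e)) 0ⁿ)
  target∈ {m} = Closure-⊇ (UnstableManifold (F (perturb {m} e)) 0ⁿ) (onAxis (const 2ℚ))
    ((λ t → onAxis (y t)) , backward-solution {m} , (λ { zero → y-initial ; (suc i) → ≃-refl 0ℝ }) , tends-to-0 {m})

-- A constructive mean value inequality.

<-pointwise : ∀ x x′ y y′ → (∀ n → seq x n ≡ seq x′ n) → (∀ n → seq y n ≡ seq y′ n) → x < y → x′ < y′
<-pointwise x x′ y y′ p q (ε , 0<ε , N , h) = ε , 0<ε , N , λ n N≤n → subst₂ (λ a b → a +′ ε ≤′ b) (p n) (q n) (h n N≤n)

-- Comparing a with p is undecidable, but the excess ε of a + b over p + q leaves room: one late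
-- entry of a is tested against p + ε/2, and either answer leaves ε/4 to spare.
<-split : ∀ p q a b → const (p +′ q) < a + b → const p < a ⊎ const q < b
<-split p q a b (ε , 0<ε , N , h) with settle a (½ *′ ½ *′ ε) (½-pos 0<½ ⊗< 0<ε)
... | K , s with p +′ ½ *′ ε ℚₚ.≤? seq a K
... | yes r = inj₁ (½ *′ ½ *′ ε , ½-pos 0<½ ⊗< 0<ε , K , λ n K≤n →
      ≤-cert (slack r ⊕ slack (∣∣≤⇒-≤ (s n K≤n))) (lemma p (seq a n) (seq a K) ε))
  where
  lemma : ∀ (p a c e : ℚ) → a ≡ p +′ ½ *′ ½ *′ e +′ ((c -′ (p +′ ½ *′ e)) +′ (½ *′ ½ *′ e -′ -′ (a -′ c)))
  lemma = solve-∀ ℚ-ring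
... | no ¬r = inj₂ (½ *′ ½ *′ ε , ½-pos 0<½ ⊗< 0<ε , K ℕ.⊔ N , λ n KN≤n →
      ≤-cert (slack (ℚₚ.<⇒≤ (ℚₚ.≰⇒> ¬r)) ⊕ slack (∣∣≤⇒≤ (s n (ℕₚ.m⊔n≤o⇒m≤o K N KN≤n))) ⊕ slack (h n (ℕₚ.m⊔n≤o⇒n≤o K N KN≤n)))
        (lemma p q (seq a n) (seq b n) (seq a K) ε))
  where
  lemma : ∀ (p q a b c e : ℚ) → b ≡ q +′ ½ *′ ½ *′ e +′ ((p +′ ½ *′ e -′ c) +′ (½ *′ ½ *′ e -′ (a -′ c)) +′ (a +′ b -′ (p +′ q +′ e)))
  lemma = solve-∀ ℚ-ring

-- The mean value inequality: a function with local Lipschitz bound M at each point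
-- has no chord of slope above M, since by bisection the steep chords would shrink to a point.
module Bisection (φ : ℝ → ℝ) (M : ℚ)
  (local : ∀ t → t ≤ 0ℝ → ∃[ δ ] 0ℚ <′ δ × (∀ s → s ≤ 0ℝ → ∣ s - t ∣ ≤ const δ → ∣ φ s - φ t ∣ ≤ const M * ∣ s - t ∣)) where

  record Steep (a b : ℚ) : Set where
    constructor steep-by
    field
      slope : const (M *′ (b -′ a)) < φ (const b) - φ (const a)

  record SteepChord : Set where
    constructor mkChord
    field
      lo hi : ℚ
      lo≤hi : lo ≤′ hi
      hi≤0  : hi ≤′ 0ℚ
      steep : Steep lo hi

  open SteepChord

  mid : SteepChord → ℚ
  mid c = ½ *′ (lo c +′ hi c)

  lo≤mid : ∀ c → lo c ≤′ mid c
  lo≤mid c = ≤-cert (0≤½ ⊗′ slack (lo≤hi c)) (lemma (lo c) (hi c))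
    where
    lemma : ∀ (a b : ℚ) → ½ *′ (a +′ b) ≡ a +′ ½ *′ (b -′ a)
    lemma = solve-∀ ℚ-ring

  mid≤hi : ∀ c → mid c ≤′ hi c
  mid≤hi c = ≤-cert (0≤½ ⊗′ slack (lo≤hi c)) (lemma (lo c) (hi c))
    where
    lemma : ∀ (a b : ℚ) → b ≡ ½ *′ (a +′ b) +′ ½ *′ (b -′ a)
    lemma = solve-∀ ℚ-ring

  -- The rises over the two halves add up to the rise over the whole, so `<-split` finds a half that
  -- is still too steep.
  steep-half : ∀ c → Steep (lo c) (mid c) ⊎ Steep (mid c) (hi c)
  steep-half c = Sum.map steep-by steep-by (<-split (M *′ (mid c -′ lo c)) (M *′ (hi c -′ mid c))
    (φ (const (mid c)) - φ (const (lo c))) (φ (const (hi c)) - φ (const (mid c)))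
    (<-pointwise (const (M *′ (hi c -′ lo c))) (const (M *′ (mid c -′ lo c) +′ M *′ (hi c -′ mid c)))
      (φ (const (hi c)) - φ (const (lo c))) ((φ (const (mid c)) - φ (const (lo c))) + (φ (const (hi c)) - φ (const (mid c))))
      (λ _ → lemma₁ M (lo c) (mid c) (hi c))
      (λ n → lemma₂ (seq (φ (const (lo c))) n) (seq (φ (const (mid c))) n) (seq (φ (const (hi c))) n)) (Steep.slope (steep c))))
    where
    lemma₁ : ∀ (M a m b : ℚ) → M *′ (b -′ a) ≡ M *′ (m -′ a) +′ M *′ (b -′ m)
    lemma₁ = solve-∀ ℚ-ring
    lemma₂ : ∀ (a m b : ℚ) → b -′ a ≡ (m -′ a) +′ (b -′ m)
    lemma₂ = solve-∀ ℚ-ring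

  shrink : ∀ c → Steep (lo c) (mid c) ⊎ Steep (mid c) (hi c) → SteepChord
  shrink c (inj₁ s) = mkChord (lo c) (mid c) (lo≤mid c) (ℚₚ.≤-trans (mid≤hi c) (hi≤0 c)) s
  shrink c (inj₂ s) = mkChord (mid c) (hi c) (mid≤hi c) (hi≤0 c) s

  lo≤shrink : ∀ c s → lo c ≤′ lo (shrink c s)
  lo≤shrink c (inj₁ _) = ℚₚ.≤-refl
  lo≤shrink c (inj₂ _) = lo≤mid c

  shrink≤hi : ∀ c s → hi (shrink c s) ≤′ hi c
  shrink≤hi c (inj₁ _) = mid≤hi c
  shrink≤hi c (inj₂ _) = ℚₚ.≤-refl

  shrink-width : ∀ c s → hi (shrink c s) -′ lo (shrink c s) ≡ ½ *′ (hi c -′ lo c)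
  shrink-width c (inj₁ _) = lemma (lo c) (hi c)
    where
    lemma : ∀ (a b : ℚ) → ½ *′ (a +′ b) -′ a ≡ ½ *′ (b -′ a)
    lemma = solve-∀ ℚ-ring
  shrink-width c (inj₂ _) = lemma (lo c) (hi c)
    where
    lemma : ∀ (a b : ℚ) → b -′ ½ *′ (a +′ b) ≡ ½ *′ (b -′ a)
    lemma = solve-∀ ℚ-ring

  bisect : SteepChord → SteepChord
  bisect c = shrink c (steep-half c)

  module _ (c₀ : SteepChord) where

    chord : ℕ → SteepChord
    chord zero    = c₀
    chord (suc k) = bisect (chord k)

    a b : ℕ → ℚ
    a k = lo (chord k)
    b k = hi (chord k)

    width : ∀ k → b k -′ a k ≡ 2⁻ k *′ (b 0 -′ a 0)
    width zero    = sym (ℚₚ.*-identityˡ (b 0 -′ a 0))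
    width (suc k) = trans (shrink-width (chord k) (steep-half (chord k)))
      (trans (cong (½ *′_) (width k)) (sym (ℚₚ.*-assoc ½ (2⁻ k) (b 0 -′ a 0))))

    a-mono : ∀ j k → a k ≤′ a (j ℕ.+ k)
    a-mono zero    k = ℚₚ.≤-refl
    a-mono (suc j) k = ℚₚ.≤-trans (a-mono j k) (lo≤shrink (chord (j ℕ.+ k)) (steep-half (chord (j ℕ.+ k))))

    b-anti : ∀ j k → b (j ℕ.+ k) ≤′ b k
    b-anti zero    k = ℚₚ.≤-refl
    b-anti (suc j) k = ℚₚ.≤-trans (shrink≤hi (chord (j ℕ.+ k)) (steep-half (chord (j ℕ.+ k)))) (b-anti j k)

    a≤a : ∀ k n → k ℕ.≤ n → a k ≤′ a n
    a≤a k n k≤n = subst (λ n → a k ≤′ a n) (ℕₚ.m∸n+n≡m k≤n) (a-mono (n ℕ.∸ k) k)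

    a≤b : ∀ k n → k ℕ.≤ n → a n ≤′ b k
    a≤b k n k≤n = subst (λ n → a n ≤′ b k) (ℕₚ.m∸n+n≡m k≤n) (ℚₚ.≤-trans (lo≤hi (chord (n ℕ.∸ k ℕ.+ k))) (b-anti (n ℕ.∸ k) k))

    narrow : ∀ ε → 0ℚ <′ ε → ∃[ k ] b k -′ a k ≤′ ε
    narrow ε 0<ε =
      let 0≤w = slack (lo≤hi c₀)
          (δ , 0<δ , e) = quotient (0<1 ⊕< 0≤w) 0<ε
          (k , p) = 2⁻-small δ 0<δ
      in k , subst₂ _≤′_ (sym (width k)) (trans (ℚₚ.*-comm δ (1ℚ +′ (b 0 -′ a 0))) e)
           (*-mono′ (0≤2⁻ k) p 0≤w (≤-cert 0≤1 (ℚₚ.+-comm 1ℚ (b 0 -′ a 0))))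

    -- The left ends are themselves the Cauchy sequence. From index k on they lie between `a k` and
    -- `b k`, so the limit belongs to every interval.
    limit : ℝ
    limit = mkℝ a λ ε 0<ε → let (k , w≤ε) = narrow ε 0<ε in k , λ m n k≤m k≤n → ∣∣≤
      (≤-cert (slack w≤ε ⊕ slack (a≤b k m k≤m) ⊕ slack (a≤a k n k≤n)) (lemma₁ (a k) (b k) (a m) (a n) ε))
      (≤-cert (slack w≤ε ⊕ slack (a≤b k n k≤n) ⊕ slack (a≤a k m k≤m)) (lemma₂ (a k) (b k) (a m) (a n) ε))
      where
      lemma₁ : ∀ (a b x y e : ℚ) → e ≡ x -′ y +′ ((e -′ (b -′ a)) +′ (b -′ x) +′ (y -′ a))
      lemma₁ = solve-∀ ℚ-ring
      lemma₂ : ∀ (a b x y e : ℚ) → e ≡ -′ (x -′ y) +′ ((e -′ (b -′ a)) +′ (b -′ y) +′ (x -′ a))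
      lemma₂ = solve-∀ ℚ-ring

    limit≤0 : limit ≤ 0ℝ
    limit≤0 = ≤-pointwise limit 0ℝ (λ k → ℚₚ.≤-trans (lo≤hi (chord k)) (hi≤0 (chord k)))

    -- Both ends of the k-th chord are within δ of the limit, which lies between them, so the local
    -- bounds add up to M (b - limit) + M (limit - a) = M (b - a). Each is spent with allowance ε/4,
    -- against an excess of ε.
    contradiction-at : ∀ k δ → b k -′ a k ≤′ δ →
      (∀ s → s ≤ 0ℝ → ∣ s - limit ∣ ≤ const δ → ∣ φ s - φ limit ∣ ≤ const M * ∣ s - limit ∣) →
      const (M *′ (b k -′ a k)) < φ (const (b k)) - φ (const (a k)) → ⊥
    contradiction-at k δ w≤δ L (ε , 0<ε , S) = ev-absurd (ev-× (ev-≥ k) (ev-× S (ev-× (at-right ¼ε 0<¼ε) (at-left ¼ε 0<¼ε))))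
      λ n (k≤n , s , r , l) → absurd (a k) (b k) (a n) (seq (φ (const (a k))) n) (seq (φ (const (b k))) n) (seq (φ limit) n) ε 0<ε s
        (subst (λ z → ∣ seq (φ (const (b k))) n -′ seq (φ limit) n ∣′ ≤′ M *′ z +′ ¼ε) (right-gap n k≤n) r)
        (subst (λ z → ∣ seq (φ (const (a k))) n -′ seq (φ limit) n ∣′ ≤′ M *′ z +′ ¼ε) (left-gap n k≤n) l)
      where
      ¼ε : ℚ
      ¼ε = ½ *′ ½ *′ ε
      0<¼ε : 0ℚ <′ ¼ε
      0<¼ε = ½-pos 0<½ ⊗< 0<ε
      right-gap : ∀ n → k ℕ.≤ n → ∣ b k -′ a n ∣′ ≡ b k -′ a n
      right-gap n k≤n = ℚₚ.0≤p⇒∣p∣≡p (slack (a≤b k n k≤n))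
      left-gap : ∀ n → k ℕ.≤ n → ∣ a k -′ a n ∣′ ≡ a n -′ a k
      left-gap n k≤n = trans (∣∣-sub-comm (a k) (a n)) (ℚₚ.0≤p⇒∣p∣≡p (slack (a≤a k n k≤n)))
      lemma₁ : ∀ (a b x d : ℚ) → d ≡ b -′ x +′ ((d -′ (b -′ a)) +′ (x -′ a))
      lemma₁ = solve-∀ ℚ-ring
      lemma₂ : ∀ (a b x d : ℚ) → d ≡ x -′ a +′ ((d -′ (b -′ a)) +′ (b -′ x))
      lemma₂ = solve-∀ ℚ-ring
      at-right : ∣ φ (const (b k)) - φ limit ∣ ≤ const M * ∣ const (b k) - limit ∣
      at-right = L (const (b k)) (≤-pointwise (const (b k)) 0ℝ (λ _ → hi≤0 (chord k)))
        (≤-eventually (∣ const (b k) - limit ∣) (const δ) (ev-map (λ n k≤n → subst (_≤′ δ) (sym (right-gap n k≤n))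
          (≤-cert (slack w≤δ ⊕ slack (a≤a k n k≤n)) (lemma₁ (a k) (b k) (a n) δ))) (ev-≥ k)))
      at-left : ∣ φ (const (a k)) - φ limit ∣ ≤ const M * ∣ const (a k) - limit ∣
      at-left = L (const (a k)) (≤-pointwise (const (a k)) 0ℝ (λ _ → ℚₚ.≤-trans (lo≤hi (chord k)) (hi≤0 (chord k))))
        (≤-eventually (∣ const (a k) - limit ∣) (const δ) (ev-map (λ n k≤n → subst (_≤′ δ) (sym (left-gap n k≤n))
          (≤-cert (slack w≤δ ⊕ slack (a≤b k n k≤n)) (lemma₂ (a k) (b k) (a n) δ))) (ev-≥ k)))
      lemma₃ : ∀ (M a b x p q r e : ℚ) → 0ℚ ≡ ½ *′ e +′ ((q -′ p -′ (M *′ (b -′ a) +′ e))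
        +′ (M *′ (b -′ x) +′ ½ *′ ½ *′ e -′ (q -′ r)) +′ (M *′ (x -′ a) +′ ½ *′ ½ *′ e -′ -′ (p -′ r)))
      lemma₃ = solve-∀ ℚ-ring
      absurd : ∀ (a b x p q r ε : ℚ) → 0ℚ <′ ε → M *′ (b -′ a) +′ ε ≤′ q -′ p →
               ∣ q -′ r ∣′ ≤′ M *′ (b -′ x) +′ ½ *′ ½ *′ ε → ∣ p -′ r ∣′ ≤′ M *′ (x -′ a) +′ ½ *′ ½ *′ ε → ⊥
      absurd a b x p q r ε 0<ε s hq hp = ℚₚ.<⇒≢ (ℚₚ.<-≤-trans (½-pos 0<ε)
        (≤-cert (slack s ⊕ slack (∣∣≤⇒≤ hq) ⊕ slack (∣∣≤⇒-≤ hp)) (lemma₃ M a b x p q r ε))) refl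

    no-steep-chord : ⊥
    no-steep-chord = let (δ , 0<δ , L) = local limit limit≤0 ; (k , w≤δ) = narrow δ 0<δ in
      contradiction-at k δ w≤δ L (Steep.slope (steep (chord k)))

-- The barrier at the double zero for e = 0.

-- Twice the projection of x to [1 - η, 1 + η], up to an additive constant.
κ : ℚ → ℝ → ℝ
κ η x = ∣ x - const (1ℚ -′ η) ∣ - ∣ x - const (1ℚ +′ η) ∣

κ′ : ℚ → ℚ → ℚ
κ′ η x = ∣ x -′ (1ℚ -′ η) ∣′ -′ ∣ x -′ (1ℚ +′ η) ∣′

κ-lip : ∀ η x y → ∣ κ′ η x -′ κ′ η y ∣′ ≤′ 2ℚ *′ ∣ x -′ y ∣′
κ-lip η x y = ∣∣≤
    (≤-cert (slack (∣∣≤⇒≤ p) ⊕ slack (∣∣≤⇒-≤ q)) (lemma₁ ∣ x -′ l ∣′ ∣ y -′ l ∣′ ∣ x -′ r ∣′ ∣ y -′ r ∣′ ∣ x -′ y ∣′))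
    (≤-cert (slack (∣∣≤⇒-≤ p) ⊕ slack (∣∣≤⇒≤ q)) (lemma₂ ∣ x -′ l ∣′ ∣ y -′ l ∣′ ∣ x -′ r ∣′ ∣ y -′ r ∣′ ∣ x -′ y ∣′))
  where
  l = 1ℚ -′ η
  r = 1ℚ +′ η
  cancel : ∀ (x y l : ℚ) → (x -′ l) -′ (y -′ l) ≡ x -′ y
  cancel = solve-∀ ℚ-ring
  p : ∣ ∣ x -′ l ∣′ -′ ∣ y -′ l ∣′ ∣′ ≤′ ∣ x -′ y ∣′
  p = subst (λ z → ∣ ∣ x -′ l ∣′ -′ ∣ y -′ l ∣′ ∣′ ≤′ ∣ z ∣′) (cancel x y l) (∣∣-lip (x -′ l) (y -′ l))
  q : ∣ ∣ x -′ r ∣′ -′ ∣ y -′ r ∣′ ∣′ ≤′ ∣ x -′ y ∣′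
  q = subst (λ z → ∣ ∣ x -′ r ∣′ -′ ∣ y -′ r ∣′ ∣′ ≤′ ∣ z ∣′) (cancel x y r) (∣∣-lip (x -′ r) (y -′ r))
  lemma₁ : ∀ (a b c d e : ℚ) → 2ℚ *′ e ≡ (a -′ c) -′ (b -′ d) +′ ((e -′ (a -′ b)) +′ (e -′ -′ (c -′ d)))
  lemma₁ = solve-∀ ℚ-ring
  lemma₂ : ∀ (a b c d e : ℚ) → 2ℚ *′ e ≡ -′ ((a -′ c) -′ (b -′ d)) +′ ((e -′ -′ (a -′ b)) +′ (e -′ (c -′ d)))
  lemma₂ = solve-∀ ℚ-ring

κ-above : ∀ η x → 0ℚ ≤′ η → 1ℚ +′ η ≤′ x → κ′ η x ≡ 2ℚ *′ η
κ-above η x 0≤η h = trans (cong₂ _-′_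
    (ℚₚ.0≤p⇒∣p∣≡p (subst (0ℚ ≤′_) (lemma₁ x η) (slack h ⊕ 0≤2 ⊗′ 0≤η))) (ℚₚ.0≤p⇒∣p∣≡p (slack h)))
  (lemma₂ x η)
  where
  lemma₁ : ∀ (x η : ℚ) → (x -′ (1ℚ +′ η)) +′ 2ℚ *′ η ≡ x -′ (1ℚ -′ η)
  lemma₁ = solve-∀ ℚ-ring
  lemma₂ : ∀ (x η : ℚ) → (x -′ (1ℚ -′ η)) -′ (x -′ (1ℚ +′ η)) ≡ 2ℚ *′ η
  lemma₂ = solve-∀ ℚ-ring

κ-below : ∀ η x → 0ℚ ≤′ η → x ≤′ 1ℚ -′ η → κ′ η x ≡ -′ (2ℚ *′ η)
κ-below η x 0≤η h = trans (cong₂ _-′_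
    (trans (∣∣-sub-comm x (1ℚ -′ η)) (ℚₚ.0≤p⇒∣p∣≡p (slack h)))
    (trans (∣∣-sub-comm x (1ℚ +′ η)) (ℚₚ.0≤p⇒∣p∣≡p (subst (0ℚ ≤′_) (lemma₁ x η) (slack h ⊕ 0≤2 ⊗′ 0≤η)))))
  (lemma₂ x η)
  where
  lemma₁ : ∀ (x η : ℚ) → (1ℚ -′ η -′ x) +′ 2ℚ *′ η ≡ 1ℚ +′ η -′ x
  lemma₁ = solve-∀ ℚ-ring
  lemma₂ : ∀ (x η : ℚ) → (1ℚ -′ η -′ x) -′ (1ℚ +′ η -′ x) ≡ -′ (2ℚ *′ η)
  lemma₂ = solve-∀ ℚ-ring

¼ : ℚ
¼ = ½ *′ ½

0<¼ : 0ℚ <′ ¼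
0<¼ = ½-pos 0<½

⅛ : ℚ
⅛ = ½ *′ ¼

0<⅛ : 0ℚ <′ ⅛
0<⅛ = ½-pos 0<¼

6ℚ 14ℚ : ℚ
6ℚ  = 4ℚ +′ 2ℚ
14ℚ = 8ℚ +′ 4ℚ +′ 2ℚ

0≤14 : 0ℚ ≤′ 14ℚ
0≤14 = from-yes (0ℚ ℚₚ.≤? 14ℚ)

-- The double zero gives (x - 1)² ≤ 4η², while |x| ≤ 3/2 because η ≤ 1/4.
g-flat : ∀ η x → 0ℚ ≤′ η → η ≤′ ¼ → ∣ x -′ 1ℚ ∣′ ≤′ 2ℚ *′ η → ∣ g 0ℚ x ∣′ ≤′ 6ℚ *′ (η *′ η)
g-flat η x 0≤η η≤¼ h = ℚₚ.≤-trans
    (∣∣-mul-mono {x} {1ℚ +′ ½} {(x -′ 1ℚ) *′ (x -′ 1ℚ) +′ 0ℚ} {2ℚ *′ η *′ (2ℚ *′ η)}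
      (∣∣≤ (≤-cert (slack (∣∣≤⇒≤ h) ⊕ 0≤2 ⊗′ slack η≤¼) (lemma₁ x η))
           (≤-cert (slack (∣∣≤⇒-≤ h) ⊕ 0≤2 ⊗′ slack η≤¼ ⊕ 0≤2) (lemma₂ x η)))
      (subst (λ z → ∣ z ∣′ ≤′ 2ℚ *′ η *′ (2ℚ *′ η)) (sym (ℚₚ.+-identityʳ ((x -′ 1ℚ) *′ (x -′ 1ℚ))))
        (∣∣-mul-mono {x -′ 1ℚ} {2ℚ *′ η} {x -′ 1ℚ} h h)))
    (ℚₚ.≤-reflexive (lemma₃ η))
  where
  lemma₁ : ∀ (x η : ℚ) → 1ℚ +′ ½ ≡ x +′ ((2ℚ *′ η -′ (x -′ 1ℚ)) +′ 2ℚ *′ (¼ -′ η))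
  lemma₁ = solve-∀ ℚ-ring
  lemma₂ : ∀ (x η : ℚ) → 1ℚ +′ ½ ≡ -′ x +′ ((2ℚ *′ η -′ -′ (x -′ 1ℚ)) +′ 2ℚ *′ (¼ -′ η) +′ 2ℚ)
  lemma₂ = solve-∀ ℚ-ring
  lemma₃ : ∀ (η : ℚ) → (1ℚ +′ ½) *′ (2ℚ *′ η *′ (2ℚ *′ η)) ≡ 6ℚ *′ (η *′ η)
  lemma₃ = solve-∀ ℚ-ring

module Barrier {m : ℕ} (y : ℝ → Point (suc m)) (sol : BackwardSolution (F (perturb 0ℚ)) y)
               (η : ℚ) (0<η : 0ℚ <′ η) (η≤¼ : η ≤′ ¼) where

  u : ℝ → ℝ
  u t = y t zero

  f : ℝ → ℝ
  f t = F (perturb 0ℚ) (y t) zero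

  seq-f : ∀ t n → seq (f t) n ≡ g 0ℚ (seq (u t) n)
  seq-f t n = seq-F (perturb 0ℚ) (y t) zero n

  0≤η : 0ℚ ≤′ η
  0≤η = ℚₚ.<⇒≤ 0<η

  -- 14 = 2 (6 + 1): the speed bound 6η² of `g-flat` plus the tolerance η² in the derivative, times
  -- the Lipschitz constant 2 of κ.
  slope : ℚ
  slope = 14ℚ *′ (η *′ η)

  0≤slope : 0ℚ ≤′ slope
  0≤slope = 0≤14 ⊗′ 0≤sq η

  u-derivative : ∀ t → t ≤ 0ℝ → ∀ ε → 0ℚ <′ ε → ∃[ δ ] 0ℚ <′ δ × (∀ s → s ≤ 0ℝ → ∣ s - t ∣ ≤ const δ →
    ∣ (u s - u t) - (s - t) * f t ∣ ≤ ∣ const ε * (s - t) ∣)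
  u-derivative t t≤0 ε 0<ε =
    let (δ , 0<δ , D) = BackwardSolution.derivative sol t t≤0 ε 0<ε
    in δ , 0<δ , λ s s≤0 s~t →
      let v = (y s ⊟ y t) ⊟ (s - t) ⊡ F (perturb 0ℚ) (y t)
          b = ∣ const ε * (s - t) ∣
          c = const (ε *′ ε) * ((s - t) * (s - t))
      in sqrt-≤ (v zero) b (≤-pointwise 0ℝ b (λ n → 0≤∣∣ (ε *′ (seq s n -′ seq t n))))
        (≤-trans (v zero * v zero) ∥ v ∥² (b * b) (≤-pointwise (v zero * v zero) ∥ v ∥² (square≤norm v zero))
          (≤-trans ∥ v ∥² c (b * b) (D s s≤0 s~t)
            (≤-pointwise c (b * b) (λ n → ℚₚ.≤-reflexive
              (trans (lemma ε (seq s n -′ seq t n)) (sym (∣∣-sq (ε *′ (seq s n -′ seq t n)))))))))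
    where
    lemma : ∀ (ε r : ℚ) → ε *′ ε *′ (r *′ r) ≡ ε *′ r *′ (ε *′ r)
    lemma = solve-∀ ℚ-ring

  Local : ℝ → Set
  Local t = ∃[ δ ] 0ℚ <′ δ × (∀ s → s ≤ 0ℝ → ∣ s - t ∣ ≤ const δ → ∣ κ η (u s) - κ η (u t) ∣ ≤ const slope * ∣ s - t ∣)

  -- In the two estimates a = u s, b = u t, r = s - t and q = f t.
  inside-estimate : ∀ a b r q e → ∣ a -′ b -′ r *′ q ∣′ ≤′ ∣ η *′ η *′ r ∣′ +′ ½ *′ e → ∣ q ∣′ ≤′ 6ℚ *′ (η *′ η) →
    ∣ κ′ η a -′ κ′ η b ∣′ ≤′ slope *′ ∣ r ∣′ +′ e
  inside-estimate a b r q e h hq = ℚₚ.≤-trans (κ-lip η a b)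
    (≤-cert (0≤2 ⊗′ (slack split ⊕ slack (ℚₚ.≤-trans h (ℚₚ.≤-reflexive (cong (_+′ ½ *′ e) size)))
                     ⊕ slack (∣∣-mul-mono {r} {∣ r ∣′} {q} ℚₚ.≤-refl hq)))
      (lemma₂ ∣ a -′ b ∣′ ∣ a -′ b -′ r *′ q ∣′ ∣ r *′ q ∣′ ∣ r ∣′ η e))
    where
    lemma₁ : ∀ (a b r q : ℚ) → (a -′ b -′ r *′ q) +′ r *′ q ≡ a -′ b
    lemma₁ = solve-∀ ℚ-ring
    split : ∣ a -′ b ∣′ ≤′ ∣ a -′ b -′ r *′ q ∣′ +′ ∣ r *′ q ∣′
    split = subst (λ z → ∣ z ∣′ ≤′ ∣ a -′ b -′ r *′ q ∣′ +′ ∣ r *′ q ∣′) (lemma₁ a b r q) (ℚₚ.∣p+q∣≤∣p∣+∣q∣ (a -′ b -′ r *′ q) (r *′ q))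
    size : ∣ η *′ η *′ r ∣′ ≡ η *′ η *′ ∣ r ∣′
    size = trans (∣∣-mul (η *′ η) r) (cong (_*′ ∣ r ∣′) (ℚₚ.0≤p⇒∣p∣≡p (0≤sq η)))
    lemma₂ : ∀ (A B C r η e : ℚ) → 14ℚ *′ (η *′ η) *′ r +′ e ≡ 2ℚ *′ A +′
      2ℚ *′ ((B +′ C -′ A) +′ (η *′ η *′ r +′ ½ *′ e -′ B) +′ (r *′ (6ℚ *′ (η *′ η)) -′ C))
    lemma₂ = solve-∀ ℚ-ring

  -- Since b is at least η/4 outside the band and a is within η/4 of b, both lie on the same side,
  -- where κ is constant. The η/4 is made of (3/2)(η/8) from (1 + G)|r| and η/16 from the allowance.
  outside-estimate : ∀ a b r q G δ e → 0ℚ ≤′ G → 0ℚ ≤′ e → ∣ a -′ b -′ r *′ q ∣′ ≤′ ∣ 1ℚ *′ r ∣′ +′ ½ *′ ⅛ *′ η → ∣ q ∣′ ≤′ G →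
    ∣ r ∣′ ≤′ δ +′ ½ *′ δ → (1ℚ +′ G) *′ δ ≡ ⅛ *′ η → η +′ ¼ *′ η ≤′ ∣ b -′ 1ℚ ∣′ → ∣ κ′ η a -′ κ′ η b ∣′ ≤′ slope *′ ∣ r ∣′ +′ e
  outside-estimate a b r q G δ e 0≤G 0≤e h hq hr eq far = ℚₚ.≤-trans (≡⇒∣∣≤ ℚₚ.≤-refl same) (0≤slope ⊗′ 0≤∣∣ r ⊕ 0≤e)
    where
    lemma₁ : ∀ (a b r q : ℚ) → (a -′ b -′ r *′ q) +′ r *′ q ≡ a -′ b
    lemma₁ = solve-∀ ℚ-ring
    split : ∣ a -′ b ∣′ ≤′ ∣ a -′ b -′ r *′ q ∣′ +′ ∣ r *′ q ∣′
    split = subst (λ z → ∣ z ∣′ ≤′ ∣ a -′ b -′ r *′ q ∣′ +′ ∣ r *′ q ∣′) (lemma₁ a b r q) (ℚₚ.∣p+q∣≤∣p∣+∣q∣ (a -′ b -′ r *′ q) (r *′ q))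
    lemma₂ : ∀ (A B C r G δ η : ℚ) → (1ℚ +′ ½) *′ ((1ℚ +′ G) *′ δ) +′ ½ *′ ⅛ *′ η ≡ A +′
      ((B +′ C -′ A) +′ (r +′ ½ *′ ⅛ *′ η -′ B) +′ (r *′ G -′ C) +′ (1ℚ +′ G) *′ (δ +′ ½ *′ δ -′ r))
    lemma₂ = solve-∀ ℚ-ring
    lemma₃ : ∀ (η : ℚ) → (1ℚ +′ ½) *′ (⅛ *′ η) +′ ½ *′ ⅛ *′ η ≡ ¼ *′ η
    lemma₃ = solve-∀ ℚ-ring
    near : ∣ a -′ b ∣′ ≤′ ¼ *′ η
    near = subst (∣ a -′ b ∣′ ≤′_) (trans (cong (λ z → (1ℚ +′ ½) *′ z +′ ½ *′ ⅛ *′ η) eq) (lemma₃ η))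
      (≤-cert (slack split ⊕ slack (subst (λ z → ∣ a -′ b -′ r *′ q ∣′ ≤′ ∣ z ∣′ +′ ½ *′ ⅛ *′ η) (ℚₚ.*-identityˡ r) h)
               ⊕ slack (∣∣-mul-mono {r} {∣ r ∣′} {q} {G} ℚₚ.≤-refl hq) ⊕ (0≤1 ⊕ 0≤G) ⊗′ slack hr)
        (lemma₂ ∣ a -′ b ∣′ ∣ a -′ b -′ r *′ q ∣′ ∣ r *′ q ∣′ ∣ r ∣′ G δ η))
    same : κ′ η a ≡ κ′ η b
    same with ∣∣-cases (b -′ 1ℚ)
    ... | inj₁ eq₁ = trans (κ-above η a 0≤η (≤-cert (slack far′ ⊕ slack (∣∣≤⇒-≤ near)) (up a b η)))
      (sym (κ-above η b 0≤η (≤-cert (slack far′ ⊕ ℚₚ.<⇒≤ 0<¼ ⊗′ 0≤η) (up′ b η))))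
      where
      far′ : η +′ ¼ *′ η ≤′ b -′ 1ℚ
      far′ = subst (η +′ ¼ *′ η ≤′_) eq₁ far
      up : ∀ (a b η : ℚ) → a ≡ 1ℚ +′ η +′ ((b -′ 1ℚ -′ (η +′ ¼ *′ η)) +′ (¼ *′ η -′ -′ (a -′ b)))
      up = solve-∀ ℚ-ring
      up′ : ∀ (b η : ℚ) → b ≡ 1ℚ +′ η +′ ((b -′ 1ℚ -′ (η +′ ¼ *′ η)) +′ ¼ *′ η)
      up′ = solve-∀ ℚ-ring
    ... | inj₂ eq₁ = trans (κ-below η a 0≤η (≤-cert (slack far′ ⊕ slack (∣∣≤⇒≤ near)) (down a b η)))
      (sym (κ-below η b 0≤η (≤-cert (slack far′ ⊕ ℚₚ.<⇒≤ 0<¼ ⊗′ 0≤η) (down′ b η))))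
      where
      far′ : η +′ ¼ *′ η ≤′ -′ (b -′ 1ℚ)
      far′ = subst (η +′ ¼ *′ η ≤′_) eq₁ far
      down : ∀ (a b η : ℚ) → 1ℚ -′ η ≡ a +′ ((-′ (b -′ 1ℚ) -′ (η +′ ¼ *′ η)) +′ (¼ *′ η -′ (a -′ b)))
      down = solve-∀ ℚ-ring
      down′ : ∀ (b η : ℚ) → 1ℚ -′ η ≡ b +′ ((-′ (b -′ 1ℚ) -′ (η +′ ¼ *′ η)) +′ ¼ *′ η)
      down′ = solve-∀ ℚ-ring

  inside : ∀ t → t ≤ 0ℝ → Eventually (λ n → ∣ seq (u t) n -′ 1ℚ ∣′ ≤′ 2ℚ *′ η) → Local t
  inside t t≤0 close = let (δ , 0<δ , D) = u-derivative t t≤0 (η *′ η) (0<η ⊗< 0<η) in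
    δ , 0<δ , λ s s≤0 s~t e 0<e → ev-map₂ (λ n h c →
        inside-estimate (seq (u s) n) (seq (u t) n) (seq s n -′ seq t n) (seq (f t) n) e h
          (subst (λ z → ∣ z ∣′ ≤′ 6ℚ *′ (η *′ η)) (sym (seq-f t n)) (g-flat η (seq (u t) n) 0≤η η≤¼ c)))
      (D s s≤0 s~t (½ *′ e) (½-pos 0<e)) close

  outside : ∀ t → t ≤ 0ℝ → Eventually (λ n → η +′ ¼ *′ η ≤′ ∣ seq (u t) n -′ 1ℚ ∣′) → Local t
  outside t t≤0 far =
    let (δ , 0<δ , D) = u-derivative t t≤0 1ℚ 0<1
        (G , 0<G , hG) = bounded (f t)
        (δ₁ , 0<δ₁ , eq) = quotient (0<1 ⊕< ℚₚ.<⇒≤ 0<G) (0<⅛ ⊗< 0<η)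
    in δ ℚ.⊓ δ₁ , ⊓-pos 0<δ 0<δ₁ , λ s s≤0 s~t e 0<e → ev-map₃ (λ n (h , r) b c →
        outside-estimate (seq (u s) n) (seq (u t) n) (seq s n -′ seq t n) (seq (f t) n) G δ₁ e (ℚₚ.<⇒≤ 0<G) (ℚₚ.<⇒≤ 0<e) h b
          (ℚₚ.≤-trans r (ℚₚ.+-monoˡ-≤ (½ *′ δ₁) (ℚₚ.p⊓q≤q δ δ₁))) eq c)
      (ev-× (D s s≤0 (≤-trans (∣ s - t ∣) (const (δ ℚ.⊓ δ₁)) (const δ) s~t (≤-pointwise (const (δ ℚ.⊓ δ₁)) (const δ) (λ _ → ℚₚ.p⊓q≤p δ δ₁)))
              (½ *′ ⅛ *′ η) (½-pos 0<⅛ ⊗< 0<η))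
            (s~t (½ *′ δ₁) (½-pos 0<δ₁)))
      hG far

  -- Whether u t lies in the band is undecidable. One entry, accurate to η/4, is tested against
  -- 3η/2; this yields |u t - 1| ≤ 2η or |u t - 1| ≥ 5η/4, two overlapping cases.
  local : ∀ t → t ≤ 0ℝ → Local t
  local t t≤0 with settle (u t) (¼ *′ η) (0<¼ ⊗< 0<η)
  ... | N , h with ∣ seq (u t) N -′ 1ℚ ∣′ ℚₚ.≤? η +′ ½ *′ η
  ... | yes p = inside t t≤0 (N , λ n N≤n → ℚₚ.≤-trans (∣∣-tri (seq (u t) n) (seq (u t) N) 1ℚ)
        (≤-cert (slack (h n N≤n) ⊕ slack p ⊕ ℚₚ.<⇒≤ 0<¼ ⊗′ 0≤η) (lemma ∣ seq (u t) n -′ seq (u t) N ∣′ ∣ seq (u t) N -′ 1ℚ ∣′ η)))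
    where
    lemma : ∀ (a b η : ℚ) → 2ℚ *′ η ≡ a +′ b +′ ((¼ *′ η -′ a) +′ (η +′ ½ *′ η -′ b) +′ ¼ *′ η)
    lemma = solve-∀ ℚ-ring
  ... | no ¬p = outside t t≤0 (N , λ n N≤n → ≤-cert
        (slack (∣∣-tri (seq (u t) N) (seq (u t) n) 1ℚ) ⊕ slack (subst (_≤′ ¼ *′ η) (∣∣-sub-comm (seq (u t) n) (seq (u t) N)) (h n N≤n))
          ⊕ slack (ℚₚ.<⇒≤ (ℚₚ.≰⇒> ¬p)))
        (lemma ∣ seq (u t) N -′ seq (u t) n ∣′ ∣ seq (u t) N -′ 1ℚ ∣′ ∣ seq (u t) n -′ 1ℚ ∣′ η))
    where
    lemma : ∀ (a b c η : ℚ) → c ≡ η +′ ¼ *′ η +′ ((a +′ c -′ b) +′ (¼ *′ η -′ a) +′ (b -′ (η +′ ½ *′ η)))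
    lemma = solve-∀ ℚ-ring

  open Bisection (λ t → κ η (u t)) slope local

  -- Over a time D with D η = 1/4, κ ∘ u changes by at most 14 η² D < 4 η.
  no-crossing : ∀ D → 0ℚ ≤′ D → D *′ η ≡ ¼ → Eventually (λ n → 1ℚ +′ η ≤′ seq (u 0ℝ) n) →
                Eventually (λ n → seq (u (const (-′ D))) n ≤′ 1ℚ -′ η) → ⊥
  no-crossing D 0≤D Dη above below = no-steep-chord (mkChord (-′ D) 0ℚ -D≤0 ℚₚ.≤-refl
      (steep-by (½ *′ η , ½-pos 0<η , ev-map₂ (λ n a b → ℚₚ.≤-reflexive
        (trans (lemma₂ D η) (trans (cong (λ z → 14ℚ *′ z *′ η +′ ½ *′ η) Dη)
          (trans (lemma₃ η) (sym (cong₂ _-′_ (κ-above η (seq (u 0ℝ) n) 0≤η a) (κ-below η (seq (u (const (-′ D))) n) 0≤η b)))))))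
        above below)))
    where
    -D≤0 : -′ D ≤′ 0ℚ
    -D≤0 = ≤-cert 0≤D (lemma₁ D)
      where
      lemma₁ : ∀ (D : ℚ) → 0ℚ ≡ -′ D +′ D
      lemma₁ = solve-∀ ℚ-ring
    lemma₂ : ∀ (D η : ℚ) → 14ℚ *′ (η *′ η) *′ (0ℚ -′ -′ D) +′ ½ *′ η ≡ 14ℚ *′ (D *′ η) *′ η +′ ½ *′ η
    lemma₂ = solve-∀ ℚ-ring
    lemma₃ : ∀ (η : ℚ) → 14ℚ *′ ¼ *′ η +′ ½ *′ η ≡ 2ℚ *′ η -′ -′ (2ℚ *′ η)
    lemma₃ = solve-∀ ℚ-ring

-- A point w of the manifold within 1/2 of (2,0,...,0) has a trajectory with first coordinate at
-- least 5/4 at time 0 and, at some time -D, at most 3/4. Both values are outside the band because η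
-- ≤ 1/4.
target∉ : ∀ {m} → ¬ (onAxis (const 2ℚ) ∈ closure (UnstableManifold (F (perturb {m} 0ℚ)) 0ⁿ))
target∉ {m} z∈ =
  let (w , (y , sol , y0≈w , tends) , _ , near) = z∈ ½ 0<½
      (T , h) = tends ½ 0<½
      -- -D lies below T, and D ≥ 1 makes η = 1/(4D) at most 1/4.
      D = -′ (T ℚ.⊓ -′ 1ℚ)
      1≤D = subst (_≤′ D) (neg-neg 1ℚ) (ℚₚ.neg-antimono-≤ (ℚₚ.p⊓q≤q T (-′ 1ℚ)))
      0<D = ℚₚ.<-≤-trans 0<1 1≤D
      (η , 0<η , Dη) = quotient 0<D 0<¼
      η≤¼ = ≤-cert (slack 1≤D ⊗′ ℚₚ.<⇒≤ 0<η) (trans (sym Dη) (lemma₁ D η))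
      -D≤0 = ≤-pointwise (const (-′ D)) 0ℝ (λ _ → ≤-cert (ℚₚ.<⇒≤ 0<D) (lemma₂ D))
      -D≤T = ≤-pointwise (const (-′ D)) (const T) (λ _ → subst (_≤′ T) (sym (neg-neg (T ℚ.⊓ -′ 1ℚ))) (ℚₚ.p⊓q≤p T (-′ 1ℚ)))
  in Barrier.no-crossing y sol η 0<η η≤¼ D (ℚₚ.<⇒≤ 0<D) Dη
       (above y w η η≤¼ near (y0≈w zero)) (below (y (const (-′ D))) η η≤¼ (proj₂ (h (const (-′ D)) -D≤0 -D≤T)))
  where
  lemma₁ : ∀ (D η : ℚ) → D *′ η ≡ η +′ (D -′ 1ℚ) *′ η
  lemma₁ = solve-∀ ℚ-ring
  lemma₂ : ∀ (D : ℚ) → 0ℚ ≡ -′ D +′ D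
  lemma₂ = solve-∀ ℚ-ring
  above : ∀ (y : ℝ → Point (suc m)) w η → η ≤′ ¼ → ∥ onAxis (const 2ℚ) ⊟ w ∥² < const (½ *′ ½) → y 0ℝ zero ≃ w zero →
          Eventually (λ n → 1ℚ +′ η ≤′ seq (y 0ℝ zero) n)
  above y w η η≤¼ (ε , 0<ε , near) close = ev-map₂
      (λ n p q → ≤-cert (slack (∣∣≤⇒≤ (sq-cancel {2ℚ -′ seq (w zero) n} {½} 0≤½
            (ℚₚ.≤-trans (square≤norm (onAxis (const 2ℚ) ⊟ w) zero n)
              (≤-cert (ℚₚ.<⇒≤ 0<ε ⊕ slack p) (lemma₃ (seq ∥ onAxis (const 2ℚ) ⊟ w ∥² n) (½ *′ ½) ε)))))
          ⊕ slack (∣∣≤⇒-≤ q) ⊕ slack η≤¼) (lemma₄ (seq (y 0ℝ zero) n) (seq (w zero) n) η))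
      near (close ¼ 0<¼)
    where
    lemma₃ : ∀ (a b e : ℚ) → b ≡ a +′ (e +′ (b -′ (a +′ e)))
    lemma₃ = solve-∀ ℚ-ring
    lemma₄ : ∀ (y w η : ℚ) → y ≡ 1ℚ +′ η +′ ((½ -′ (2ℚ -′ w)) +′ (¼ -′ -′ (y -′ w)) +′ (¼ -′ η))
    lemma₄ = solve-∀ ℚ-ring
  below : ∀ (v : Point (suc m)) η → η ≤′ ¼ → ∥ v ⊟ 0ⁿ ∥² ≤ const (½ *′ ½) → Eventually (λ n → seq (v zero) n ≤′ 1ℚ -′ η)
  below v η η≤¼ p = ev-map (λ n h → ≤-cert (slack (∣∣≤⇒≤ (sq-cancel {seq (v zero) n -′ 0ℚ} {½ +′ ¼} (0≤½ ⊕ ℚₚ.<⇒≤ 0<¼)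
        (ℚₚ.≤-trans (square≤norm (v ⊟ 0ⁿ) zero n) h))) ⊕ slack η≤¼) (lemma₅ (seq (v zero) n) η))
      (p ((½ +′ ¼) *′ (½ +′ ¼) -′ ½ *′ ½) (from-yes (0ℚ ℚₚ.<? (½ +′ ¼) *′ (½ +′ ¼) -′ ½ *′ ½)))
    where
    lemma₅ : ∀ (v η : ℚ) → 1ℚ -′ η ≡ v +′ ((½ +′ ¼ -′ (v -′ 0ℚ)) +′ (¼ -′ η))
    lemma₅ = solve-∀ ℚ-ring

-- Names of the fields, and the contradiction.

code : ℕ → ℚ → ℕ
code m ε = encodePolyMap (fieldPoly (perturb {m} ε))

splice : ℕ → ℕ → ℕ → ℕ → ℕ
splice N c c′ l with l ℕ.<? N
... | yes _ = c
... | no  _ = c′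

splice-< : ∀ N c c′ l → l ℕ.< N → splice N c c′ l ≡ c
splice-< N c c′ l l<N with l ℕ.<? N
... | yes _   = refl
... | no  l≮N = ⊥-elim (l≮N l<N)

splice-cases : ∀ N c c′ l → (l ℕ.< N × splice N c c′ l ≡ c) ⊎ splice N c c′ l ≡ c′
splice-cases N c c′ l with l ℕ.<? N
... | yes l<N = inj₁ (l<N , refl)
... | no  _   = inj₂ refl

withOrigin : (ℕ → ℕ) → ℕ → ℕ
withOrigin q l = pair (q l) 0

module Names {m : ℕ} (B : ℕ → RationalBall (suc m)) (0<radius : ∀ k → 0ℚ <′ proj₂ (B k)) where

  Near : ℚ → ℚ → ℕ → Set
  Near ε ε₀ l = ∃[ d ] Distance B (F (perturb ε)) (F (perturb ε₀)) d × d ≤ const (2⁻ l)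

  -- Truncating at M = K + 3 makes the tail 4 · 2⁻ᴹ half of 2⁻ᴷ. The choice 2 (1 + S) η = 2⁻ᴷ bounds
  -- ε S by the other half, and the minimum with 1 meets the assumption e ≤ 1 of the Euler
  -- estimates.
  near-base : ∀ K → ∃[ ε ] 0ℚ <′ ε × ε ≤′ 1ℚ × Near ε 0ℚ K
  near-base K =
    let (η , 0<η , eq) = quotient (0<2 ⊗< (0<1 ⊕< 0≤S)) (0<2⁻ K)
        ε = η ℚ.⊓ 1ℚ
        0<ε = ⊓-pos 0<η 0<1
        (d , D , _ , bound) = distance B 0<radius ε 0ℚ (ℚₚ.<⇒≤ 0<ε)
    in ε , 0<ε , ℚₚ.p⊓q≤q η 1ℚ , d , D , ≤-pointwise d (const (2⁻ K)) λ t →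
         ℚₚ.≤-trans (bound (3 ℕ.+ K) t) (≤-cert (0≤S ⊗′ slack (ℚₚ.p⊓q≤p η 1ℚ) ⊕ ℚₚ.<⇒≤ 0<η)
           (trans (half (2⁻ K)) (trans (cong (λ z → ½ *′ z +′ ½ *′ 2⁻ K) (sym eq)) (lemma S η ε (2⁻ K)))))
    where
    S : ℚ
    S = partial (weight B 0<radius) (3 ℕ.+ K)
    partial-nonneg : ∀ N → 0ℚ ≤′ partial (weight B 0<radius) N
    partial-nonneg zero    = ℚₚ.≤-refl
    partial-nonneg (suc N) = partial-nonneg N ⊕ 0≤weight B 0<radius N
    0≤S : 0ℚ ≤′ S
    0≤S = partial-nonneg (3 ℕ.+ K)
    half : ∀ (x : ℚ) → x ≡ ½ *′ x +′ ½ *′ x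
    half = solve-∀ ℚ-ring
    lemma : ∀ (S η ε x : ℚ) → ½ *′ (2ℚ *′ (1ℚ +′ S) *′ η) +′ ½ *′ x ≡
      (ε -′ 0ℚ) *′ S +′ 4ℚ *′ (½ *′ (½ *′ (½ *′ x))) +′ (S *′ (η -′ ε) +′ η)
    lemma = solve-∀ ℚ-ring

  near-self : ∀ ε l → Near ε ε l
  near-self ε l = let (d , D , bound , _) = distance B 0<radius ε ε ℚₚ.≤-refl in
    d , D , ≤-pointwise d (const (2⁻ l)) λ t → ℚₚ.≤-trans (bound t) (≤-cert (0≤2⁻ l) (lemma ε (partial (weight B 0<radius) t) (2⁻ l)))
    where
    lemma : ∀ (ε S x : ℚ) → x ≡ (ε -′ ε) *′ S +′ x
    lemma = solve-∀ ℚ-ring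

  near-earlier : ∀ ε ε₀ {l K} → l ℕ.≤ K → Near ε ε₀ K → Near ε ε₀ l
  near-earlier ε ε₀ {l} {K} l≤K (d , D , p) = d , D ,
    ≤-trans d (const (2⁻ K)) (const (2⁻ l)) p (≤-pointwise (const (2⁻ K)) (const (2⁻ l)) (λ _ → 2⁻-antitone l≤K))

  names : ∀ ε q → (∀ l → ∃[ ε₀ ] q l ≡ code m ε₀ × Near ε ε₀ l) →
          (ωRep B ⊗ ρⁿ (suc m)) (withOrigin q) (vectorField (perturb ε) , 0ⁿ)
  names ε q h =
    (λ l → let (ε₀ , e , near) = h l in
      subst (λ P → ∃[ d ] Distance B (F (perturb ε)) ⟦ P ⟧ᵐ d × d ≤ const (2⁻ l))
        (sym (trans (cong (decodePolyMap (suc m)) (trans (cong proj₁ (unpair-pair (q l) 0)) e))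
          (decode-encodePolyMap (fieldPoly (perturb ε₀))))) near) ,
    λ i k → ≤-pointwise (∣ const (decodeℚ (lookup (decodeVec (suc m) (snd (withOrigin q) k)) i)) - 0ℝ ∣) (const (2⁻ k))
      λ _ → ≡⇒∣∣≤ (0≤2⁻ k) (cong decodeℚ (trans
        (cong (λ c → lookup (decodeVec (suc m) c) i) (cong proj₂ (unpair-pair (q k) 0))) (decodeVec-0 (suc m) i)))

  names-base : (ωRep B ⊗ ρⁿ (suc m)) (withOrigin (λ _ → code m 0ℚ)) (vectorField (perturb 0ℚ) , 0ⁿ)
  names-base = names 0ℚ (λ _ → code m 0ℚ) (λ l → 0ℚ , refl , near-self 0ℚ l)

  -- An entry l < N is the unperturbed field, at distance at most 2⁻ᴺ and so at most 2⁻ˡ; later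
  -- entries are the perturbed field itself.
  names-spliced : ∀ ε N → Near ε 0ℚ N →
    (ωRep B ⊗ ρⁿ (suc m)) (withOrigin (splice N (code m 0ℚ) (code m ε))) (vectorField (perturb ε) , 0ⁿ)
  names-spliced ε N near = names ε (splice N (code m 0ℚ) (code m ε)) λ l → entry l (splice-cases N (code m 0ℚ) (code m ε) l)
    where
    entry : ∀ l → (l ℕ.< N × splice N (code m 0ℚ) (code m ε) l ≡ code m 0ℚ) ⊎ splice N (code m 0ℚ) (code m ε) l ≡ code m ε →
            ∃[ ε₀ ] splice N (code m 0ℚ) (code m ε) l ≡ code m ε₀ × Near ε ε₀ l
    entry l (inj₁ (l<N , e)) = 0ℚ , e , near-earlier ε 0ℚ (ℕₚ.<⇒≤ l<N) near
    entry l (inj₂ e)         = ε , e , near-self ε l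

theorem13 : ∀ (n : ℕ) → 1 ℕ.≤ n → (B : ℕ → RationalBall n) → ComputableCover n B →
    ¬ Computable (ωRep B ⊗ ρⁿ n) (closedRep n) (ψ n)
theorem13 (suc m) _ B cover (M , computes) =
  let (q , out , _ , outer) = computes (vectorField (perturb 0ℚ) , 0ⁿ) (hyperbolic 0ℚ ℚₚ.≤-refl) p names-base
      (k , z∈ball) = Equivalence.to (outer z) target∉
      (N , stable) = continuous M p q out k
      -- N comes from the run for ε = 0 alone. Only then is ε chosen, small enough for all N
      -- retained entries to be legitimate.
      (ε , 0<ε , ε≤1 , near) = near-base N
      r = splice N (code m 0ℚ) (code m ε)
      (q′ , out′ , _ , outer′) = computes (vectorField (perturb ε) , 0ⁿ) (hyperbolic ε (ℚₚ.<⇒≤ 0<ε)) (withOrigin r) (names-spliced ε N near)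
      q′k≡qk = stable (withOrigin r) q′ (λ i i<N → cong (λ c → pair c 0) (sym (splice-< N (code m 0ℚ) (code m ε) i i<N))) out′
  in Equivalence.from (outer′ z) (k , subst (λ c → z ∈ᵇ decodeBall (suc m) (proj₂ (unpair c))) (sym q′k≡qk) z∈ball)
       (target∈ ε 0<ε ε≤1)
  where
  open Names B (ComputableCover.positive cover)
  p : ℕ → ℕ
  p = withOrigin (λ _ → code m 0ℚ)
  z : Point (suc m)
  z = onAxis (const 2ℚ)
  hyperbolic : ∀ ε → 0ℚ ≤′ ε → HyperbolicEquilibrium (F (perturb {m} ε)) 0ⁿ
  hyperbolic ε 0≤ε = F-hyperbolic (perturb ε) λ { zero → 0≤ε ; (suc _) → ℚₚ.≤-refl }
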